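{- If $k\le p$ and $G\subset\mathbb{F}_q^k$ is an arc of size $2k-2$, then the column space of the matrix $H_G^{\uparrow 0}$ contains the vector $v\in\mathbb{F}_q^{\binom{2k-2}{k-1}}$ with $v_i=1$ for $i\in\{1,\dots,k\}$ and $v_i=0$ otherwise. Hence, if $k\le p$ and $k\ne (q+1)/2$, then the normal rational curve $\mathcal{R}_k$ is the unique arc in $\mathbb{F}_q^k$ of size $q+1$ up to linear equivalence.
   Context: $\mathbb{F}_q$ is a finite field of order $q$ and characteristic $p$. An arc in $\mathbb{F}_q^k$ is an ordered family of at least $k$ vectors in which every subfamily of size $k$ is a basis; subfamilies inherit the order. Two arcs $G,G'$ are linearly equivalent if, for a basis $B$, the matrix whose columns are the vectors of $G$ in coordinates w.r.t. $B$ can be transformed into the corresponding matrix of $G'$ by elementary row operations, column permutations, and multiplying columns by nonzero scalars. The normal rational curve is $\mathcal{R}_k=\{(1,t,\dots,t^{k-1}): t\in\mathbb{F}_q\}\cup\{(0,\dots,0,1)\}$. For an ordered set, a subset $A$ precedes $A'$ in colex order if the largest element of $A\triangle A'$ lies in $A'$. For an arc $G$, $H_G^{\uparrow 0}$ is the $0/1$ matrix with rows indexed by the $(k-1)$-subsets $C$ of $G$ listed in colex order, columns indexed by the $(k-2)$-subsets $A$ of $G$, and $(C,A)$-entry $1$ if $A\subset C$ and $0$ otherwise; the coordinates of $v$ are numbered according to this row order. -}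

module Defs where

open import Level using (0ℓ)
open import Data.Nat as ℕ using (ℕ; zero; suc; _<_; _≡ᵇ_; _<ᵇ_)
open import Data.Fin using (Fin; zero; suc; toℕ; _<_)
open import Data.Fin.Permutation using (Permutation′; _⟨$⟩ʳ_)
open import Data.Bool using (Bool; true; false; if_then_else_; _∧_; not)
open import Data.Vec using (Vec; []; _∷_)
open import Data.List using (List; []; _∷_; _++_; map; filter; length; foldr)
open import Data.Maybe using (Maybe; just; nothing)
import Data.Maybe as Maybe
open import Data.Product using (Σ; ∃; _×_; _,_)
open import Relation.Nullary using (¬_)
open import Relation.Binary.PropositionalEquality using (_≡_; _≢_)
open import Relation.Binary.Construct.Closure.ReflexiveTransitive using (Star)
open import Relation.Unary using (Decidable)
open import Function.Bundles using (_↔_)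
open import Algebra.Structures using (IsCommutativeRing)

record FiniteField : Set₁ where
  infixl 6 _+_
  infixl 7 _*_
  field
    Carrier : Set
    _+_ _*_ : Carrier → Carrier → Carrier
    -_      : Carrier → Carrier
    0# 1#   : Carrier
    isCommutativeRing : IsCommutativeRing _≡_ _+_ _*_ -_ 0# 1#
    0≢1     : 0# ≢ 1#
    inverse : ∀ x → x ≢ 0# → ∃ λ y → x * y ≡ 1#
    q       : ℕ
    enum    : Fin q ↔ Carrier

module _ (F : FiniteField) where
  open FiniteField F

  _×1 : ℕ → Carrier
  zero ×1 = 0#
  suc n ×1 = 1# + (n ×1)

  IsCharacteristic : ℕ → Set
  IsCharacteristic p =
    0 ℕ.< p × (p ×1 ≡ 0#) × (∀ m → 0 ℕ.< m → m ℕ.< p → m ×1 ≢ 0#)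

  pow : Carrier → ℕ → Carrier
  pow t zero = 1#
  pow t (suc n) = t * pow t n

  ∑ : (m : ℕ) → (Fin m → Carrier) → Carrier
  ∑ zero f = 0#
  ∑ (suc m) f = f zero + ∑ m (λ i → f (suc i))

  ∑L : {A : Set} → List A → (A → Carrier) → Carrier
  ∑L xs f = foldr (λ x s → f x + s) 0# xs

  Vecᶠ : ℕ → Set
  Vecᶠ k = Fin k → Carrier

  LinIndep : ∀ {k m} → (Fin m → Vecᶠ k) → Set
  LinIndep {k} {m} vs =
    ∀ (c : Fin m → Carrier) → (∀ r → ∑ m (λ i → c i * vs i r) ≡ 0#) → ∀ i → c i ≡ 0#

  Spans : ∀ {k m} → (Fin m → Vecᶠ k) → Set
  Spans {k} {m} vs =
    ∀ (w : Vecᶠ k) → ∃ λ (c : Fin m → Carrier) → ∀ r → ∑ m (λ i → c i * vs i r) ≡ w r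

  IsBasis : ∀ {k m} → (Fin m → Vecᶠ k) → Set
  IsBasis vs = LinIndep vs × Spans vs

  -- strictly increasing maps Fin k → Fin n (= k-subfamilies with inherited order)
  StrictlyIncreasing : ∀ {k n} → (Fin k → Fin n) → Set
  StrictlyIncreasing s = ∀ i j → i Data.Fin.< j → s i Data.Fin.< s j

  IsArc : ∀ {k n} → (Fin n → Vecᶠ k) → Set
  IsArc {k} {n} G =
    k ℕ.≤ n × (∀ (s : Fin k → Fin n) → StrictlyIncreasing s → IsBasis (λ i → G (s i)))

  Mat : ℕ → ℕ → Set
  Mat k n = Fin k → Fin n → Carrier

  matrixOf : ∀ {k n} → (Fin n → Vecᶠ k) → Mat k n
  matrixOf G r c = G c r

  data ElemStep {k n : ℕ} (M M' : Mat k n) : Set where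
    rowSwap  : (i j : Fin k) →
               (∀ r c → M' r c ≡ (if toℕ r ≡ᵇ toℕ i then M j c
                                  else if toℕ r ≡ᵇ toℕ j then M i c else M r c)) →
               ElemStep M M'
    rowScale : (i : Fin k) (λ' : Carrier) → λ' ≢ 0# →
               (∀ r c → M' r c ≡ (if toℕ r ≡ᵇ toℕ i then λ' * M r c else M r c)) →
               ElemStep M M'
    rowAdd   : (i j : Fin k) → i ≢ j → (λ' : Carrier) →
               (∀ r c → M' r c ≡ (if toℕ r ≡ᵇ toℕ i then M i c + λ' * M j c else M r c)) →
               ElemStep M M'
    colPerm  : (σ : Permutation′ n) →
               (∀ r c → M' r c ≡ M r (σ ⟨$⟩ʳ c)) →
               ElemStep M M'
    colScale : (j : Fin n) (λ' : Carrier) → λ' ≢ 0# →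
               (∀ r c → M' r c ≡ (if toℕ c ≡ᵇ toℕ j then λ' * M r c else M r c)) →
               ElemStep M M'

  LinearlyEquivalent : ∀ {k n} → (Fin n → Vecᶠ k) → (Fin n → Vecᶠ k) → Set
  LinearlyEquivalent G G' = Star ElemStep (matrixOf G) (matrixOf G')

  -- the normal rational curve R_k as an ordered family of q+1 vectors:
  -- index i < q ↦ (1, t, …, t^{k-1}) with t = enum(i); index q ↦ (0,…,0,1)

  unlast : ∀ {n} → Fin (suc n) → Maybe (Fin n)
  unlast {zero} zero = nothing
  unlast {suc n} zero = just zero
  unlast {suc n} (suc i) = Maybe.map suc (unlast i)

  NRC : (k : ℕ) → Fin (suc q) → Vecᶠ k
  NRC k i r with unlast i
  ... | just j  = pow (Function.Bundles.Inverse.to enum j) (toℕ r)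
  ... | nothing = if toℕ r ≡ᵇ ℕ.pred k then 1# else 0#

-- subsets of an n-element ordered index set, as boolean vectors
-- (position 0 = first/smallest element)

allSubsets : (n : ℕ) → List (Vec Bool n)
allSubsets zero = [] ∷ []
allSubsets (suc n) = map (false ∷_) (allSubsets n) ++ map (true ∷_) (allSubsets n)

size : ∀ {n} → Vec Bool n → ℕ
size [] = 0
size (false ∷ xs) = size xs
size (true ∷ xs) = suc (size xs)

_==ᵥ_ : ∀ {n} → Vec Bool n → Vec Bool n → Bool
[] ==ᵥ [] = true
(a ∷ as) ==ᵥ (b ∷ bs) = (if a then b else not b) ∧ (as ==ᵥ bs)

_⊆ᵇ_ : ∀ {n} → Vec Bool n → Vec Bool n → Bool
[] ⊆ᵇ [] = true
(a ∷ as) ⊆ᵇ (b ∷ bs) = (if a then b else true) ∧ (as ⊆ᵇ bs)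

-- colex order: A precedes A' iff the largest element of A △ A' lies in A'
colexLT : ∀ {n} → Vec Bool n → Vec Bool n → Bool
colexLT [] [] = false
colexLT (a ∷ as) (b ∷ bs) = if as ==ᵥ bs then (not a ∧ b) else colexLT as bs

-- position (0-based) of the m-subset C in the colex listing of all m-subsets
colexRank : ∀ {n} → (m : ℕ) → Vec Bool n → ℕ
colexRank {n} m C =
  length (filter (λ C' → (size C' ℕ.≟ m) Relation.Nullary.×-dec
                          Data.Bool.T? (colexLT C' C))
                 (allSubsets n))

module _ (F : FiniteField) where
  open FiniteField F

  -- the vector v ∈ F^{binom(n, k-1)}, indexed by (k-1)-subsets C in colex order:
  -- v_C = 1 iff the (1-based) position of C lies in {1,…,k}
  vTarget : (k n : ℕ) → Vec Bool n → Carrier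
  vTarget k n C = if colexRank (ℕ.pred k) C <ᵇ k then 1# else 0#

  -- v lies in the F-column space of H_G^{↑0} (rows: (k-1)-subsets C,
  -- columns: (k-2)-subsets A, entry 1 iff A ⊂ C)
  InColumnSpaceH0 : (k n : ℕ) → Set
  InColumnSpaceH0 k n =
    ∃ λ (x : Vec Bool n → Carrier) →
      ∀ (C : Vec Bool n) → size C ≡ ℕ.pred k →
        ∑L F (filter (λ A → size A ℕ.≟ (k ℕ.∸ 2)) (allSubsets n))
           (λ A → x A * (if A ⊆ᵇ C then 1# else 0#))
        ≡ vTarget k n C

{-# OPTIONS --safe #-}

-- For the first part, give the column A the coefficient X_j, where j is the number of elements of A among the last k − 2
-- elements of G: the equations say (k − 1 − j) X_j + j X_{j−1} = δ_{j0}, and they are solvable because k ≤ p.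
--
-- For the second part, let S be an arc of size q + 1 and let E be a subset of S of size 2k − 2.  For a (k − 1)-subset C of E put
--   D_C = ∏_{y ∈ S∖C} det(y, C) · ∏_{u ∈ E∖C} det(u, C).
-- Since x^q = x, a change of sign of C changes nothing.  For every (k − 2)-subset A of E one has Σ_{C ⊃ A} 1/D_C = 0: modulo A
-- the arc consists of pairwise independent vectors of a plane, and 1/∏_{y ∈ S∖C} det(y, C) agrees up to a constant with the value
-- of a form of degree k − 2, the product of the tangents at A, so that Lagrange interpolation at k points applies.  Hence
-- (1/D_C)_C is orthogonal to the column space of the inclusion matrix, and the first part gives Σ 1/D_C = 0, the sum being over the
-- (k − 1)-subsets C of a basis K contained in E.  In coordinates with respect to K this reads
--   Σ_i β_i ∏_{u ∈ U} u_i⁻¹ = 0 for all (k − 2)-subsets U of S∖K.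
-- If q ≥ 2k it follows that the vectors (u_i⁻¹)_i with u ∈ S∖K lie in a plane, so that u_i = 1/[P_i, Q_u] for vectors P_i, Q_u of
-- F², which is the shape of the normal rational curve in the coordinates given by k of its points.  The case q + 2 ≤ 2k is reduced
-- to this one by passing to the dual arc, that is by transposing the matrix (u_i).
module Submission where

open import Defs
open import Data.Nat as ℕ using (ℕ; zero; suc)
import Data.Nat.Properties as ℕₚ
open import Data.Fin as Fin using (Fin; zero; suc; toℕ; splitAt; join)
import Data.Fin.Properties as Finₚ
open import Data.Bool as Bool using (Bool; true; false; if_then_else_; _∧_; not)
open import Data.Bool.Properties using (∧-zeroʳ)
open import Data.Maybe as Maybe using (Maybe; just; nothing)
import Data.Maybe.Properties as Maybeₚ
open import Data.Vec as Vec using (Vec; []; _∷_)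
open import Data.List using (List; []; _∷_; _++_; map; length; filter; allFin; take; drop; tabulate; lookup; replicate; applyUpTo)
open import Data.List.Properties as Listₚ using (length-map; length-++)
open import Data.List.Membership.Propositional using (_∈_; _∉_)
open import Data.List.Membership.Propositional.Properties using (∈-map⁺; ∈-map⁻; ∈-++⁻; ∈-++⁺ˡ; ∈-++⁺ʳ; ∈-∃++; ∈-allFin; ∈-filter⁻; ∈-lookup)
open import Data.List.Relation.Unary.Any using (here; there; index)
open import Data.List.Relation.Unary.Any.Properties using (lookup-index)
import Data.List.Relation.Unary.Sorted.TotalOrder.Properties as Sortedₚ
open import Data.List.Relation.Unary.All as All using (All; []; _∷_)
open import Data.List.Relation.Unary.AllPairs as AllPairs using (AllPairs; []; _∷_)
open import Data.List.Relation.Unary.Unique.Propositional using (Unique)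
open import Data.List.Relation.Unary.Unique.Propositional.Properties as Uniqueₚ using (allFin⁺)
open import Data.List.Relation.Binary.Permutation.Propositional using (_↭_; refl; prep; swap; trans; ↭-sym; ↭-trans; ↭-reflexive)
open import Data.List.Relation.Binary.Permutation.Propositional.Properties as Permₚ using (↭-length; shift; ∈-resp-↭)
open import Data.Product using (∃; _×_; _,_; proj₁; proj₂)
open import Data.Sum as Sum using (_⊎_; inj₁; inj₂; [_,_]′)
import Data.Sum.Properties as Sumₚ
open import Data.Empty using (⊥; ⊥-elim)
import Data.Vec.Properties as Vecₚ
open import Relation.Nullary using (¬_; Dec; yes; no; does; _×-dec_; ¬?)
open import Relation.Nullary.Decidable using (map′; decidable-stable)
open import Relation.Unary using (Decidable)
open import Relation.Binary.PropositionalEquality using (_≡_; _≢_; refl; sym; cong; cong₂; subst; module ≡-Reasoning) renaming (trans to _∙_)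
open import Relation.Binary.Definitions using (tri<; tri≈; tri>)
open import Function using (_∘_; Inverse)
import Data.Fin.Permutation as Perm
open import Relation.Binary.Construct.Closure.ReflexiveTransitive using (Star; ε; _◅_; _◅◅_)
open import Algebra.Bundles using (CommutativeRing; RawRing)
open import Algebra.Solver.Ring.AlmostCommutativeRing using (fromCommutativeRing; AlmostCommutativeRing; _-Raw-AlmostCommutative⟶_)
import Algebra.Solver.Ring
import Algebra.Properties.Ring

-- The factors of E∖C occur twice in D_C, once as part of S∖C and once on their own. This gives D_C
-- the degree |S∖C| + |E∖C| = q + 1 in C, so that a scalar c attached to C enters as c^(q+1) = c²
-- and normalisations of determinants can be split off. The second copy also supplies the
-- denominator of the Lagrange term, the first one being absorbed in the value of the tangents. The
-- constant β_i is the inverse of the product of the i-th coordinates of all of S∖K. To reach a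
-- plane, fix a (k - 2)-subset W of S∖K and exchange one w in W for some z outside W. The identity
-- for the new set says that (β_i z_i⁻¹ ∏_{u ∈ W} u_i⁻¹)_i is orthogonal to w. Varying w puts this
-- vector into the orthogonal complement of W, which is two-dimensional and does not depend on z.
-- Comparing three such z requires k + 1 ≤ m with m = |S∖K| = q + 1 - k, which is the bound q ≥ 2k.
-- Transposition interchanges k and m, so exactly the case k = m, that is 2k = q + 1, escapes both.

module ArcClassification (F : FiniteField) where

  open FiniteField F

  private
    R : CommutativeRing _ _
    R = record { isCommutativeRing = isCommutativeRing }

  open CommutativeRing R using (+-comm; +-assoc; +-identityˡ; +-identityʳ; *-comm; *-assoc; *-identityˡ; *-identityʳ; zeroˡ; zeroʳ; -‿inverseˡ; -‿inverseʳ; distribˡ; distribʳ)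
  open Algebra.Properties.Ring (CommutativeRing.ring R) using (-‿distribˡ-*; -‿distribʳ-*; -‿involutive; -0#≈0#; -‿+-comm)

  -- Arithmetic in a finite field

  _≟_ : (x y : Carrier) → Dec (x ≡ y)
  x ≟ y = map′ (λ e → sym (Inverse.strictlyInverseˡ enum x) ∙ (cong (Inverse.to enum) e ∙ Inverse.strictlyInverseˡ enum y))
               (cong (Inverse.from enum)) (Inverse.from enum x Fin.≟ Inverse.from enum y)

  nat : ℕ → Carrier
  nat n = _×1 F n

  nat-+ : ∀ a b → nat (a ℕ.+ b) ≡ nat a + nat b
  nat-+ zero b = sym (+-identityˡ _)
  nat-+ (suc a) b = cong (1# +_) (nat-+ a b) ∙ sym (+-assoc _ _ _)

  nat-* : ∀ a b → nat (a ℕ.* b) ≡ nat a * nat b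
  nat-* zero b = sym (zeroˡ _)
  nat-* (suc a) b = nat-+ b (a ℕ.* b) ∙ (cong₂ _+_ (sym (*-identityˡ _)) (nat-* a b) ∙ sym (distribʳ _ _ _))

  -- The coefficients of the ring solver are formal differences of naturals.
  module RingSolver where
    private
      ACR : AlmostCommutativeRing _ _
      ACR = fromCommutativeRing R

      Coeff : RawRing _ _
      Coeff = record
        { Carrier = ℕ × ℕ
        ; _≈_ = _≡_
        ; _+_ = λ (a , b) (c , d) → a ℕ.+ c , b ℕ.+ d
        ; _*_ = λ (a , b) (c , d) → a ℕ.* c ℕ.+ b ℕ.* d , a ℕ.* d ℕ.+ b ℕ.* c
        ; -_ = λ (a , b) → b , a
        ; 0# = 0 , 0
        ; 1# = 1 , 0
        }

      -- 0 and 1 are treated separately so that they denote 0# and 1# definitionally.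
      ⟦_⟧ : ℕ × ℕ → Carrier
      ⟦ 0 , 0 ⟧ = 0#
      ⟦ 1 , 0 ⟧ = 1#
      ⟦ a , b ⟧ = nat a + - nat b

      val : ∀ a b → ⟦ a , b ⟧ ≡ nat a + - nat b
      val 0 0 = sym (-‿inverseʳ 0#)
      val 1 0 = sym (cong₂ _+_ (+-identityʳ 1#) -0#≈0# ∙ +-identityʳ 1#)
      val 0 (suc b) = refl
      val 1 (suc b) = refl
      val (suc (suc a)) b = refl

      middle4 : ∀ a b c d → (a + b) + (c + d) ≡ (a + c) + (b + d)
      middle4 a b c d = begin
        (a + b) + (c + d) ≡⟨ +-assoc a b (c + d) ⟩
        a + (b + (c + d)) ≡⟨ cong (a +_) (sym (+-assoc b c d)) ⟩
        a + ((b + c) + d) ≡⟨ cong (λ z → a + (z + d)) (+-comm b c) ⟩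
        a + ((c + b) + d) ≡⟨ cong (a +_) (+-assoc c b d) ⟩
        a + (c + (b + d)) ≡⟨ sym (+-assoc a c (b + d)) ⟩
        (a + c) + (b + d) ∎
        where open ≡-Reasoning

      +-homo : ∀ x y → ⟦ RawRing._+_ Coeff x y ⟧ ≡ ⟦ x ⟧ + ⟦ y ⟧
      +-homo (a , b) (c , d) = begin
        _ ≡⟨ val (a ℕ.+ c) (b ℕ.+ d) ⟩
        nat (a ℕ.+ c) + - nat (b ℕ.+ d) ≡⟨ cong₂ (λ u v → u + - v) (nat-+ a c) (nat-+ b d) ⟩
        (nat a + nat c) + - (nat b + nat d) ≡⟨ cong ((nat a + nat c) +_) (sym (-‿+-comm (nat b) (nat d))) ⟩
        (nat a + nat c) + (- nat b + - nat d) ≡⟨ middle4 _ _ _ _ ⟩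
        (nat a + - nat b) + (nat c + - nat d) ≡⟨ sym (cong₂ _+_ (val a b) (val c d)) ⟩
        ⟦ a , b ⟧ + ⟦ c , d ⟧ ∎
        where open ≡-Reasoning

      *-homo : ∀ x y → ⟦ RawRing._*_ Coeff x y ⟧ ≡ ⟦ x ⟧ * ⟦ y ⟧
      *-homo (a , b) (c , d) = begin
        _ ≡⟨ val (a ℕ.* c ℕ.+ b ℕ.* d) (a ℕ.* d ℕ.+ b ℕ.* c) ⟩
        nat (a ℕ.* c ℕ.+ b ℕ.* d) + - nat (a ℕ.* d ℕ.+ b ℕ.* c)
          ≡⟨ cong₂ (λ u v → u + - v) (nat-+ (a ℕ.* c) (b ℕ.* d) ∙ cong₂ _+_ (nat-* a c) (nat-* b d))
                                     (nat-+ (a ℕ.* d) (b ℕ.* c) ∙ cong₂ _+_ (nat-* a d) (nat-* b c)) ⟩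
        (A * C + B * D) + - (A * D + B * C)
          ≡⟨ cong ((A * C + B * D) +_) (sym (-‿+-comm _ _)) ⟩
        (A * C + B * D) + (- (A * D) + - (B * C))
          ≡⟨ middle4 _ _ _ _ ⟩
        (A * C + - (A * D)) + (B * D + - (B * C))
          ≡⟨ cong₂ _+_ (cong (A * C +_) (-‿distribʳ-* A D))
                       (+-comm _ _ ∙ cong₂ _+_ (-‿distribˡ-* B C) (sym (-‿involutive _) ∙ (cong -_ (-‿distribˡ-* B D) ∙ -‿distribʳ-* (- B) D))) ⟩
        (A * C + A * - D) + (- B * C + - B * - D)
          ≡⟨ cong₂ _+_ (sym (distribˡ A C (- D))) (sym (distribˡ (- B) C (- D))) ⟩
        A * (C + - D) + - B * (C + - D)
          ≡⟨ sym (distribʳ (C + - D) A (- B)) ⟩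
        (A + - B) * (C + - D)
          ≡⟨ sym (cong₂ _*_ (val a b) (val c d)) ⟩
        ⟦ a , b ⟧ * ⟦ c , d ⟧ ∎
        where
          open ≡-Reasoning
          A = nat a ; B = nat b ; C = nat c ; D = nat d

      morphism : Coeff -Raw-AlmostCommutative⟶ ACR
      morphism = record
        { ⟦_⟧ = ⟦_⟧
        ; +-homo = +-homo
        ; *-homo = *-homo
        ; -‿homo = λ (a , b) → val b a ∙ sym (cong -_ (val a b) ∙ (sym (-‿+-comm (nat a) (- nat b)) ∙ (cong (- nat a +_) (-‿involutive _) ∙ +-comm _ _)))
        ; 0-homo = refl
        ; 1-homo = refl
        }

      cross : ∀ a b c d → a + d ≡ c + b → a + - b ≡ c + - d
      cross a b c d e = begin
        a + - b ≡⟨ sym (+-identityʳ _) ⟩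
        (a + - b) + 0# ≡⟨ cong ((a + - b) +_) (sym (-‿inverseʳ d)) ⟩
        (a + - b) + (d + - d) ≡⟨ middle4 _ _ _ _ ⟩
        (a + d) + (- b + - d) ≡⟨ cong (_+ (- b + - d)) e ⟩
        (c + b) + (- b + - d) ≡⟨ cong ((c + b) +_) (+-comm _ _) ⟩
        (c + b) + (- d + - b) ≡⟨ middle4 _ _ _ _ ⟩
        (c + - d) + (b + - b) ≡⟨ cong ((c + - d) +_) (-‿inverseʳ b) ⟩
        (c + - d) + 0# ≡⟨ +-identityʳ _ ⟩
        c + - d ∎
        where open ≡-Reasoning

      weak : ∀ x y → Maybe (⟦ x ⟧ ≡ ⟦ y ⟧)
      weak (a , b) (c , d) with a ℕ.+ d ℕ.≟ c ℕ.+ b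
      ... | yes e = just (val a b ∙ (cross (nat a) (nat b) (nat c) (nat d) (sym (nat-+ a d) ∙ (cong nat e ∙ nat-+ c b)) ∙ sym (val c d)))
      ... | no _ = nothing

    open Algebra.Solver.Ring Coeff ACR morphism weak public using (solve; con; _:=_; _:+_; _:*_; :-_; _:-_; Polynomial)

    :0 :1 : ∀ {n} → Polynomial n
    :0 = con (0 , 0)
    :1 = con (1 , 0)

  open RingSolver

  -- inverses, with the convention 0⁻¹ = 0
  inv : Carrier → Carrier
  inv x with x ≟ 0#
  ... | yes _ = 0#
  ... | no x≢0 = proj₁ (inverse x x≢0)

  inv-0 : inv 0# ≡ 0#
  inv-0 with 0# ≟ 0#
  ... | yes _ = refl
  ... | no ne = ⊥-elim (ne refl)

  inv-r : ∀ {x} → x ≢ 0# → x * inv x ≡ 1#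
  inv-r {x} ne with x ≟ 0#
  ... | yes e = ⊥-elim (ne e)
  ... | no x≢0 = proj₂ (inverse x x≢0)

  inv-l : ∀ {x} → x ≢ 0# → inv x * x ≡ 1#
  inv-l ne = *-comm _ _ ∙ inv-r ne

  *-cancelˡ : ∀ {x y z} → x ≢ 0# → x * y ≡ x * z → y ≡ z
  *-cancelˡ {x} {y} {z} ne e = begin
    y ≡⟨ sym (*-identityˡ y) ⟩
    1# * y ≡⟨ cong (_* y) (sym (inv-l ne)) ⟩
    inv x * x * y ≡⟨ *-assoc _ _ _ ⟩
    inv x * (x * y) ≡⟨ cong (inv x *_) e ⟩
    inv x * (x * z) ≡⟨ sym (*-assoc _ _ _) ⟩
    inv x * x * z ≡⟨ cong (_* z) (inv-l ne) ⟩
    1# * z ≡⟨ *-identityˡ z ⟩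
    z ∎
    where open ≡-Reasoning

  *≡0 : ∀ {x y} → x ≢ 0# → x * y ≡ 0# → y ≡ 0#
  *≡0 ne e = *-cancelˡ ne (e ∙ sym (zeroʳ _))

  *≢0 : ∀ {x y} → x ≢ 0# → y ≢ 0# → x * y ≢ 0#
  *≢0 nx ny e = ny (*≡0 nx e)

  ≢0ʳ : ∀ {x y} → x * y ≢ 0# → y ≢ 0#
  ≢0ʳ ne e = ne (cong (_ *_) e ∙ zeroʳ _)

  1≢0 : 1# ≢ 0#
  1≢0 e = 0≢1 (sym e)

  inv≢0 : ∀ {x} → x ≢ 0# → inv x ≢ 0#
  inv≢0 {x} ne e = 1≢0 (sym (inv-r ne) ∙ (cong (x *_) e ∙ zeroʳ x))

  inv-unique : ∀ {x y} → x ≢ 0# → x * y ≡ 1# → y ≡ inv x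
  inv-unique ne e = *-cancelˡ ne (e ∙ sym (inv-r ne))

  inv-* : ∀ x y → inv (x * y) ≡ inv x * inv y
  inv-* x y = go (x ≟ 0#) (y ≟ 0#)
    where
      open ≡-Reasoning
      go : Dec (x ≡ 0#) → Dec (y ≡ 0#) → inv (x * y) ≡ inv x * inv y
      go (yes e) _ = begin
        inv (x * y) ≡⟨ cong (λ z → inv (z * y)) e ⟩
        inv (0# * y) ≡⟨ cong inv (zeroˡ y) ⟩
        inv 0# ≡⟨ inv-0 ⟩
        0# ≡⟨ sym (zeroˡ _) ⟩
        0# * inv y ≡⟨ cong (_* inv y) (sym inv-0 ∙ cong inv (sym e)) ⟩
        inv x * inv y ∎
      go (no _) (yes e) = begin
        inv (x * y) ≡⟨ cong (λ z → inv (x * z)) e ⟩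
        inv (x * 0#) ≡⟨ cong inv (zeroʳ x) ⟩
        inv 0# ≡⟨ inv-0 ⟩
        0# ≡⟨ sym (zeroʳ _) ⟩
        inv x * 0# ≡⟨ cong (inv x *_) (sym inv-0 ∙ cong inv (sym e)) ⟩
        inv x * inv y ∎
      go (no nx) (no ny) = sym (inv-unique (*≢0 nx ny) (begin
        x * y * (inv x * inv y) ≡⟨ solve 4 (λ x y i j → x :* y :* (i :* j) := (x :* i) :* (y :* j)) refl x y (inv x) (inv y) ⟩
        (x * inv x) * (y * inv y) ≡⟨ cong₂ _*_ (inv-r nx) (inv-r ny) ⟩
        1# * 1# ≡⟨ *-identityˡ 1# ⟩
        1# ∎))

  inv-inv : ∀ x → inv (inv x) ≡ x
  inv-inv x = go (x ≟ 0#)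
    where
      go : Dec (x ≡ 0#) → inv (inv x) ≡ x
      go (yes e) = cong (inv ∘ inv) e ∙ (cong inv inv-0 ∙ (inv-0 ∙ sym e))
      go (no nx) = sym (inv-unique (inv≢0 nx) (inv-l nx))

  x-y≡0⇒x≡y : ∀ {x y} → x + - y ≡ 0# → x ≡ y
  x-y≡0⇒x≡y {x} {y} e = solve 2 (λ x y → x := (x :+ :- y) :+ y) refl x y ∙ (cong (_+ y) e ∙ +-identityˡ y)

  pw : Carrier → ℕ → Carrier
  pw = pow F

  pw-+ : ∀ x a b → pw x (a ℕ.+ b) ≡ pw x a * pw x b
  pw-+ x zero b = sym (*-identityˡ _)
  pw-+ x (suc a) b = cong (x *_) (pw-+ x a b) ∙ sym (*-assoc _ _ _)

  pw≢0 : ∀ {x} n → x ≢ 0# → pw x n ≢ 0#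
  pw≢0 zero ne = 1≢0
  pw≢0 (suc n) ne = *≢0 ne (pw≢0 n ne)

  pw-1 : ∀ n → pw 1# n ≡ 1#
  pw-1 zero = refl
  pw-1 (suc n) = *-identityˡ _ ∙ pw-1 n

  pw-* : ∀ x y n → pw (x * y) n ≡ pw x n * pw y n
  pw-* x y zero = sym (*-identityˡ _)
  pw-* x y (suc n) = cong (x * y *_) (pw-* x y n) ∙ solve 4 (λ x y a b → x :* y :* (a :* b) := (x :* a) :* (y :* b)) refl x y (pw x n) (pw y n)

  -- Finite sums and products over lists

  sumL : {A : Set} → List A → (A → Carrier) → Carrier
  sumL = ∑L F

  prodL : {A : Set} → List A → (A → Carrier) → Carrier
  prodL [] f = 1#
  prodL (x ∷ xs) f = f x * prodL xs f

  sum-cong : {A : Set} (xs : List A) {f g : A → Carrier} → (∀ {x} → x ∈ xs → f x ≡ g x) → sumL xs f ≡ sumL xs g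
  sum-cong [] e = refl
  sum-cong (x ∷ xs) e = cong₂ _+_ (e (here refl)) (sum-cong xs (λ m → e (there m)))

  sum-≗ : {A : Set} (xs : List A) {f g : A → Carrier} → (∀ x → f x ≡ g x) → sumL xs f ≡ sumL xs g
  sum-≗ xs e = sum-cong xs (λ {x} _ → e x)

  sum-0 : {A : Set} (xs : List A) {f : A → Carrier} → (∀ {x} → x ∈ xs → f x ≡ 0#) → sumL xs f ≡ 0#
  sum-0 [] e = refl
  sum-0 (x ∷ xs) e = cong₂ _+_ (e (here refl)) (sum-0 xs (λ m → e (there m))) ∙ +-identityˡ 0#

  sum-++ : {A : Set} (xs ys : List A) {f : A → Carrier} → sumL (xs ++ ys) f ≡ sumL xs f + sumL ys f
  sum-++ [] ys = sym (+-identityˡ _)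
  sum-++ (x ∷ xs) ys = cong (_ +_) (sum-++ xs ys) ∙ sym (+-assoc _ _ _)

  sum-map : {A B : Set} (h : A → B) (xs : List A) {f : B → Carrier} → sumL (map h xs) f ≡ sumL xs (f ∘ h)
  sum-map h [] = refl
  sum-map h (x ∷ xs) = cong (_ +_) (sum-map h xs)

  sum-+ : {A : Set} (xs : List A) (f g : A → Carrier) → sumL xs (λ x → f x + g x) ≡ sumL xs f + sumL xs g
  sum-+ [] f g = sym (+-identityˡ _)
  sum-+ (x ∷ xs) f g = cong (_ +_) (sum-+ xs f g) ∙ solve 4 (λ a b c d → a :+ b :+ (c :+ d) := a :+ c :+ (b :+ d)) refl (f x) (g x) _ _

  sum-*ˡ : {A : Set} (xs : List A) (c : Carrier) (f : A → Carrier) → sumL xs (λ x → c * f x) ≡ c * sumL xs f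
  sum-*ˡ [] c f = sym (zeroʳ c)
  sum-*ˡ (x ∷ xs) c f = cong (_ +_) (sum-*ˡ xs c f) ∙ sym (distribˡ _ _ _)

  sum-swap : {A B : Set} (xs : List A) (ys : List B) (f : A → B → Carrier) →
    sumL xs (λ x → sumL ys (f x)) ≡ sumL ys (λ y → sumL xs (λ x → f x y))
  sum-swap [] ys f = sym (sum-0 ys (λ _ → refl))
  sum-swap (x ∷ xs) ys f = cong (_ +_) (sum-swap xs ys f) ∙ sym (sum-+ ys (f x) _)

  sum-↭ : {A : Set} {xs ys : List A} (f : A → Carrier) → xs ↭ ys → sumL xs f ≡ sumL ys f
  sum-↭ f refl = refl
  sum-↭ f (prep x p) = cong (f x +_) (sum-↭ f p)
  sum-↭ f (swap x y p) = cong (λ s → f x + (f y + s)) (sum-↭ f p) ∙ solve 3 (λ a b c → a :+ (b :+ c) := b :+ (a :+ c)) refl _ _ _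
  sum-↭ f (trans p r) = sum-↭ f p ∙ sum-↭ f r

  prod-cong : {A : Set} (xs : List A) {f g : A → Carrier} → (∀ {x} → x ∈ xs → f x ≡ g x) → prodL xs f ≡ prodL xs g
  prod-cong [] e = refl
  prod-cong (x ∷ xs) e = cong₂ _*_ (e (here refl)) (prod-cong xs (λ m → e (there m)))

  prod-++ : {A : Set} (xs ys : List A) {f : A → Carrier} → prodL (xs ++ ys) f ≡ prodL xs f * prodL ys f
  prod-++ [] ys = sym (*-identityˡ _)
  prod-++ (x ∷ xs) ys = cong (_ *_) (prod-++ xs ys) ∙ sym (*-assoc _ _ _)

  prod-map : {A B : Set} (h : A → B) (xs : List A) {f : B → Carrier} → prodL (map h xs) f ≡ prodL xs (f ∘ h)
  prod-map h [] = refl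
  prod-map h (x ∷ xs) = cong (_ *_) (prod-map h xs)

  prod-* : {A : Set} (xs : List A) (f g : A → Carrier) → prodL xs (λ x → f x * g x) ≡ prodL xs f * prodL xs g
  prod-* [] f g = sym (*-identityˡ _)
  prod-* (x ∷ xs) f g = cong (_ *_) (prod-* xs f g) ∙ solve 4 (λ a b c d → a :* b :* (c :* d) := a :* c :* (b :* d)) refl (f x) (g x) _ _

  prod-const : {A : Set} (xs : List A) (c : Carrier) → prodL xs (λ _ → c) ≡ pw c (length xs)
  prod-const [] c = refl
  prod-const (x ∷ xs) c = cong (c *_) (prod-const xs c)

  prod-↭ : {A : Set} {xs ys : List A} (f : A → Carrier) → xs ↭ ys → prodL xs f ≡ prodL ys f
  prod-↭ f refl = refl
  prod-↭ f (prep x p) = cong (f x *_) (prod-↭ f p)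
  prod-↭ f (swap x y p) = cong (λ s → f x * (f y * s)) (prod-↭ f p) ∙ solve 3 (λ a b c → a :* (b :* c) := b :* (a :* c)) refl _ _ _
  prod-↭ f (trans p r) = prod-↭ f p ∙ prod-↭ f r

  prod≢0 : {A : Set} (xs : List A) {f : A → Carrier} → (∀ {x} → x ∈ xs → f x ≢ 0#) → prodL xs f ≢ 0#
  prod≢0 [] ne = 1≢0
  prod≢0 (x ∷ xs) ne = *≢0 (ne (here refl)) (prod≢0 xs (λ m → ne (there m)))

  -- Interpolation on the projective line

  -- A node paired with the list of the remaining nodes: the shape of a term of Lagrange
  -- interpolation, obtained without comparing nodes for equality.
  sel : {A : Set} → List A → List (A × List A)
  sel [] = []
  sel (x ∷ xs) = (x , xs) ∷ map (λ p → proj₁ p , x ∷ proj₂ p) (sel xs)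

  sel-↭ : {A : Set} (xs : List A) {z : A} {rest : List A} → (z , rest) ∈ sel xs → xs ↭ z ∷ rest
  sel-↭ (x ∷ xs) (here refl) = refl
  sel-↭ (x ∷ xs) (there m) with ∈-map⁻ _ m
  ... | (z , r) , m′ , refl = trans (prep x (sel-↭ xs m′)) (swap x z refl)

  map-proj₁-sel : {A : Set} (xs : List A) → map proj₁ (sel xs) ≡ xs
  map-proj₁-sel [] = refl
  map-proj₁-sel (x ∷ xs) = cong (x ∷_) (sym (Listₚ.map-∘ (sel xs)) ∙ map-proj₁-sel xs)

  sel-map : {A B : Set} (h : A → B) (xs : List A) → sel (map h xs) ≡ map (λ p → h (proj₁ p) , map h (proj₂ p)) (sel xs)
  sel-map h [] = refl
  sel-map h (x ∷ xs) = cong (_ ∷_) (cong (map _) (sel-map h xs) ∙ (sym (Listₚ.map-∘ (sel xs)) ∙ Listₚ.map-∘ (sel xs)))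

  AllPairs-↭ : {A : Set} {R : A → A → Set} → (∀ {x y} → R x y → R y x) → {xs ys : List A} → xs ↭ ys → AllPairs R xs → AllPairs R ys
  AllPairs-↭ s refl ps = ps
  AllPairs-↭ s (prep x p) (r ∷ ps) = Permₚ.All-resp-↭ p r ∷ AllPairs-↭ s p ps
  AllPairs-↭ s (swap x y p) ((xy ∷ xr) ∷ (yr ∷ ps)) = (s xy ∷ Permₚ.All-resp-↭ p yr) ∷ (Permₚ.All-resp-↭ p xr ∷ AllPairs-↭ s p ps)
  AllPairs-↭ s (trans p r) ps = AllPairs-↭ s r (AllPairs-↭ s p ps)

  Unique-↭ : {A : Set} {xs ys : List A} → xs ↭ ys → Unique xs → Unique ys
  Unique-↭ = AllPairs-↭ (λ ne e → ne (sym e))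

  AllPairs-++ˡ : {A : Set} {R : A → A → Set} (xs : List A) {ys : List A} → AllPairs R (xs ++ ys) → AllPairs R xs
  AllPairs-++ˡ [] ps = []
  AllPairs-++ˡ (x ∷ xs) (r ∷ ps) = All.tabulate (λ m → All.lookup r (∈-++⁺ˡ m)) ∷ AllPairs-++ˡ xs ps

  ∉-Unique : {A : Set} {x : A} {xs : List A} → Unique (x ∷ xs) → x ∉ xs
  ∉-Unique (r ∷ _) m = All.lookup r m refl

  Point : Set
  Point = Carrier × Carrier

  -- The bracket [x, y], the determinant of two vectors of the plane. If it is nonzero, then x and y
  -- represent different points of the projective line.
  br : Point → Point → Carrier
  br (a , b) (c , d) = a * d + - (b * c)

  ap : Point → Point → Carrier
  ap (a , b) (c , d) = a * c + b * d

  br-anti : ∀ x y → br x y ≡ - br y x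
  br-anti (a , b) (c , d) = solve 4 (λ a b c d → a :* d :+ :- (b :* c) := :- (c :* b :+ :- (d :* a))) refl a b c d

  br-sym≢0 : ∀ {x y} → br x y ≢ 0# → br y x ≢ 0#
  br-sym≢0 {x} {y} ne e = ne (br-anti x y ∙ (cong -_ e ∙ -0#≈0#))

  -- The homogeneous analogue of f(z) / ∏ (z - u), whose sum over the nodes is a divided difference
  -- of f; here f is the product of the linear forms `φs`.
  lagrangeTerm : List Point → Point × List Point → Carrier
  lagrangeTerm φs (z , rest) = prodL φs (λ φ → ap φ z) * inv (prodL rest (br z))

  sum-sel₂ : {A : Set} (x y : A) (xs : List A) (f : A × List A → Carrier) →
    sumL (sel (x ∷ y ∷ xs)) f ≡ f (x , y ∷ xs) + (f (y , x ∷ xs) + sumL (sel xs) (λ p → f (proj₁ p , x ∷ y ∷ proj₂ p)))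
  sum-sel₂ x y xs f = cong (λ s → f (x , y ∷ xs) + (f (y , x ∷ xs) + s)) (sum-map _ (map _ (sel xs)) ∙ sum-map _ (sel xs))

  ∈-sel : {A : Set} (xs : List A) {z : A} {rest : List A} → (z , rest) ∈ sel xs → z ∈ xs
  ∈-sel xs m = ∈-resp-↭ (↭-sym (sel-↭ xs m)) (here refl)

  -- A product of t linear forms on the plane is annihilated by the Lagrange functional of any t + 2 pairwise
  -- independent vectors: a linear form φ satisfies φ(z)[z₀,z₁] = φ(z₀)[z,z₁] + φ(z₁)[z₀,z], and each of the two
  -- summands cancels one of the points z₀, z₁.
  interpolation : ∀ φs zs → length zs ≡ 2 ℕ.+ length φs → AllPairs (λ z u → br z u ≢ 0#) zs →
    sumL (sel zs) (lagrangeTerm φs) ≡ 0#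
  interpolation [] (z₀ ∷ z₁ ∷ []) _ ((ne ∷ []) ∷ _) = begin
    1# * inv (br z₀ z₁ * 1#) + (1# * inv (br z₁ z₀ * 1#) + 0#)
      ≡⟨ cong₂ (λ a b → 1# * inv a + (1# * inv b + 0#)) (*-identityʳ _) (*-identityʳ _ ∙ br-anti z₁ z₀) ⟩
    1# * inv b + (1# * inv (- b) + 0#)
      ≡⟨ cong (λ a → 1# * inv b + (1# * a + 0#)) (sym (inv-unique (br-sym≢0 ne ∘ (br-anti z₁ z₀ ∙_)) (solve 2 (λ b i → :- b :* (:- i) := b :* i) refl b (inv b) ∙ inv-r ne))) ⟩
    1# * inv b + (1# * (- inv b) + 0#)
      ≡⟨ solve 1 (λ i → :1 :* i :+ (:1 :* (:- i) :+ :0) := :0) refl (inv b) ⟩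
    0# ∎
    where
      open ≡-Reasoning
      b = br z₀ z₁
  interpolation (φ ∷ φs) (z₀ ∷ z₁ ∷ zs) len ((ne ∷ ne₀) ∷ ne₁ ∷ nes) = *≡0 ne (begin
    b * sumL (sel (z₀ ∷ z₁ ∷ zs)) T
      ≡⟨ cong (b *_) (sum-sel₂ z₀ z₁ zs T) ⟩
    b * (T (z₀ , z₁ ∷ zs) + (T (z₁ , z₀ ∷ zs) + sumL (sel zs) (λ p → T (proj₁ p , z₀ ∷ z₁ ∷ proj₂ p))))
      ≡⟨ solve 4 (λ b x y z → b :* (x :+ (y :+ z)) := b :* x :+ (b :* y :+ b :* z)) refl b _ _ _ ⟩
    b * T (z₀ , z₁ ∷ zs) + (b * T (z₁ , z₀ ∷ zs) + b * sumL (sel zs) (λ p → T (proj₁ p , z₀ ∷ z₁ ∷ proj₂ p)))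
      ≡⟨ cong₂ _+_ eq₀ (cong₂ _+_ eq₁ eq₂) ⟩
    ap φ z₀ * A₀ + (- ap φ z₁ * A₁ + (ap φ z₀ * B₀ + - ap φ z₁ * B₁))
      ≡⟨ solve 6 (λ u v a b c d → u :* a :+ (:- v :* b :+ (u :* c :+ :- v :* d)) := u :* (a :+ c) :+ :- v :* (b :+ d)) refl (ap φ z₀) (ap φ z₁) A₀ A₁ B₀ B₁ ⟩
    ap φ z₀ * (A₀ + B₀) + - ap φ z₁ * (A₁ + B₁)
      ≡⟨ cong₂ (λ x y → ap φ z₀ * x + - ap φ z₁ * y) ih₀ ih₁ ⟩
    ap φ z₀ * 0# + - ap φ z₁ * 0#
      ≡⟨ solve 2 (λ x y → x :* :0 :+ y :* :0 := :0) refl _ _ ⟩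
    0# ∎)
    where
      open ≡-Reasoning
      b = br z₀ z₁
      T = lagrangeTerm (φ ∷ φs)
      T′ = lagrangeTerm φs
      f : Point → Carrier
      f z = prodL φs (λ ψ → ap ψ z)
      A₀ = T′ (z₀ , zs)
      A₁ = T′ (z₁ , zs)
      B₀ = sumL (sel zs) (λ p → T′ (proj₁ p , z₀ ∷ proj₂ p))
      B₁ = sumL (sel zs) (λ p → T′ (proj₁ p , z₁ ∷ proj₂ p))
      ih₀ : A₀ + B₀ ≡ 0#
      ih₀ = cong (A₀ +_) (sym (sum-map _ (sel zs))) ∙ interpolation φs (z₀ ∷ zs) (ℕₚ.suc-injective len) (ne₀ ∷ nes)
      ih₁ : A₁ + B₁ ≡ 0#
      ih₁ = cong (A₁ +_) (sym (sum-map _ (sel zs))) ∙ interpolation φs (z₁ ∷ zs) (ℕₚ.suc-injective len) (ne₁ ∷ nes)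
      eq₀ : b * T (z₀ , z₁ ∷ zs) ≡ ap φ z₀ * A₀
      eq₀ = begin
        b * (ap φ z₀ * f z₀ * inv (b * P)) ≡⟨ cong (λ x → b * (ap φ z₀ * f z₀ * x)) (inv-* b P) ⟩
        b * (ap φ z₀ * f z₀ * (inv b * inv P)) ≡⟨ solve 5 (λ b u v i j → b :* (u :* v :* (i :* j)) := (b :* i) :* (u :* (v :* j))) refl b _ _ _ _ ⟩
        (b * inv b) * (ap φ z₀ * (f z₀ * inv P)) ≡⟨ cong (_* (ap φ z₀ * (f z₀ * inv P))) (inv-r ne) ∙ *-identityˡ _ ⟩
        ap φ z₀ * A₀ ∎
        where P = prodL zs (br z₀)
      eq₁ : b * T (z₁ , z₀ ∷ zs) ≡ - ap φ z₁ * A₁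
      eq₁ = begin
        b * (ap φ z₁ * f z₁ * inv (c * P))
          ≡⟨ cong₂ (λ x y → x * (ap φ z₁ * f z₁ * y)) (br-anti z₀ z₁) (inv-* c P) ⟩
        - c * (ap φ z₁ * f z₁ * (inv c * inv P))
          ≡⟨ solve 5 (λ b u v i j → :- b :* (u :* v :* (i :* j)) := (b :* i) :* (:- u :* (v :* j))) refl c _ _ _ _ ⟩
        (c * inv c) * (- ap φ z₁ * (f z₁ * inv P))
          ≡⟨ cong (_* (- ap φ z₁ * (f z₁ * inv P))) (inv-r (br-sym≢0 ne)) ∙ *-identityˡ _ ⟩
        - ap φ z₁ * A₁ ∎
        where
          P = prodL zs (br z₁)
          c = br z₁ z₀
      pointwise : ∀ {p} → p ∈ sel zs → b * T (proj₁ p , z₀ ∷ z₁ ∷ proj₂ p) ≡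
        ap φ z₀ * T′ (proj₁ p , z₀ ∷ proj₂ p) + - ap φ z₁ * T′ (proj₁ p , z₁ ∷ proj₂ p)
      pointwise {z , rest} m = begin
        b * (ap φ z * f z * inv (x * (y * P)))
          ≡⟨ cong (λ w → b * (ap φ z * f z * w)) (inv-* x (y * P) ∙ cong (inv x *_) (inv-* y P)) ⟩
        b * (ap φ z * f z * (inv x * (inv y * inv P)))
          ≡⟨ solve 6 (λ b u v i j k → b :* (u :* v :* (i :* (j :* k))) := (u :* b) :* (v :* (i :* (j :* k)))) refl b _ _ _ _ _ ⟩
        (ap φ z * b) * (f z * (inv x * (inv y * inv P)))
          ≡⟨ cong (_* (f z * (inv x * (inv y * inv P)))) (decompose φ z z₀ z₁) ⟩
        (ap φ z₀ * y + - ap φ z₁ * x) * (f z * (inv x * (inv y * inv P)))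
          ≡⟨ solve 8 (λ u v x y g i j k → (u :* y :+ :- v :* x) :* (g :* (i :* (j :* k))) := (y :* j) :* (u :* (g :* (i :* k))) :+ (x :* i) :* (:- v :* (g :* (j :* k)))) refl (ap φ z₀) (ap φ z₁) x y (f z) (inv x) (inv y) (inv P) ⟩
        (y * inv y) * (ap φ z₀ * (f z * (inv x * inv P))) + (x * inv x) * (- ap φ z₁ * (f z * (inv y * inv P)))
          ≡⟨ cong₂ (λ s t → s * (ap φ z₀ * (f z * (inv x * inv P))) + t * (- ap φ z₁ * (f z * (inv y * inv P)))) (inv-r y≢0) (inv-r x≢0) ⟩
        1# * (ap φ z₀ * (f z * (inv x * inv P))) + 1# * (- ap φ z₁ * (f z * (inv y * inv P)))
          ≡⟨ cong₂ _+_ (*-identityˡ _ ∙ cong (λ w → ap φ z₀ * (f z * w)) (sym (inv-* x P))) (*-identityˡ _ ∙ cong (λ w → - ap φ z₁ * (f z * w)) (sym (inv-* y P))) ⟩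
        ap φ z₀ * (f z * inv (x * P)) + - ap φ z₁ * (f z * inv (y * P)) ∎
        where
          x = br z z₀
          y = br z z₁
          P = prodL rest (br z)
          x≢0 : x ≢ 0#
          x≢0 = br-sym≢0 (All.lookup ne₀ (∈-sel zs m))
          y≢0 : y ≢ 0#
          y≢0 = br-sym≢0 (All.lookup ne₁ (∈-sel zs m))
          decompose : ∀ φ z z₀ z₁ → ap φ z * br z₀ z₁ ≡ ap φ z₀ * br z z₁ + - ap φ z₁ * br z z₀
          decompose (a , b) (c , d) (e , g) (h , i) = solve 8 (λ a b c d e g h i →
            (a :* c :+ b :* d) :* (e :* i :+ :- (g :* h)) :=
            (a :* e :+ b :* g) :* (c :* i :+ :- (d :* h)) :+ :- (a :* h :+ b :* i) :* (c :* g :+ :- (d :* e))) refl a b c d e g h i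
      eq₂ : b * sumL (sel zs) (λ p → T (proj₁ p , z₀ ∷ z₁ ∷ proj₂ p)) ≡ ap φ z₀ * B₀ + - ap φ z₁ * B₁
      eq₂ = begin
        b * sumL (sel zs) (λ p → T (proj₁ p , z₀ ∷ z₁ ∷ proj₂ p))
          ≡⟨ sym (sum-*ˡ (sel zs) b _) ⟩
        sumL (sel zs) (λ p → b * T (proj₁ p , z₀ ∷ z₁ ∷ proj₂ p))
          ≡⟨ sum-cong (sel zs) pointwise ⟩
        sumL (sel zs) (λ p → ap φ z₀ * T′ (proj₁ p , z₀ ∷ proj₂ p) + - ap φ z₁ * T′ (proj₁ p , z₁ ∷ proj₂ p))
          ≡⟨ sum-+ (sel zs) _ _ ⟩
        sumL (sel zs) (λ p → ap φ z₀ * T′ (proj₁ p , z₀ ∷ proj₂ p)) + sumL (sel zs) (λ p → - ap φ z₁ * T′ (proj₁ p , z₁ ∷ proj₂ p))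
          ≡⟨ cong₂ _+_ (sum-*ˡ (sel zs) _ _) (sum-*ˡ (sel zs) _ _) ⟩
        ap φ z₀ * B₀ + - ap φ z₁ * B₁ ∎

  -- The elements of the field and products of their differences

  complete : {A : Set} (all : List A) → (∀ x → x ∈ all) → (xs : List A) → Unique xs → ∃ λ ys → all ↭ xs ++ ys
  complete all ∈all [] _ = all , refl
  complete all ∈all (x ∷ xs) u@(_ ∷ u′) with complete all ∈all xs u′
  ... | ys , p with ∈-++⁻ xs (∈-resp-↭ p (∈all x))
  ... | inj₁ m = ⊥-elim (∉-Unique u m)
  ... | inj₂ m with ∈-∃++ m
  ... | as , bs , refl = as ++ bs , ↭-trans p (↭-trans (Permₚ.++⁺ˡ xs (shift x as bs)) (shift x xs (as ++ bs)))

  -- The pigeonhole principle. It turns injective maps of the field into permutations, and later an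
  -- injection of the columns into the points of the projective line into a bijection.
  exhaust : {A : Set} (all : List A) → (∀ x → x ∈ all) → (xs : List A) → Unique xs → length xs ≡ length all → all ↭ xs
  exhaust all ∈all xs u len with complete all ∈all xs u
  ... | [] , p = ↭-trans p (↭-reflexive (Listₚ.++-identityʳ xs))
  ... | y ∷ ys , p = ⊥-elim (ℕₚ.m≢1+m+n (length xs) (len ∙ (↭-length p ∙ (length-++ xs ∙ ℕₚ.+-suc (length xs) (length ys)))))

  allF : List Carrier
  allF = map (Inverse.to enum) (allFin q)

  ∈-allF : ∀ x → x ∈ allF
  ∈-allF x = subst (_∈ allF) (Inverse.strictlyInverseˡ enum x) (∈-map⁺ (Inverse.to enum) (∈-allFin (Inverse.from enum x)))

  length-allFin : ∀ n → length (allFin n) ≡ n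
  length-allFin n = Listₚ.length-tabulate {n = n} (λ i → i)

  length-allF : length allF ≡ q
  length-allF = length-map (Inverse.to enum) (allFin q) ∙ length-allFin q

  nonzeros : List Carrier
  nonzeros = proj₁ (complete allF ∈-allF (0# ∷ []) ([] ∷ []))

  allF↭0∷nonzeros : allF ↭ 0# ∷ nonzeros
  allF↭0∷nonzeros = proj₂ (complete allF ∈-allF (0# ∷ []) ([] ∷ []))

  Unique-allF : Unique allF
  Unique-allF = Uniqueₚ.map⁺ (λ {x} {y} e → sym (Inverse.strictlyInverseʳ enum x) ∙ (cong (Inverse.from enum) e ∙ Inverse.strictlyInverseʳ enum y)) (allFin⁺ q)

  length-nonzeros : suc (length nonzeros) ≡ q
  length-nonzeros = sym (↭-length allF↭0∷nonzeros) ∙ length-allF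

  nonzeros≢0 : ∀ {x} → x ∈ nonzeros → x ≢ 0#
  nonzeros≢0 m refl = ∉-Unique (Unique-↭ allF↭0∷nonzeros Unique-allF) m

  prod-nonzeros≢0 : prodL nonzeros (λ x → x) ≢ 0#
  prod-nonzeros≢0 = prod≢0 nonzeros nonzeros≢0

  -- By `exhaust` the injective map h permutes the field; as it sends y to zero, it carries the
  -- remaining elements onto the nonzero ones.
  map-nonzeros : (h : Carrier → Carrier) {ys : List Carrier} {y : Carrier} → (∀ {a b} → h a ≡ h b → a ≡ b) → h y ≡ 0# → allF ↭ y ∷ ys →
    prodL ys h ≡ prodL nonzeros (λ x → x)
  map-nonzeros h {ys} {y} inj hy p = sym (prod-map h ys) ∙ prod-↭ (λ x → x) (Permₚ.drop-∷ (↭-trans (↭-sym q₁) allF↭0∷nonzeros))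
    where
      q₀ : allF ↭ h y ∷ map h ys
      q₀ = exhaust allF ∈-allF (map h (y ∷ ys)) (Uniqueₚ.map⁺ inj (Unique-↭ p Unique-allF))
            (length-map h (y ∷ ys) ∙ sym (↭-length p))
      q₁ : allF ↭ 0# ∷ map h ys
      q₁ = subst (λ z → allF ↭ z ∷ map h ys) hy q₀

  -- x − z runs over the nonzero elements as x runs over the elements different from z
  prod-differences : ∀ {z ys} → allF ↭ z ∷ ys → prodL ys (λ x → x + - z) ≡ prodL nonzeros (λ x → x)
  prod-differences {z} = map-nonzeros (λ x → x + - z)
    (λ {a} {b} e → solve 2 (λ a z → a := (a :+ :- z) :+ z) refl a z ∙ (cong (_+ z) e ∙ solve 2 (λ b z → (b :+ :- z) :+ z := b) refl b z))
    (-‿inverseʳ z)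

  -- Multiplication by a nonzero x permutes the nonzero elements, so their product P satisfies
  -- x^(q-1) P = P.
  fermat : ∀ x → pw x q ≡ x
  fermat x = cong (pw x) (sym length-nonzeros) ∙ go (x ≟ 0#)
    where
      P = prodL nonzeros (λ y → y)
      go : Dec (x ≡ 0#) → x * pw x (length nonzeros) ≡ x
      go (yes e) = cong (_* pw x (length nonzeros)) e ∙ (zeroˡ _ ∙ sym e)
      go (no ne) = cong (x *_) (*-cancelˡ prod-nonzeros≢0 (begin
        P * pw x (length nonzeros) ≡⟨ *-comm _ _ ⟩
        pw x (length nonzeros) * P ≡⟨ cong (_* P) (sym (prod-const nonzeros x)) ⟩
        prodL nonzeros (λ _ → x) * P ≡⟨ sym (prod-* nonzeros (λ _ → x) (λ y → y)) ⟩
        prodL nonzeros (λ y → x * y) ≡⟨ map-nonzeros (x *_) (*-cancelˡ ne) (zeroʳ x) allF↭0∷nonzeros ⟩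
        P ≡⟨ sym (*-identityʳ P) ⟩
        P * 1# ∎)) ∙ *-identityʳ x
        where open ≡-Reasoning

  -- The reciprocals of the products of differences over almost all of the field agree, up to a constant, with a polynomial of
  -- degree t, so they are annihilated by the Lagrange functional of t + 2 points.
  affine-identity : ∀ rs zs t → Unique (rs ++ zs) → length rs ℕ.+ (length zs ℕ.+ t) ≡ q → length zs ≡ 2 ℕ.+ t →
    sumL (sel zs) (λ p → inv (prodL rs (λ y → y + - proj₁ p) * (prodL (proj₂ p) (λ u → u + - proj₁ p) * prodL (proj₂ p) (λ u → u + - proj₁ p)))) ≡ 0#
  affine-identity rs zs t u len lenz with complete allF ∈-allF (rs ++ zs) u
  ... | ts , perm = begin
    sumL (sel zs) (λ p → inv (prodL rs (λ y → y + - proj₁ p) * (X p * X p)))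
      ≡⟨ sum-cong (sel zs) term ⟩
    sumL (sel zs) (λ p → inv P * lagrangeTerm φs (pt (proj₁ p) , map pt (proj₂ p)))
      ≡⟨ sum-*ˡ (sel zs) (inv P) _ ⟩
    inv P * sumL (sel zs) (λ p → lagrangeTerm φs (pt (proj₁ p) , map pt (proj₂ p)))
      ≡⟨ cong (inv P *_) (sym (sum-map _ (sel zs)) ∙ cong (λ l → sumL l (lagrangeTerm φs)) (sym (sel-map pt zs))) ⟩
    inv P * sumL (sel (map pt zs)) (lagrangeTerm φs)
      ≡⟨ cong (inv P *_) (interpolation φs (map pt zs) lenpt apart) ⟩
    inv P * 0#
      ≡⟨ zeroʳ _ ⟩
    0# ∎
    where
      open ≡-Reasoning
      X : Carrier × List Carrier → Carrier
      X p = prodL (proj₂ p) (λ u → u + - proj₁ p)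
      P = prodL nonzeros (λ x → x)
      pt : Carrier → Point
      pt z = 1# , z
      form : Carrier → Point
      form τ = τ , - 1#
      φs = map form ts
      lents : length ts ≡ t
      lents = ℕₚ.+-cancelˡ-≡ (length rs ℕ.+ length zs) (length ts) t
        (cong (ℕ._+ length ts) (sym (length-++ rs)) ∙ (sym (length-++ (rs ++ zs)) ∙ (sym (↭-length perm) ∙ (length-allF ∙ (sym len ∙ sym (ℕₚ.+-assoc (length rs) (length zs) t))))))
      lenpt : length (map pt zs) ≡ 2 ℕ.+ length φs
      lenpt = length-map pt zs ∙ (lenz ∙ cong (2 ℕ.+_) (sym (length-map form ts ∙ lents)))
      br-pt : ∀ z u → br (pt z) (pt u) ≡ u + - z
      br-pt z u = solve 2 (λ z u → :1 :* u :+ :- (z :* :1) := u :+ :- z) refl z u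
      uz : Unique zs
      uz = AllPairs-++ˡ zs (Unique-↭ (Permₚ.++-comm rs zs) u)
      apart-map : ∀ {xs} → Unique xs → AllPairs (λ z u → br z u ≢ 0#) (map pt xs)
      apart-map [] = []
      apart-map {x ∷ xs} (r ∷ rs) = All.tabulate (λ m → lem (∈-map⁻ pt m)) ∷ apart-map rs
        where
          lem : ∀ {v} → (∃ λ y → y ∈ xs × v ≡ pt y) → br (pt x) v ≢ 0#
          lem (y , m , refl) e = All.lookup r m (sym (x-y≡0⇒x≡y (sym (br-pt x y) ∙ e)))
      apart = apart-map uz
      term : ∀ {p} → p ∈ sel zs → inv (prodL rs (λ y → y + - proj₁ p) * (X p * X p)) ≡ inv P * lagrangeTerm φs (pt (proj₁ p) , map pt (proj₂ p))
      term {z , rest} m = begin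
        inv (A * (Y * Y)) ≡⟨ inv-* A (Y * Y) ∙ cong (inv A *_) (inv-* Y Y) ⟩
        inv A * (inv Y * inv Y) ≡⟨ sym (cong (_* (inv A * (inv Y * inv Y))) (inv-r τ≢0) ∙ *-identityˡ _) ⟩
        (τ * inv τ) * (inv A * (inv Y * inv Y)) ≡⟨ solve 4 (λ t i a y → (t :* i) :* (a :* (y :* y)) := (a :* (y :* i)) :* (t :* y)) refl τ (inv τ) (inv A) (inv Y) ⟩
        (inv A * (inv Y * inv τ)) * (τ * inv Y) ≡⟨ cong (_* (τ * inv Y)) (sym (inv-* A (Y * τ) ∙ cong (inv A *_) (inv-* Y τ)) ∙ cong inv prodP) ⟩
        inv P * (τ * inv Y) ≡⟨ cong (inv P *_) (cong₂ (λ a b → a * inv b) (sym τ≡) (sym Y≡)) ⟩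
        inv P * lagrangeTerm φs (pt z , map pt rest) ∎
        where
          A = prodL rs (λ y → y + - z)
          Y = prodL rest (λ y → y + - z)
          τ = prodL ts (λ y → y + - z)
          perm′ : allF ↭ z ∷ (rs ++ (rest ++ ts))
          perm′ = ↭-trans perm (↭-trans (↭-reflexive (Listₚ.++-assoc rs zs ts)) (↭-trans (Permₚ.++⁺ˡ rs (Permₚ.++⁺ʳ ts (sel-↭ zs m))) (shift z rs (rest ++ ts))))
          -- The three products together run through all y - z with y different from z, and P does
          -- not depend on z. Hence 1/(A Y²) = τ/(P Y), where τ is a product of t linear forms in z,
          -- one for each field element missed by `rs` and `zs`.
          prodP : A * (Y * τ) ≡ P
          prodP = cong (A *_) (sym (prod-++ rest ts)) ∙ (sym (prod-++ rs (rest ++ ts)) ∙ prod-differences perm′)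
          τ≢0 : τ ≢ 0#
          τ≢0 = ≢0ʳ (≢0ʳ (λ e → prod-nonzeros≢0 (sym prodP ∙ e)))
          τ≡ : prodL φs (λ φ → ap φ (pt z)) ≡ τ
          τ≡ = prod-map form ts ∙ prod-cong ts (λ {y} _ → solve 2 (λ y z → y :* :1 :+ :- :1 :* z := y :+ :- z) refl y z)
          Y≡ : prodL (map pt rest) (br (pt z)) ≡ Y
          Y≡ = prod-map pt rest ∙ prod-cong rest (λ {y} _ → br-pt z y)

  -- The scalar of z occurs to the power 1 + |Rs| + 2(t + 1) = q + 1, hence as its square. Together
  -- with the squared scalars of the other points of Z it forms a factor independent of z, and
  -- `affine-identity` remains. The separate factor κ · lam z is the contribution of a point at
  -- infinity.
  weighted-identity : {I : Set} (lam s : I → Carrier) (κ : Carrier) (Rs Z : List I) (t : ℕ) → Unique (map s (Rs ++ Z)) →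
    length Rs ℕ.+ (length Z ℕ.+ t) ≡ q → length Z ≡ 2 ℕ.+ t →
    let b : I → I → Carrier
        b u z = κ * (lam u * lam z * (s u + - s z)) in
    sumL (sel Z) (λ p → inv (κ * lam (proj₁ p) * prodL Rs (λ y → b y (proj₁ p)) *
      (prodL (proj₂ p) (λ u → b u (proj₁ p)) * prodL (proj₂ p) (λ u → b u (proj₁ p))))) ≡ 0#
  weighted-identity {I} lam s κ Rs Z t u len lenZ = begin
    sumL (sel Z) (λ p → inv (D p))
      ≡⟨ sum-cong (sel Z) (λ {p} m → cong inv (term m) ∙ inv-* C (D′ (s (proj₁ p) , map s (proj₂ p)))) ⟩
    sumL (sel Z) (λ p → inv C * inv (D′ (s (proj₁ p) , map s (proj₂ p))))
      ≡⟨ sum-*ˡ (sel Z) (inv C) _ ⟩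
    inv C * sumL (sel Z) (λ p → inv (D′ (s (proj₁ p) , map s (proj₂ p))))
      ≡⟨ cong (inv C *_) (sym (sum-map _ (sel Z)) ∙ cong (λ l → sumL l (λ p → inv (D′ p))) (sym (sel-map s Z))) ⟩
    inv C * sumL (sel (map s Z)) (λ p → inv (D′ p))
      ≡⟨ cong (inv C *_) (affine-identity (map s Rs) (map s Z) t (subst Unique (Listₚ.map-++ s Rs Z) u)
           (cong₂ (λ a b → a ℕ.+ (b ℕ.+ t)) (length-map s Rs) (length-map s Z) ∙ len) (length-map s Z ∙ lenZ)) ⟩
    inv C * 0#
      ≡⟨ zeroʳ _ ⟩
    0# ∎
    where
      open ≡-Reasoning
      b : I → I → Carrier
      b u z = κ * (lam u * lam z * (s u + - s z))
      D : I × List I → Carrier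
      D p = κ * lam (proj₁ p) * prodL Rs (λ y → b y (proj₁ p)) * (prodL (proj₂ p) (λ u → b u (proj₁ p)) * prodL (proj₂ p) (λ u → b u (proj₁ p)))
      D′ : Carrier × List Carrier → Carrier
      D′ p = prodL (map s Rs) (λ y → y + - proj₁ p) * (prodL (proj₂ p) (λ u → u + - proj₁ p) * prodL (proj₂ p) (λ u → u + - proj₁ p))
      r = length Rs
      κ′ = pw κ (suc t)
      ΛR = prodL Rs lam
      ΛZ = prodL Z lam
      C = κ * pw κ r * ΛR * (κ′ * κ′) * (ΛZ * ΛZ)
      expand : ∀ z (xs : List I) → prodL xs (λ y → b y z) ≡ pw κ (length xs) * (prodL xs lam * pw (lam z) (length xs) * prodL (map s xs) (λ y → y + - s z))
      expand z xs = begin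
        prodL xs (λ y → b y z) ≡⟨ prod-* xs (λ _ → κ) _ ⟩
        prodL xs (λ _ → κ) * prodL xs (λ y → lam y * lam z * (s y + - s z))
          ≡⟨ cong₂ _*_ (prod-const xs κ) (prod-* xs _ _ ∙ cong₂ _*_ (prod-* xs lam _ ∙ cong (prodL xs lam *_) (prod-const xs (lam z))) (sym (prod-map s xs))) ⟩
        _ ∎
      term : ∀ {p} → p ∈ sel Z → D p ≡ C * D′ (s (proj₁ p) , map s (proj₂ p))
      term {z , rest} m = begin
        κ * l * prodL Rs (λ y → b y z) * (prodL rest (λ u → b u z) * prodL rest (λ u → b u z))
          ≡⟨ cong₂ (λ x y → κ * l * x * (y * y)) (expand z Rs) (expand z rest ∙ cong (λ n → pw κ n * (prodL rest lam * pw l n * Y)) lenrest) ⟩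
        κ * l * (pw κ r * (ΛR * pw l r * X)) * ((κ′ * (Λ * l′ * Y)) * (κ′ * (Λ * l′ * Y)))
          ≡⟨ solve 10 (λ κ l a b c d e g h i → κ :* l :* (a :* (b :* c :* d)) :* ((e :* (g :* h :* i)) :* (e :* (g :* h :* i)))
               := κ :* a :* b :* (e :* e) :* ((l :* (c :* (h :* h))) :* (g :* g)) :* (d :* (i :* i))) refl κ l (pw κ r) ΛR (pw l r) X κ′ Λ l′ Y ⟩
        κ * pw κ r * ΛR * (κ′ * κ′) * ((l * (pw l r * (l′ * l′))) * (Λ * Λ)) * (X * (Y * Y))
          ≡⟨ cong (λ w → κ * pw κ r * ΛR * (κ′ * κ′) * w * (X * (Y * Y))) weight ⟩
        C * (X * (Y * Y)) ∎
        where
          l = lam z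
          l′ = pw l (suc t)
          Λ = prodL rest lam
          X = prodL (map s Rs) (λ y → y + - s z)
          Y = prodL (map s rest) (λ y → y + - s z)
          lenrest : length rest ≡ suc t
          lenrest = ℕₚ.suc-injective (sym (↭-length (sel-↭ Z m)) ∙ lenZ)
          total : r ℕ.+ (suc t ℕ.+ suc t) ≡ q
          total = cong (r ℕ.+_) (ℕₚ.+-suc (suc t) t ∙ cong (ℕ._+ t) (sym lenZ)) ∙ len
          weight : (l * (pw l r * (l′ * l′))) * (Λ * Λ) ≡ ΛZ * ΛZ
          weight = begin
            (l * (pw l r * (l′ * l′))) * (Λ * Λ)
              ≡⟨ cong (λ w → l * w * (Λ * Λ)) (sym (pw-+ l r (suc t ℕ.+ suc t) ∙ cong (pw l r *_) (pw-+ l (suc t) (suc t))) ∙ (cong (pw l) total ∙ fermat l)) ⟩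
            (l * l) * (Λ * Λ)
              ≡⟨ solve 2 (λ l m → (l :* l) :* (m :* m) := (l :* m) :* (l :* m)) refl l Λ ⟩
            (l * Λ) * (l * Λ)
              ≡⟨ cong (λ w → w * w) (sym (prod-↭ lam (sel-↭ Z m))) ⟩
            ΛZ * ΛZ ∎

  -- Exterior algebra

  -- A form on F^k is given by its coordinates with respect to the monomials e_B = e_{i₁} ∧ … ∧ e_{i_r}, B = {i₁ < … < i_r};
  -- ext v is the exterior multiplication by v from the left.
  Form : ℕ → Set
  Form k = Vec Bool k → Carrier

  ext : ∀ {k} → Vecᶠ F k → Form k → Form k
  ext v ω [] = 0#
  ext v ω (false ∷ B) = ext (v ∘ suc) (λ C → ω (false ∷ C)) B
  ext v ω (true ∷ B) = v zero * ω (false ∷ B) + - ext (v ∘ suc) (λ C → ω (true ∷ C)) B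

  ext-cong : ∀ {k} (v : Vecᶠ F k) {ω ω′ : Form k} → (∀ B → ω B ≡ ω′ B) → ∀ B → ext v ω B ≡ ext v ω′ B
  ext-cong v e [] = refl
  ext-cong v e (false ∷ B) = ext-cong (v ∘ suc) (λ C → e (false ∷ C)) B
  ext-cong v e (true ∷ B) = cong₂ (λ x y → v zero * x + - y) (e (false ∷ B)) (ext-cong (v ∘ suc) (λ C → e (true ∷ C)) B)

  ext-congˡ : ∀ {k} {v w : Vecᶠ F k} (ω : Form k) → (∀ r → v r ≡ w r) → ∀ B → ext v ω B ≡ ext w ω B
  ext-congˡ ω e [] = refl
  ext-congˡ ω e (false ∷ B) = ext-congˡ (λ C → ω (false ∷ C)) (λ r → e (suc r)) B
  ext-congˡ ω e (true ∷ B) = cong₂ (λ x y → x * ω (false ∷ B) + - y) (e zero) (ext-congˡ (λ C → ω (true ∷ C)) (λ r → e (suc r)) B)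

  ext-linʳ : ∀ {k} (v : Vecᶠ F k) (c d : Carrier) (ω ω′ : Form k) → ∀ B →
    ext v (λ C → c * ω C + d * ω′ C) B ≡ c * ext v ω B + d * ext v ω′ B
  ext-linʳ v c d ω ω′ [] = solve 2 (λ c d → :0 := c :* :0 :+ d :* :0) refl c d
  ext-linʳ v c d ω ω′ (false ∷ B) = ext-linʳ (v ∘ suc) c d _ _ B
  ext-linʳ v c d ω ω′ (true ∷ B) = cong (λ x → v zero * (c * ω (false ∷ B) + d * ω′ (false ∷ B)) + - x) (ext-linʳ (v ∘ suc) c d _ _ B)
    ∙ solve 7 (λ v c d x y z w → v :* (c :* x :+ d :* y) :+ :- (c :* z :+ d :* w) := c :* (v :* x :+ :- z) :+ d :* (v :* y :+ :- w)) refl (v zero) c d _ _ _ _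

  ext-linˡ : ∀ {k} (v w : Vecᶠ F k) (c d : Carrier) (ω : Form k) → ∀ B →
    ext (λ r → c * v r + d * w r) ω B ≡ c * ext v ω B + d * ext w ω B
  ext-linˡ v w c d ω [] = solve 2 (λ c d → :0 := c :* :0 :+ d :* :0) refl c d
  ext-linˡ v w c d ω (false ∷ B) = ext-linˡ (v ∘ suc) (w ∘ suc) c d _ B
  ext-linˡ v w c d ω (true ∷ B) = cong (λ x → (c * v zero + d * w zero) * ω (false ∷ B) + - x) (ext-linˡ (v ∘ suc) (w ∘ suc) c d _ B)
    ∙ solve 7 (λ v w c d x y z → (c :* v :+ d :* w) :* x :+ :- (c :* y :+ d :* z) := c :* (v :* x :+ :- y) :+ d :* (w :* x :+ :- z)) refl (v zero) (w zero) c d _ _ _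

  ext-0 : ∀ {k} (v : Vecᶠ F k) {ω : Form k} → (∀ B → ω B ≡ 0#) → ∀ B → ext v ω B ≡ 0#
  ext-0 v {ω} e B = ext-cong v (λ C → e C ∙ solve 1 (λ x → :0 := :0 :* x :+ :0 :* x) refl (ω C)) B
    ∙ (ext-linʳ v 0# 0# ω ω B ∙ solve 1 (λ x → :0 :* x :+ :0 :* x := :0) refl _)

  ext-0ˡ : ∀ {k} {v : Vecᶠ F k} (ω : Form k) → (∀ r → v r ≡ 0#) → ∀ B → ext v ω B ≡ 0#
  ext-0ˡ {v = v} ω e B = ext-congˡ ω (λ r → e r ∙ solve 1 (λ x → :0 := :0 :* x :+ :0 :* x) refl (v r)) B
    ∙ (ext-linˡ v v 0# 0# ω B ∙ solve 1 (λ x → :0 :* x :+ :0 :* x := :0) refl _)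

  ext-neg : ∀ {k} (v : Vecᶠ F k) {ω ω′ : Form k} → (∀ B → ω B ≡ - ω′ B) → ∀ B → ext v ω B ≡ - ext v ω′ B
  ext-neg v {ω} {ω′} e B = ext-cong v (λ C → e C ∙ solve 1 (λ x → :- x := :0 :* x :+ :- :1 :* x) refl (ω′ C)) B
    ∙ (ext-linʳ v 0# (- 1#) ω′ ω′ B ∙ solve 1 (λ x → :0 :* x :+ :- :1 :* x := :- x) refl _)

  private
    ext-sub : ∀ {k} (v : Vecᶠ F k) (c : Carrier) (ω ω′ : Form k) → ∀ B →
      ext v (λ C → c * ω C + - ω′ C) B ≡ c * ext v ω B + - ext v ω′ B
    ext-sub v c ω ω′ B = ext-cong v (λ C → cong (c * ω C +_) (solve 1 (λ x → :- x := :- :1 :* x) refl (ω′ C))) B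
      ∙ (ext-linʳ v c (- 1#) ω ω′ B ∙ cong (c * ext v ω B +_) (solve 1 (λ x → :- :1 :* x := :- x) refl _))

  ext-swap : ∀ {k} (v w : Vecᶠ F k) (ω : Form k) → ∀ B → ext v (ext w ω) B ≡ - ext w (ext v ω) B
  ext-swap v w ω [] = sym -0#≈0#
  ext-swap v w ω (false ∷ B) = ext-swap (v ∘ suc) (w ∘ suc) _ B
  ext-swap v w ω (true ∷ B) = begin
    v zero * W + - ext v′ (λ C → w zero * ω (false ∷ C) + - ext w′ ω₁ C) B ≡⟨ cong (λ x → v zero * W + - x) (ext-sub v′ (w zero) ω₀ (ext w′ ω₁) B) ⟩
    v zero * W + - (w zero * V + - ext v′ (ext w′ ω₁) B) ≡⟨ cong (λ x → v zero * W + - (w zero * V + - x)) (ext-swap v′ w′ ω₁ B) ⟩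
    v zero * W + - (w zero * V + - (- X)) ≡⟨ solve 5 (λ v w a b x → v :* a :+ :- (w :* b :+ :- (:- x)) := :- (w :* b :+ :- (v :* a :+ :- x))) refl (v zero) (w zero) W V X ⟩
    - (w zero * V + - (v zero * W + - X)) ≡⟨ cong (λ x → - (w zero * V + - x)) (sym (ext-sub w′ (v zero) ω₀ (ext v′ ω₁) B)) ⟩
    - (w zero * V + - ext w′ (λ C → v zero * ω (false ∷ C) + - ext v′ ω₁ C) B) ∎
    where
      open ≡-Reasoning
      v′ = v ∘ suc ; w′ = w ∘ suc
      ω₀ ω₁ : Form _
      ω₀ C = ω (false ∷ C)
      ω₁ C = ω (true ∷ C)
      V = ext v′ ω₀ B
      W = ext w′ ω₀ B
      X = ext w′ (ext v′ ω₁) B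

  ext-sq : ∀ {k} (v : Vecᶠ F k) (ω : Form k) → ∀ B → ext v (ext v ω) B ≡ 0#
  ext-sq v ω [] = refl
  ext-sq v ω (false ∷ B) = ext-sq (v ∘ suc) _ B
  ext-sq v ω (true ∷ B) = begin
    v zero * W + - ext v′ (λ C → v zero * ω (false ∷ C) + - ext v′ ω₁ C) B ≡⟨ cong (λ x → v zero * W + - x) (ext-sub v′ (v zero) ω₀ (ext v′ ω₁) B) ⟩
    v zero * W + - (v zero * W + - ext v′ (ext v′ ω₁) B) ≡⟨ cong (λ x → v zero * W + - (v zero * W + - x)) (ext-sq v′ ω₁ B) ⟩
    v zero * W + - (v zero * W + - 0#) ≡⟨ solve 1 (λ a → a :+ :- (a :+ :- :0) := :0) refl _ ⟩
    0# ∎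
    where
      open ≡-Reasoning
      v′ = v ∘ suc
      ω₀ ω₁ : Form _
      ω₀ C = ω (false ∷ C)
      ω₁ C = ω (true ∷ C)
      W = ext v′ ω₀ B

  ext-sum : ∀ {k} {I : Set} (xs : List I) (d : I → Carrier) (v : I → Vecᶠ F k) {w : Vecᶠ F k} (ω : Form k) →
    (∀ r → w r ≡ sumL xs (λ x → d x * v x r)) → ∀ B → ext w ω B ≡ sumL xs (λ x → d x * ext (v x) ω B)
  ext-sum [] d v ω e B = ext-0ˡ ω e B
  ext-sum (x ∷ xs) d v ω e B = ext-congˡ ω (λ r → e r ∙ cong (d x * v x r +_) (sym (*-identityˡ _))) B
    ∙ (ext-linˡ (v x) (λ r → sumL xs (λ y → d y * v y r)) (d x) 1# ω B ∙ cong (d x * ext (v x) ω B +_) (*-identityˡ _ ∙ ext-sum xs d v ω (λ r → refl) B))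

  unit : ∀ {k} → Form k
  unit [] = 1#
  unit (false ∷ B) = unit B
  unit (true ∷ B) = 0#

  wedge : ∀ {k} → List (Vecᶠ F k) → Form k
  wedge [] = unit
  wedge (v ∷ vs) = ext v (wedge vs)

  -- On a wedge of k vectors of F^k this coefficient is their determinant; determinants enter in no
  -- other form.
  top : ∀ {k} → Form k → Carrier
  top {k} ω = ω (Vec.replicate k true)

  -- Reordering the factors of a wedge is tracked only up to sign. Vanishing, squares and the
  -- weights of hyperplanes do not see the sign, so parities of permutations are never computed.
  _≈±_ : ∀ {k} → Form k → Form k → Set
  ω ≈± ω′ = (∀ B → ω B ≡ ω′ B) ⊎ (∀ B → ω B ≡ - ω′ B)

  ≈±-trans : ∀ {k} {ω ω′ ω″ : Form k} → ω ≈± ω′ → ω′ ≈± ω″ → ω ≈± ω″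
  ≈±-trans (inj₁ a) (inj₁ b) = inj₁ (λ B → a B ∙ b B)
  ≈±-trans (inj₁ a) (inj₂ b) = inj₂ (λ B → a B ∙ b B)
  ≈±-trans (inj₂ a) (inj₁ b) = inj₂ (λ B → a B ∙ cong -_ (b B))
  ≈±-trans (inj₂ a) (inj₂ b) = inj₁ (λ B → a B ∙ (cong -_ (b B) ∙ -‿involutive _))

  ext-≈± : ∀ {k} (v : Vecᶠ F k) {ω ω′ : Form k} → ω ≈± ω′ → ext v ω ≈± ext v ω′
  ext-≈± v (inj₁ a) = inj₁ (ext-cong v a)
  ext-≈± v (inj₂ a) = inj₂ (ext-neg v a)

  wedge-↭ : ∀ {k} {vs ws : List (Vecᶠ F k)} → vs ↭ ws → wedge vs ≈± wedge ws
  wedge-↭ refl = inj₁ (λ _ → refl)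
  wedge-↭ (prep v p) = ext-≈± v (wedge-↭ p)
  wedge-↭ (swap v w p) = ≈±-trans (inj₂ (ext-swap v w _)) (ext-≈± w (ext-≈± v (wedge-↭ p)))
  wedge-↭ (trans p r) = ≈±-trans (wedge-↭ p) (wedge-↭ r)

  ≈±-0 : ∀ {k} {ω ω′ : Form k} → ω ≈± ω′ → ∀ {B} → ω′ B ≡ 0# → ω B ≡ 0#
  ≈±-0 (inj₁ a) e = a _ ∙ e
  ≈±-0 (inj₂ a) e = a _ ∙ (cong -_ e ∙ -0#≈0#)

  ≈±-square : ∀ {k} {ω ω′ : Form k} → ω ≈± ω′ → ∀ B → ω B * ω B ≡ ω′ B * ω′ B
  ≈±-square (inj₁ a) B = cong (λ x → x * x) (a B)
  ≈±-square (inj₂ a) B = cong (λ x → x * x) (a B) ∙ solve 1 (λ x → :- x :* :- x := x :* x) refl _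

  ext-member : ∀ {k} {v : Vecᶠ F k} {vs : List (Vecᶠ F k)} → v ∈ vs → ∀ B → ext v (wedge vs) B ≡ 0#
  ext-member {v = v} {_ ∷ vs} (here refl) B = ext-sq v (wedge vs) B
  ext-member {v = v} {w ∷ vs} (there m) B = ext-swap v w (wedge vs) B ∙ (cong -_ (ext-0 w (ext-member m) B) ∙ -0#≈0#)

  private
    lift : ∀ {k} → Vecᶠ F k → Vecᶠ F (suc k)
    lift v zero = 0#
    lift v (suc i) = v i

    e₀ : ∀ {k} → Vecᶠ F (suc k)
    e₀ zero = 1#
    e₀ (suc i) = 0#

    -- The standard basis serves as the one family whose determinant is known not to vanish.
    std : ∀ k → List (Vecᶠ F k)
    std zero = []
    std (suc k) = e₀ ∷ map lift (std k)

    wedge-lift-true : ∀ {k} (vs : List (Vecᶠ F k)) B → wedge (map lift vs) (true ∷ B) ≡ 0#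
    wedge-lift-true [] B = refl
    wedge-lift-true (v ∷ vs) B = cong (λ x → 0# * _ + - x) (ext-0 v (wedge-lift-true vs) B) ∙ solve 1 (λ x → :0 :* x :+ :- :0 := :0) refl _

    wedge-lift-false : ∀ {k} (vs : List (Vecᶠ F k)) B → wedge (map lift vs) (false ∷ B) ≡ wedge vs B
    wedge-lift-false [] B = refl
    wedge-lift-false (v ∷ vs) B = ext-cong v (wedge-lift-false vs) B

    top-std : ∀ k → top (wedge (std k)) ≡ 1#
    top-std zero = refl
    top-std (suc k) = cong₂ (λ x y → 1# * x + - y) (wedge-lift-false (std k) _ ∙ top-std k) (ext-0ˡ _ (λ _ → refl) (Vec.replicate k true)) ∙ solve 0 (:1 :* :1 :+ :- :0 := :1) refl

    length-std : ∀ k → length (std k) ≡ k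
    length-std zero = refl
    length-std (suc k) = cong suc (length-map lift (std k) ∙ length-std k)

  SpansL : ∀ {k} {I : Set} → (I → Vecᶠ F k) → List I → Set
  SpansL {k} {I} v xs = ∀ (w : Vecᶠ F k) → ∃ λ (d : I → Carrier) → ∀ r → w r ≡ sumL xs (λ x → d x * v x r)

  -- If the determinant of a spanning family vanished, then replacing its members one at a time by arbitrary vectors would
  -- show that every determinant vanishes.
  spans⇒det≢0 : ∀ {k} {I : Set} (v : I → Vecᶠ F k) (xs : List I) → length xs ≡ k → SpansL v xs → top (wedge (map v xs)) ≢ 0#
  spans⇒det≢0 {k} {I} v xs len sp det≡0 = 1≢0 (sym (top-std k) ∙ (cong (λ vs → top (wedge vs)) (sym (Listₚ.++-identityʳ (std k))) ∙ go (std k) [] xs refl (ℕₚ.+-identityʳ _ ∙ length-std k)))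
    where
      -- Induction on the arbitrary vectors `ws`. The first of them is expanded in the family:
      -- members already in `ys` give a repeated factor, and a member of `rest` moves over to `ys`.
      -- When `ws` is used up, `ys` is the whole family by counting.
      go : ∀ ws ys rest → ys ++ rest ↭ xs → length ws ℕ.+ length ys ≡ k → top (wedge (ws ++ map v ys)) ≡ 0#
      go [] ys [] p l = ≈±-0 (wedge-↭ (Permₚ.map⁺ v (↭-trans (↭-reflexive (sym (Listₚ.++-identityʳ ys))) p))) det≡0
      go [] ys (z ∷ rest) p l = ⊥-elim (ℕₚ.m≢1+m+n (length ys) (l ∙ (sym len ∙ (sym (↭-length p) ∙ (length-++ ys ∙ ℕₚ.+-suc _ _)))))
      go (w ∷ ws) ys rest p l with sp w
      ... | d , e = ext-sum xs d v (wedge (ws ++ map v ys)) e (Vec.replicate k true) ∙ sum-0 xs (λ {x} m → cong (d x *_) (vanish (∈-++⁻ ys (∈-resp-↭ (↭-sym p) m))) ∙ zeroʳ _)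
        where
          vanish : ∀ {x} → (x ∈ ys) ⊎ (x ∈ rest) → top (ext (v x) (wedge (ws ++ map v ys))) ≡ 0#
          vanish (inj₁ m) = ext-member (∈-++⁺ʳ ws (∈-map⁺ v m)) (Vec.replicate k true)
          vanish {x} (inj₂ m) with ∈-∃++ m
          ... | as , bs , refl = ≈±-0 (wedge-↭ (↭-sym (shift (v x) ws (map v ys)))) (go ws (x ∷ ys) (as ++ bs) p′ (ℕₚ.+-suc _ _ ∙ l))
            where
              p′ : x ∷ ys ++ (as ++ bs) ↭ xs
              p′ = ↭-trans (↭-sym (shift x ys (as ++ bs))) (↭-trans (Permₚ.++⁺ˡ ys (↭-sym (shift x as bs))) p)

  -- Inclusion matrices

  sumSubsets : ∀ n → (Vec Bool n → Carrier) → Carrier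
  sumSubsets zero f = f []
  sumSubsets (suc n) f = sumSubsets n (λ A → f (false ∷ A)) + sumSubsets n (λ A → f (true ∷ A))

  sumSubsets≡sum : ∀ n f → sumL (allSubsets n) f ≡ sumSubsets n f
  sumSubsets≡sum zero f = +-identityʳ _
  sumSubsets≡sum (suc n) f = sum-++ (map (false ∷_) (allSubsets n)) (map (true ∷_) (allSubsets n))
    ∙ cong₂ _+_ (sum-map _ (allSubsets n) ∙ sumSubsets≡sum n _) (sum-map _ (allSubsets n) ∙ sumSubsets≡sum n _)

  sumSubsets-0 : ∀ n {f} → (∀ A → f A ≡ 0#) → sumSubsets n f ≡ 0#
  sumSubsets-0 zero e = e []
  sumSubsets-0 (suc n) e = cong₂ _+_ (sumSubsets-0 n (λ A → e (false ∷ A))) (sumSubsets-0 n (λ A → e (true ∷ A))) ∙ +-identityˡ 0#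

  sum-filter : {A : Set} {P : A → Set} (P? : Decidable P) (xs : List A) (f : A → Carrier) →
    sumL (filter P? xs) f ≡ sumL xs (λ x → if does (P? x) then f x else 0#)
  sum-filter P? [] f = refl
  sum-filter P? (x ∷ xs) f with does (P? x)
  ... | true = cong (f x +_) (sum-filter P? xs f)
  ... | false = sum-filter P? xs f ∙ sym (+-identityˡ _)

  [_] : Bool → Carrier
  [ b ] = if b then 1# else 0#

  sumAtSize : ∀ n → ℕ → (Vec Bool n → Carrier) → Carrier
  sumAtSize n m f = sumSubsets n (λ A → if size A ℕ.≡ᵇ m then f A else 0#)

  sum-filter-size : ∀ n m f → sumL (filter (λ A → size A ℕ.≟ m) (allSubsets n)) f ≡ sumAtSize n m f
  sum-filter-size n m f = sum-filter (λ A → size A ℕ.≟ m) (allSubsets n) f ∙ sumSubsets≡sum n _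

  if-0 : ∀ b {x} → x ≡ 0# → (if b then x else 0#) ≡ 0#
  if-0 true e = e
  if-0 false e = refl

  -- Lower and upper covers in the lattice of subsets. Rows and columns of the inclusion matrix are
  -- summed over them.
  downs ups : ∀ {n} → Vec Bool n → List (Vec Bool n)
  downs [] = []
  downs (false ∷ C) = map (false ∷_) (downs C)
  downs (true ∷ C) = (false ∷ C) ∷ map (true ∷_) (downs C)
  ups [] = []
  ups (false ∷ A) = (true ∷ A) ∷ map (false ∷_) (ups A)
  ups (true ∷ A) = map (true ∷_) (ups A)

  private
    -- Boundary cases for the inductions of `sum-downs` and `sum-ups`: a set contains no larger set,
    -- is contained in no smaller one, and is comparable with only itself among the sets of its own
    -- size.
    below> : ∀ {n} (C : Vec Bool n) m (f : Vec Bool n → Carrier) → size C ℕ.< m → sumAtSize n m (λ A → f A * [ A ⊆ᵇ C ]) ≡ 0#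
    below> [] (suc m) f lt = refl
    below> {suc n} (false ∷ C) m f lt = cong₂ _+_ (below> C m _ lt) (sumSubsets-0 n (λ A → if-0 (suc (size A) ℕ.≡ᵇ m) (zeroʳ _))) ∙ +-identityˡ 0#
    below> (true ∷ C) (suc m) f lt = cong₂ _+_ (below> C (suc m) _ (ℕₚ.m<n⇒m<1+n (ℕ.s<s⁻¹ lt))) (below> C m _ (ℕ.s<s⁻¹ lt)) ∙ +-identityˡ 0#

    below≡ : ∀ {n} (C : Vec Bool n) m (f : Vec Bool n → Carrier) → size C ≡ m → sumAtSize n m (λ A → f A * [ A ⊆ᵇ C ]) ≡ f C
    below≡ [] zero f e = *-identityʳ _
    below≡ {suc n} (false ∷ C) m f e = cong₂ _+_ (below≡ C m _ e) (sumSubsets-0 n (λ A → if-0 (suc (size A) ℕ.≡ᵇ m) (zeroʳ _))) ∙ +-identityʳ _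
    below≡ (true ∷ C) (suc m) f e = cong₂ _+_ (below> C (suc m) _ (ℕₚ.≤-reflexive e)) (below≡ C m _ (ℕₚ.suc-injective e)) ∙ +-identityˡ _

    above> : ∀ {n} (A : Vec Bool n) m (f : Vec Bool n → Carrier) → m ℕ.< size A → sumAtSize n m (λ C → f C * [ A ⊆ᵇ C ]) ≡ 0#
    above> {suc n} (false ∷ A) zero f lt = cong₂ _+_ (above> A 0 _ lt) (sumSubsets-0 n (λ _ → refl)) ∙ +-identityˡ 0#
    above> (false ∷ A) (suc m) f lt = cong₂ _+_ (above> A (suc m) _ lt) (above> A m _ (ℕₚ.<-trans (ℕₚ.n<1+n m) lt)) ∙ +-identityˡ 0#
    above> {suc n} (true ∷ A) zero f lt = cong₂ _+_ (sumSubsets-0 n (λ C → if-0 (size C ℕ.≡ᵇ 0) (zeroʳ _))) (sumSubsets-0 n (λ _ → refl)) ∙ +-identityˡ 0#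
    above> {suc n} (true ∷ A) (suc m) f lt = cong₂ _+_ (sumSubsets-0 n (λ C → if-0 (size C ℕ.≡ᵇ suc m) (zeroʳ _))) (above> A m _ (ℕ.s<s⁻¹ lt)) ∙ +-identityˡ 0#

    above≡ : ∀ {n} (A : Vec Bool n) m (f : Vec Bool n → Carrier) → size A ≡ m → sumAtSize n m (λ C → f C * [ A ⊆ᵇ C ]) ≡ f A
    above≡ [] zero f e = *-identityʳ _
    above≡ {suc n} (false ∷ A) zero f e = cong₂ _+_ (above≡ A 0 _ e) (sumSubsets-0 n (λ _ → refl)) ∙ +-identityʳ _
    above≡ (false ∷ A) (suc m) f e = cong₂ _+_ (above≡ A (suc m) _ e) (above> A m _ (ℕₚ.≤-reflexive (sym e))) ∙ +-identityʳ _
    above≡ {suc n} (true ∷ A) (suc m) f e = cong₂ _+_ (sumSubsets-0 n (λ C → if-0 (size C ℕ.≡ᵇ suc m) (zeroʳ _))) (above≡ A m _ (ℕₚ.suc-injective e)) ∙ +-identityˡ _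

    downs-∅ : ∀ {n} (C : Vec Bool n) → size C ≡ 0 → downs C ≡ []
    downs-∅ [] e = refl
    downs-∅ (false ∷ C) e = cong (map (false ∷_)) (downs-∅ C e)

  sum-downs : ∀ {n} (C : Vec Bool n) m (f : Vec Bool n → Carrier) → size C ≡ suc m →
    sumAtSize n m (λ A → f A * [ A ⊆ᵇ C ]) ≡ sumL (downs C) f
  sum-downs {suc n} (false ∷ C) m f e = cong₂ _+_ (sum-downs C m _ e ∙ sym (sum-map _ (downs C))) (sumSubsets-0 n (λ A → if-0 (suc (size A) ℕ.≡ᵇ m) (zeroʳ _))) ∙ +-identityʳ _
  sum-downs {suc n} (true ∷ C) zero f e = cong₂ _+_ (below≡ C 0 _ (ℕₚ.suc-injective e))
    (sumSubsets-0 n (λ _ → refl) ∙ cong (λ l → sumL (map (true ∷_) l) f) (sym (downs-∅ C (ℕₚ.suc-injective e))))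
  sum-downs (true ∷ C) (suc m) f e = cong₂ _+_ (below≡ C (suc m) _ (ℕₚ.suc-injective e)) (sum-downs C m _ (ℕₚ.suc-injective e) ∙ sym (sum-map _ (downs C)))

  sum-ups : ∀ {n} (A : Vec Bool n) m (f : Vec Bool n → Carrier) → size A ≡ m →
    sumAtSize n (suc m) (λ C → f C * [ A ⊆ᵇ C ]) ≡ sumL (ups A) f
  sum-ups [] m f e = refl
  sum-ups (false ∷ A) m f e = cong₂ _+_ (sum-ups A m _ e ∙ sym (sum-map _ (ups A))) (above≡ A m _ e) ∙ +-comm _ _
  sum-ups {suc n} (true ∷ A) (suc m) f e = cong₂ _+_ (sumSubsets-0 n (λ C → if-0 (size C ℕ.≡ᵇ suc (suc m)) (zeroʳ _))) (sum-ups A m _ (ℕₚ.suc-injective e) ∙ sym (sum-map _ (ups A))) ∙ +-identityˡ _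

  size-++ : ∀ k {n} (C : Vec Bool (k ℕ.+ n)) → size C ≡ size (Vec.take k C) ℕ.+ size (Vec.drop k C)
  size-++ zero C = refl
  size-++ (suc k) (false ∷ C) = size-++ k C
  size-++ (suc k) (true ∷ C) = cong suc (size-++ k C)

  size≤ : ∀ {n} (C : Vec Bool n) → size C ℕ.≤ n
  size≤ [] = ℕ.z≤n
  size≤ (false ∷ C) = ℕₚ.m≤n⇒m≤1+n (size≤ C)
  size≤ (true ∷ C) = ℕ.s≤s (size≤ C)

  private
    sum-downs-size : ∀ {n} (C : Vec Bool n) (X : ℕ → Carrier) → sumL (downs C) (λ A → X (size A)) ≡ nat (size C) * X (ℕ.pred (size C))
    sum-downs-size [] X = sym (zeroˡ _)
    sum-downs-size (false ∷ C) X = sum-map _ (downs C) ∙ sum-downs-size C X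
    sum-downs-size (true ∷ C) X = cong (X (size C) +_) (sum-map _ (downs C) ∙ (sum-downs-size C (λ n → X (suc n)) ∙ fix (size C)))
      ∙ solve 2 (λ x n → x :+ n :* x := (:1 :+ n) :* x) refl (X (size C)) (nat (size C))
      where
        fix : ∀ s → nat s * X (suc (ℕ.pred s)) ≡ nat s * X s
        fix zero = zeroˡ _ ∙ sym (zeroˡ _)
        fix (suc s) = refl

    -- Deleting one of the first k elements keeps the number c of the later ones, and each of the c
    -- deletions of a later element lowers it by one. For c = 0 the value at `pred 0` is multiplied
    -- by zero.
    sum-downs-drop : ∀ k {n} (C : Vec Bool (k ℕ.+ n)) (X : ℕ → Carrier) →
      let c = size (Vec.drop k C) in
      sumL (downs C) (λ A → X (size (Vec.drop k A))) ≡ nat (size (Vec.take k C)) * X c + nat c * X (ℕ.pred c)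
    sum-downs-drop zero C X = sum-downs-size C X ∙ solve 2 (λ x y → x := :0 :* y :+ x) refl _ (X (size C))
    sum-downs-drop (suc k) (false ∷ C) X = sum-map _ (downs C) ∙ sum-downs-drop k C X
    sum-downs-drop (suc k) (true ∷ C) X = cong (_ +_) (sum-map _ (downs C) ∙ sum-downs-drop k C X)
      ∙ solve 3 (λ x n y → x :+ (n :* x :+ y) := (:1 :+ n) :* x :+ y) refl _ _ _

  -- The coefficient of a column A depends only on the number j of elements of A among the last t = k − 2; the recursion says
  -- that the row of C vanishes when C contains j + 1 of them.
  coeff : ℕ → ℕ → Carrier
  coeff t zero = inv (nat (suc t))
  coeff t (suc j) = - (nat (suc j) * coeff t j * inv (nat (t ℕ.∸ j)))

  -- A set C with j + 1 of the last t elements has t - j of the first k, so its row is cancelled by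
  -- the recursion of `coeff`. All integers that get inverted lie between 1 and t + 1 = k - 1; in
  -- particular t - j is positive because j + 1 ≤ t.
  column-combination : ∀ t → (∀ m → 0 ℕ.< m → m ℕ.< suc (suc t) → nat m ≢ 0#) → (C : Vec Bool (suc (suc t) ℕ.+ t)) → size C ≡ suc t →
    sumAtSize _ t (λ A → coeff t (size (Vec.drop (suc (suc t)) A)) * [ A ⊆ᵇ C ]) ≡ [ size (Vec.drop (suc (suc t)) C) ℕ.≡ᵇ 0 ]
  column-combination t nz C e = sum-downs C t _ e ∙ (sum-downs-drop k C (coeff t) ∙ go (size (Vec.take k C)) (size (Vec.drop k C)) (sym (size-++ k C) ∙ e) (size≤ (Vec.drop k C)))
    where
      k = suc (suc t)
      go : ∀ a c → a ℕ.+ c ≡ suc t → c ℕ.≤ t → nat a * coeff t c + nat c * coeff t (ℕ.pred c) ≡ [ c ℕ.≡ᵇ 0 ]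
      go a zero e _ = cong₂ _+_ (cong (λ n → nat n * inv (nat (suc t))) (sym (ℕₚ.+-identityʳ a) ∙ e) ∙ inv-r (nz (suc t) ℕ.z<s (ℕₚ.n<1+n _))) (zeroˡ _) ∙ +-identityʳ _
      go a (suc j) e le = begin
        nat a * coeff t (suc j) + nat (suc j) * coeff t j
          ≡⟨ cong (λ n → nat n * coeff t (suc j) + nat (suc j) * coeff t j) a≡ ⟩
        N * (- (nat (suc j) * coeff t j * inv N)) + nat (suc j) * coeff t j
          ≡⟨ solve 4 (λ n i s x → n :* (:- (s :* x :* i)) :+ s :* x := :- ((n :* i) :* (s :* x)) :+ s :* x) refl N (inv N) (nat (suc j)) (coeff t j) ⟩
        - ((N * inv N) * (nat (suc j) * coeff t j)) + nat (suc j) * coeff t j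
          ≡⟨ cong (λ y → - (y * (nat (suc j) * coeff t j)) + nat (suc j) * coeff t j) (inv-r (nz (t ℕ.∸ j) (ℕₚ.m<n⇒0<n∸m le) (ℕₚ.≤-<-trans (ℕₚ.m∸n≤m t j) (ℕₚ.<-trans (ℕₚ.n<1+n t) (ℕₚ.n<1+n (suc t)))))) ⟩
        - (1# * (nat (suc j) * coeff t j)) + nat (suc j) * coeff t j
          ≡⟨ solve 1 (λ x → :- (:1 :* x) :+ x := :0) refl _ ⟩
        0# ∎
        where
          open ≡-Reasoning
          N = nat (t ℕ.∸ j)
          a≡ : a ≡ t ℕ.∸ j
          a≡ = sym (ℕₚ.m+n∸n≡m a j) ∙ cong (ℕ._∸ j) (ℕₚ.suc-injective (sym (ℕₚ.+-suc a j) ∙ e))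

  -- Colexicographic rank

  count : ∀ n → (Vec Bool n → Bool) → ℕ
  count zero P = if P [] then 1 else 0
  count (suc n) P = count n (λ A → P (false ∷ A)) ℕ.+ count n (λ A → P (true ∷ A))

  private
    length-filter-++ : {A : Set} {P : A → Set} (P? : Decidable P) (xs ys : List A) →
      length (filter P? (xs ++ ys)) ≡ length (filter P? xs) ℕ.+ length (filter P? ys)
    length-filter-++ P? xs ys = cong length (Listₚ.filter-++ P? xs ys) ∙ length-++ (filter P? xs)

    length-filter-map : {A B : Set} {P : B → Set} (P? : Decidable P) (h : A → B) (xs : List A) →
      length (filter P? (map h xs)) ≡ length (filter (λ x → P? (h x)) xs)
    length-filter-map P? h [] = refl
    length-filter-map P? h (x ∷ xs) with does (P? (h x))
    ... | true = cong suc (length-filter-map P? h xs)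
    ... | false = length-filter-map P? h xs

  length-filter≡count : ∀ n {P : Vec Bool n → Set} (P? : Decidable P) → length (filter P? (allSubsets n)) ≡ count n (λ A → does (P? A))
  length-filter≡count zero P? with does (P? [])
  ... | true = refl
  ... | false = refl
  length-filter≡count (suc n) P? = length-filter-++ P? (map (false ∷_) (allSubsets n)) (map (true ∷_) (allSubsets n))
    ∙ cong₂ ℕ._+_ (length-filter-map P? _ (allSubsets n) ∙ length-filter≡count n (λ A → P? (false ∷ A)))
                  (length-filter-map P? _ (allSubsets n) ∙ length-filter≡count n (λ A → P? (true ∷ A)))

  count-mono : ∀ n {P Q : Vec Bool n → Bool} → (∀ A → P A ≡ true → Q A ≡ true) → count n P ℕ.≤ count n Q
  count-mono zero {P} {Q} i with P [] in eP | Q [] in eQ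
  ... | false | _ = ℕ.z≤n
  ... | true | true = ℕₚ.≤-refl
  ... | true | false with () ← sym (i [] eP) ∙ eQ
  count-mono (suc n) i = ℕₚ.+-mono-≤ (count-mono n (λ A → i (false ∷ A))) (count-mono n (λ A → i (true ∷ A)))

  count-strict : ∀ n {P Q : Vec Bool n → Bool} → (∀ A → P A ≡ true → Q A ≡ true) → ∀ A → P A ≡ false → Q A ≡ true → count n P ℕ.< count n Q
  count-strict zero {P} {Q} i [] p q with P [] | Q []
  count-strict zero i [] refl refl | _ | _ = ℕ.s≤s ℕ.z≤n
  count-strict (suc n) i (false ∷ A) p q = ℕₚ.+-mono-<-≤ (count-strict n (λ B → i (false ∷ B)) A p q) (count-mono n (λ B → i (true ∷ B)))
  count-strict (suc n) i (true ∷ A) p q = ℕₚ.+-mono-≤-< (count-mono n (λ B → i (false ∷ B))) (count-strict n (λ B → i (true ∷ B)) A p q)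

  count-none : ∀ n {P : Vec Bool n → Bool} → (∀ A → P A ≡ false) → count n P ≡ 0
  count-none zero e = cong (λ b → if b then 1 else 0) (e [])
  count-none (suc n) e = cong₂ ℕ._+_ (count-none n (λ A → e (false ∷ A))) (count-none n (λ A → e (true ∷ A)))

  low : ∀ k {n} → ℕ → Vec Bool (k ℕ.+ n) → Bool
  low k m C = (size C ℕ.≡ᵇ m) ∧ (size (Vec.drop k C) ℕ.≡ᵇ 0)

  private
    low-zero : ∀ n m (A : Vec Bool n) → low 0 (suc m) A ≡ false
    low-zero n m A with size A
    ... | zero = refl
    ... | suc s = ∧-zeroʳ (s ℕ.≡ᵇ m)

    count-low-0 : ∀ n → count n (low 0 0) ≡ 1
    count-low-0 zero = refl
    count-low-0 (suc n) = cong₂ ℕ._+_ (count-low-0 n) (count-none n (λ _ → refl))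

    count-low> : ∀ k n m → k ℕ.< m → count (k ℕ.+ n) (low k m) ≡ 0
    count-low> zero n (suc m) lt = count-none n (low-zero n m)
    count-low> (suc k) n (suc m) lt = cong₂ ℕ._+_ (count-low> k n (suc m) (ℕₚ.m<n⇒m<1+n (ℕ.s<s⁻¹ lt))) (count-low> k n m (ℕ.s<s⁻¹ lt))

    count-low≡ : ∀ k n → count (k ℕ.+ n) (low k k) ≡ 1
    count-low≡ zero n = count-low-0 n
    count-low≡ (suc k) n = cong₂ ℕ._+_ (count-low> k n (suc k) ℕₚ.≤-refl) (count-low≡ k n)

  -- There is one such subset for each element left out of the first k + 1.
  count-low : ∀ k n → count (suc k ℕ.+ n) (low (suc k) k) ≡ suc k
  count-low zero n = cong₂ ℕ._+_ (count-low-0 n) (count-none n (λ _ → refl))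
  count-low (suc k) n = cong₂ ℕ._+_ (count-low≡ (suc k) n) (count-low k n)

  private
    ==ᵥ-sound : ∀ {n} (A B : Vec Bool n) → (A ==ᵥ B) ≡ true → A ≡ B
    ==ᵥ-sound [] [] e = refl
    ==ᵥ-sound (false ∷ A) (false ∷ B) e = cong (false ∷_) (==ᵥ-sound A B e)
    ==ᵥ-sound (true ∷ A) (true ∷ B) e = cong (true ∷_) (==ᵥ-sound A B e)

    ==ᵥ-refl : ∀ {n} (A : Vec Bool n) → (A ==ᵥ A) ≡ true
    ==ᵥ-refl [] = refl
    ==ᵥ-refl (false ∷ A) = ==ᵥ-refl A
    ==ᵥ-refl (true ∷ A) = ==ᵥ-refl A

    colex-irrefl : ∀ {n} (A : Vec Bool n) → colexLT A A ≡ false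
    colex-irrefl [] = refl
    colex-irrefl (a ∷ A) rewrite ==ᵥ-refl A with a
    ... | true = refl
    ... | false = refl

    colex-∅ʳ : ∀ {n} (A Z : Vec Bool n) → size Z ≡ 0 → colexLT A Z ≡ false
    colex-∅ʳ [] [] e = refl
    colex-∅ʳ (a ∷ A) (false ∷ Z) e with A ==ᵥ Z
    ... | true = ∧-zeroʳ (not a)
    ... | false = colex-∅ʳ A Z e

    ∅-unique : ∀ {n} (A Z : Vec Bool n) → size A ≡ 0 → size Z ≡ 0 → (A ==ᵥ Z) ≡ true
    ∅-unique [] [] e f = refl
    ∅-unique (false ∷ A) (false ∷ Z) e f = ∅-unique A Z e f

    colex-∅ˡ : ∀ {n} (A C : Vec Bool n) → size A ≡ 0 → size C ≢ 0 → colexLT A C ≡ true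
    colex-∅ˡ [] [] e ne = ⊥-elim (ne refl)
    colex-∅ˡ (false ∷ A) (c ∷ C) e ne with A ==ᵥ C in eq
    colex-∅ˡ (false ∷ A) (true ∷ C) e ne | true = refl
    colex-∅ˡ (false ∷ A) (false ∷ C) e ne | true = ⊥-elim (ne (cong size (sym (==ᵥ-sound A C eq)) ∙ e))
    ... | false = colex-∅ˡ A C e (λ z → false≢true (sym eq ∙ ∅-unique A C e z))
      where
        false≢true : false ≢ true
        false≢true ()

    -- Colex order is decided at the largest element of the difference. If A reached beyond the
    -- first k elements and C did not, this element would belong to A.
    colex-low : ∀ k {n} (A C : Vec Bool (k ℕ.+ n)) → size (Vec.drop k C) ≡ 0 → colexLT A C ≡ true → size (Vec.drop k A) ≡ 0
    colex-low zero A C e lt with () ← sym lt ∙ colex-∅ʳ A C e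
    colex-low (suc k) (a ∷ A) (c ∷ C) e lt with A ==ᵥ C in eq
    ... | true = cong (size ∘ Vec.drop k) (==ᵥ-sound A C eq) ∙ e
    ... | false = colex-low k A C e lt

    low-colex : ∀ k {n} (A C : Vec Bool (k ℕ.+ n)) → size (Vec.drop k A) ≡ 0 → size (Vec.drop k C) ≢ 0 → colexLT A C ≡ true
    low-colex zero A C e ne = colex-∅ˡ A C e ne
    low-colex (suc k) (a ∷ A) (c ∷ C) e ne with A ==ᵥ C in eq
    ... | true = ⊥-elim (ne (cong (size ∘ Vec.drop k) (sym (==ᵥ-sound A C eq)) ∙ e))
    ... | false = low-colex k A C e ne

    ∧-true : ∀ {a b} → a ∧ b ≡ true → a ≡ true × b ≡ true
    ∧-true {true} {true} e = refl , refl

    ≡ᵇ-sound : ∀ {m n} → (m ℕ.≡ᵇ n) ≡ true → m ≡ n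
    ≡ᵇ-sound {m} {n} e = ℕₚ.≡ᵇ⇒≡ m n (subst Bool.T (sym e) _)

    ≡ᵇ-refl : ∀ n → (n ℕ.≡ᵇ n) ≡ true
    ≡ᵇ-refl zero = refl
    ≡ᵇ-refl (suc n) = ≡ᵇ-refl n

    <ᵇ-true : ∀ {m n} → m ℕ.< n → (m ℕ.<ᵇ n) ≡ true
    <ᵇ-true {m} {n} lt with m ℕ.<ᵇ n | ℕₚ.<⇒<ᵇ lt
    ... | true | _ = refl

    <ᵇ-false : ∀ {m n} → n ℕ.≤ m → (m ℕ.<ᵇ n) ≡ false
    <ᵇ-false {m} {n} le with m ℕ.<ᵇ n in eq
    ... | false = refl
    ... | true = ⊥-elim (ℕₚ.<⇒≱ (ℕₚ.<ᵇ⇒< m n (subst Bool.T (sym eq) _)) le)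

  -- The k first (k − 1)-subsets in colex order are those contained in the first k elements.
  vTarget≡ : ∀ t (C : Vec Bool (suc (suc t) ℕ.+ t)) → size C ≡ suc t →
    vTarget F (suc (suc t)) (suc (suc t) ℕ.+ t) C ≡ [ size (Vec.drop (suc (suc t)) C) ℕ.≡ᵇ 0 ]
  vTarget≡ t C e = cong (λ r → [ r ℕ.<ᵇ k ]) rank≡ ∙ go (size (Vec.drop k C)) refl
    where
      k = suc (suc t)
      before : Vec Bool (k ℕ.+ t) → Bool
      before A = (size A ℕ.≡ᵇ suc t) ∧ colexLT A C
      rank≡ : colexRank (suc t) C ≡ count (k ℕ.+ t) before
      rank≡ = length-filter≡count (k ℕ.+ t) (λ A → (size A ℕ.≟ suc t) Relation.Nullary.×-dec Bool.T? (colexLT A C))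
      -- If C lies within the first k elements, every set before C is one of the k low sets, and C
      -- is a low set not before itself, so the rank is less than k. Otherwise all k low sets come
      -- before C.
      go : ∀ s → size (Vec.drop k C) ≡ s → [ count (k ℕ.+ t) before ℕ.<ᵇ k ] ≡ [ s ℕ.≡ᵇ 0 ]
      go zero s≡ = cong [_] (<ᵇ-true (subst (count (k ℕ.+ t) before ℕ.<_) (count-low (suc t) t)
        (count-strict (k ℕ.+ t) imp C (cong ((size C ℕ.≡ᵇ suc t) ∧_) (colex-irrefl C) ∙ ∧-zeroʳ (size C ℕ.≡ᵇ suc t)) (cong₂ (λ a b → (a ℕ.≡ᵇ suc t) ∧ (b ℕ.≡ᵇ 0)) e s≡ ∙ cong (_∧ true) (≡ᵇ-refl t)))))
        where
          imp : ∀ A → before A ≡ true → low k (suc t) A ≡ true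
          imp A b with ∧-true b
          ... | a , lt = cong₂ (λ x y → x ∧ (y ℕ.≡ᵇ 0)) a (colex-low k A C s≡ lt)
      go (suc s) s≡ = cong [_] (<ᵇ-false (subst (ℕ._≤ count (k ℕ.+ t) before) (count-low (suc t) t) (count-mono (k ℕ.+ t) imp)))
        where
          nonzero : size (Vec.drop k C) ≢ 0
          nonzero z with () ← sym z ∙ s≡
          imp : ∀ A → low k (suc t) A ≡ true → before A ≡ true
          imp A b with ∧-true b
          ... | a , l = cong₂ _∧_ a (low-colex k A C (≡ᵇ-sound l) nonzero)

  columnSpace : ∀ k → (∀ m → 0 ℕ.< m → m ℕ.< k → nat m ≢ 0#) → InColumnSpaceH0 F k (2 ℕ.* k ℕ.∸ 2)
  -- For k = 0 and k = 1 the ground set is empty and the matrix has the single entry 1. The target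
  -- is 0 in the first case, as no position is less than 0, and 1 in the second.
  columnSpace 0 nz = (λ _ → 0#) , λ where [] _ → solve 0 (:0 :* :1 :+ :0 := :0) refl
  columnSpace 1 nz = (λ _ → 1#) , λ where [] _ → solve 0 (:1 :* :1 :+ :0 := :1) refl
  columnSpace (suc (suc t)) nz = subst (InColumnSpaceH0 F (suc (suc t))) n≡ (x , λ C e →
      sum-filter-size (suc (suc t) ℕ.+ t) t (λ A → x A * [ A ⊆ᵇ C ]) ∙ (column-combination t nz C e ∙ sym (vTarget≡ t C e)))
    where
      x : Vec Bool (suc (suc t) ℕ.+ t) → Carrier
      x A = coeff t (size (Vec.drop (suc (suc t)) A))
      n≡ : suc (suc t) ℕ.+ t ≡ 2 ℕ.* suc (suc t) ℕ.∸ 2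
      n≡ = ℕₚ.+-comm (suc (suc t)) t ∙ cong (λ x → t ℕ.+ suc (suc x)) (sym (ℕₚ.+-identityʳ t))

  -- Weights of the hyperplanes of an arc

  inL outL : ∀ {n} {I : Set} → Vec Bool n → Vec I n → List I
  inL [] [] = []
  inL (true ∷ C) (x ∷ E) = x ∷ inL C E
  inL (false ∷ C) (x ∷ E) = inL C E
  outL [] [] = []
  outL (true ∷ C) (x ∷ E) = outL C E
  outL (false ∷ C) (x ∷ E) = x ∷ outL C E

  in-out-↭ : ∀ {n} {I : Set} (C : Vec Bool n) (E : Vec I n) → Vec.toList E ↭ outL C E ++ inL C E
  in-out-↭ [] [] = refl
  in-out-↭ (false ∷ C) (x ∷ E) = prep x (in-out-↭ C E)
  in-out-↭ (true ∷ C) (x ∷ E) = ↭-trans (prep x (in-out-↭ C E)) (↭-sym (shift x (outL C E) (inL C E)))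

  length-inL : ∀ {n} {I : Set} (C : Vec Bool n) (E : Vec I n) → length (inL C E) ≡ size C
  length-inL [] [] = refl
  length-inL (false ∷ C) (x ∷ E) = length-inL C E
  length-inL (true ∷ C) (x ∷ E) = cong suc (length-inL C E)

  length-outL : ∀ {n} {I : Set} (C : Vec Bool n) (E : Vec I n) → length (outL C E) ℕ.+ size C ≡ n
  length-outL [] [] = refl
  length-outL (false ∷ C) (x ∷ E) = cong suc (length-outL C E)
  length-outL (true ∷ C) (x ∷ E) = ℕₚ.+-suc _ _ ∙ cong suc (length-outL C E)

  -- Enlarging A inserts the new vector somewhere inside the wedge. Moving it to the front costs at
  -- most a sign, which h does not see.
  sum-ups-sel : ∀ {n k} {I : Set} (v : I → Vecᶠ F k) (A : Vec Bool n) (E : Vec I n) (h : Form k → List I → Carrier) →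
    (∀ {ω ω′} out → ω ≈± ω′ → h ω out ≡ h ω′ out) →
    sumL (ups A) (λ C → h (wedge (map v (inL C E))) (outL C E)) ≡
    sumL (sel (outL A E)) (λ p → h (ext (v (proj₁ p)) (wedge (map v (inL A E)))) (proj₂ p))
  sum-ups-sel v [] [] h inv± = refl
  sum-ups-sel v (false ∷ A) (x ∷ E) h inv± = cong (h (ext (v x) (wedge (map v (inL A E)))) (outL A E) +_) (sum-map _ (ups A) ∙ (sum-ups-sel v A E (λ ω out → h ω (x ∷ out)) (λ out → inv± (x ∷ out)) ∙ sym (sum-map _ (sel (outL A E)))))
  sum-ups-sel v (true ∷ A) (x ∷ E) h inv± = sum-map _ (ups A) ∙ (sum-ups-sel v A E (λ ω out → h (ext (v x) ω) out) (λ out s → inv± out (ext-≈± (v x) s))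
    ∙ sum-≗ (sel (outL A E)) (λ p → inv± (proj₂ p) (inj₂ (ext-swap (v x) (v (proj₁ p)) _))))

  full : ∀ n → Vec Bool n
  full n = Vec.replicate n true

  inL-full : ∀ {n} {I : Set} (E : Vec I n) → inL (full n) E ≡ Vec.toList E
  inL-full [] = refl
  inL-full (x ∷ E) = cong (x ∷_) (inL-full E)

  outL-full : ∀ {n} {I : Set} (E : Vec I n) → outL (full n) E ≡ []
  outL-full [] = refl
  outL-full (x ∷ E) = outL-full E

  sum-downs-full : ∀ {n} {I : Set} (E : Vec I n) (h : List I → List I → Carrier) →
    sumL (downs (full n)) (λ C → h (inL C E) (outL C E)) ≡ sumL (sel (Vec.toList E)) (λ p → h (proj₂ p) (proj₁ p ∷ []))
  sum-downs-full [] h = refl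
  sum-downs-full {suc n} (x ∷ E) h = cong₂ _+_ (cong₂ (λ a b → h a (x ∷ b)) (inL-full E) (outL-full E))
    (sum-map _ (downs (full n)) ∙ (sum-downs-full E (λ r o → h (x ∷ r) o) ∙ sym (sum-map _ (sel (Vec.toList E)))))

  size-full : ∀ n → size (full n) ≡ n
  size-full zero = refl
  size-full (suc n) = cong suc (size-full n)

  ⊆-full : ∀ {n} (A : Vec Bool n) → (A ⊆ᵇ full n) ≡ true
  ⊆-full [] = refl
  ⊆-full (false ∷ A) = ⊆-full A
  ⊆-full (true ∷ A) = ⊆-full A

  empty : ∀ n → Vec Bool n
  empty n = Vec.replicate n false

  sum-low : ∀ k n m (f : Vec Bool (k ℕ.+ n) → Carrier) →
    sumAtSize (k ℕ.+ n) m (λ C → [ size (Vec.drop k C) ℕ.≡ᵇ 0 ] * f C) ≡ sumAtSize k m (λ C → f (C Vec.++ empty n))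
  sum-low zero zero m f = cong (λ x → if 0 ℕ.≡ᵇ m then x else 0#) (*-identityˡ _)
  sum-low zero (suc n) m f = cong₂ _+_ (sum-low zero n m (λ C → f (false ∷ C))) (sumSubsets-0 n (λ A → if-0 (suc (size A) ℕ.≡ᵇ m) (zeroˡ _))) ∙ +-identityʳ _
  sum-low (suc k) n zero f = cong₂ _+_ (sum-low k n zero (λ C → f (false ∷ C))) (sumSubsets-0 (k ℕ.+ n) (λ _ → refl) ∙ sym (sumSubsets-0 k (λ _ → refl)))
  sum-low (suc k) n (suc m) f = cong₂ _+_ (sum-low k n (suc m) (λ C → f (false ∷ C))) (sum-low k n m (λ C → f (true ∷ C)))

  inL-++ : ∀ {k n} {I : Set} (C : Vec Bool k) (K : Vec I k) (U : Vec I n) → inL (C Vec.++ empty n) (K Vec.++ U) ≡ inL C K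
  inL-++ [] [] [] = refl
  inL-++ [] [] (u ∷ U) = inL-++ [] [] U
  inL-++ (false ∷ C) (x ∷ K) U = inL-++ C K U
  inL-++ (true ∷ C) (x ∷ K) U = cong (x ∷_) (inL-++ C K U)

  outL-++ : ∀ {k n} {I : Set} (C : Vec Bool k) (K : Vec I k) (U : Vec I n) → outL (C Vec.++ empty n) (K Vec.++ U) ≡ outL C K ++ Vec.toList U
  outL-++ [] [] [] = refl
  outL-++ [] [] (u ∷ U) = cong (u ∷_) (outL-++ [] [] U)
  outL-++ (false ∷ C) (x ∷ K) U = cong (x ∷_) (outL-++ C K U)
  outL-++ (true ∷ C) (x ∷ K) U = outL-++ C K U

  AllPairs-prepend : {A : Set} (xs As : List A) → Unique (xs ++ As) → AllPairs (λ u z → Unique (u ∷ z ∷ As)) xs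
  AllPairs-prepend [] As u = []
  AllPairs-prepend {A} (x ∷ xs) As (r ∷ u) = All.tabulate pair ∷ AllPairs-prepend xs As u
    where
      UAs : ∀ xs → Unique (xs ++ As) → Unique As
      UAs [] u = u
      UAs (_ ∷ xs) (_ ∷ u) = UAs xs u
      apart : ∀ xs {z} → Unique (xs ++ As) → z ∈ xs → All (z ≢_) As
      apart (_ ∷ xs) (r ∷ _) (here refl) = All.tabulate (λ m → All.lookup r (∈-++⁺ʳ xs m))
      apart (_ ∷ xs) (_ ∷ u) (there m) = apart xs u m
      pair : ∀ {z} → z ∈ xs → Unique (x ∷ z ∷ As)
      pair m = (All.lookup r (∈-++⁺ˡ m) ∷ All.tabulate (λ m′ → All.lookup r (∈-++⁺ʳ xs m′))) ∷ (apart xs u m ∷ UAs xs u)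

  module GeneralPosition (t : ℕ) {I : Set} (v : I → Vecᶠ F (suc (suc t)))
    (basis : ∀ xs → Unique xs → length xs ≡ suc (suc t) → SpansL v xs) where

    private
      k : ℕ
      k = suc (suc t)

    det≢0 : ∀ xs → Unique xs → length xs ≡ k → top (wedge (map v xs)) ≢ 0#
    det≢0 xs u l = spans⇒det≢0 v xs l (basis xs u l)

    -- The quantity D_C for ω the wedge of C, with Y = S∖E and out = E∖C: as S∖C is the union of the
    -- two, the determinants of out occur twice.
    weight : List I → Form k → List I → Carrier
    weight Y ω out = prodL Y (λ y → top (ext (v y) ω)) * (prodL out (λ u → top (ext (v u) ω)) * prodL out (λ u → top (ext (v u) ω)))

    private
      prod-neg : ∀ (xs : List I) (f : I → Carrier) → prodL xs (λ x → - f x) ≡ pw (- 1#) (length xs) * prodL xs f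
      prod-neg xs f = prod-cong xs (λ {x} _ → solve 1 (λ a → :- a := :- :1 :* a) refl (f x)) ∙ (prod-* xs (λ _ → - 1#) f ∙ cong (_* prodL xs f) (prod-const xs (- 1#)))

      pw-neg-sq : ∀ n → pw (- 1#) n * pw (- 1#) n ≡ 1#
      pw-neg-sq n = sym (pw-* (- 1#) (- 1#) n) ∙ (cong (λ x → pw x n) (solve 0 (:- :1 :* :- :1 := :1) refl) ∙ pw-1 n)

    -- The sign of ω enters to the power |Y| + 2(k − 1) = q + 1, and x^(q+1) = x².
    weight-± : ∀ Y → length Y ℕ.+ (suc t ℕ.+ suc t) ≡ suc q → ∀ {ω ω′} out → ω ≈± ω′ → weight Y ω out ≡ weight Y ω′ out
    weight-± Y len out (inj₁ e) = cong₂ (λ a b → a * (b * b)) (prod-cong Y (λ {y} _ → ext-cong (v y) e (full k))) (prod-cong out (λ {y} _ → ext-cong (v y) e (full k)))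
    weight-± Y len {ω} {ω′} out (inj₂ e) = begin
      weight Y ω out
        ≡⟨ cong₂ (λ a b → a * (b * b)) (prod-cong Y (λ {y} _ → ext-neg (v y) e (full k)) ∙ prod-neg Y f) (prod-cong out (λ {y} _ → ext-neg (v y) e (full k)) ∙ prod-neg out f) ⟩
      (pw (- 1#) (length Y) * prodL Y f) * ((s * prodL out f) * (s * prodL out f))
        ≡⟨ solve 4 (λ a b s c → (a :* b) :* ((s :* c) :* (s :* c)) := (a :* (s :* s)) :* (b :* (c :* c))) refl _ _ s _ ⟩
      (pw (- 1#) (length Y) * (s * s)) * weight Y ω′ out
        ≡⟨ cong (_* weight Y ω′ out) sign ∙ *-identityˡ _ ⟩
      weight Y ω′ out ∎
      where
        open ≡-Reasoning
        f : I → Carrier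
        f y = top (ext (v y) ω′)
        s = pw (- 1#) (length out)
        sign : pw (- 1#) (length Y) * (s * s) ≡ 1#
        sign = begin
          pw (- 1#) (length Y) * (s * s)
            ≡⟨ cong (pw (- 1#) (length Y) *_) (pw-neg-sq (length out) ∙ sym (pw-neg-sq (suc t))) ⟩
          pw (- 1#) (length Y) * (pw (- 1#) (suc t) * pw (- 1#) (suc t))
            ≡⟨ sym (pw-+ (- 1#) (length Y) (suc t ℕ.+ suc t) ∙ cong (pw (- 1#) (length Y) *_) (pw-+ (- 1#) (suc t) (suc t))) ⟩
          pw (- 1#) (length Y ℕ.+ (suc t ℕ.+ suc t))
            ≡⟨ cong (pw (- 1#)) len ⟩
          - 1# * pw (- 1#) q
            ≡⟨ cong (- 1# *_) (fermat (- 1#)) ⟩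
          - 1# * - 1#
            ≡⟨ solve 0 (:- :1 :* :- :1 := :1) refl ⟩
          1# ∎

    -- Modulo the span of As the vectors become pairwise independent vectors of a plane, whose coordinates α, β refer to the
    -- basis y₀, y₁.
    tangent-identity : ∀ As y₀ y₁ R Z → length As ≡ t → length Z ≡ suc (suc t) → Unique (y₀ ∷ ((y₁ ∷ R) ++ Z) ++ As) →
      length (y₁ ∷ R) ℕ.+ (length Z ℕ.+ t) ≡ q →
      sumL (sel Z) (λ p → inv (weight (y₀ ∷ y₁ ∷ R) (ext (v (proj₁ p)) (wedge (map v As))) (proj₂ p))) ≡ 0#
    tangent-identity As y₀ y₁ R Z lenA lenZ u len = sum-cong (sel Z) term ∙ weighted-identity β s κ Rs Z t uniq len lenZ
      where
        open ≡-Reasoning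
        Rs = y₁ ∷ R
        ωA = wedge (map v As)
        B = full k
        bk : I → I → Carrier
        bk u z = top (ext (v u) (ext (v z) ωA))
        κ = bk y₀ y₁
        Ub : Unique (y₀ ∷ y₁ ∷ As)
        Ub = All.head (AllPairs.head (AllPairs-prepend (y₀ ∷ Rs ++ Z) As u))
        coord : ∀ w → ∃ λ (d : I → Carrier) → ∀ r → w r ≡ sumL (y₀ ∷ y₁ ∷ As) (λ x → d x * v x r)
        coord = basis (y₀ ∷ y₁ ∷ As) Ub (cong (2 ℕ.+_) lenA)
        α β s : I → Carrier
        α x = proj₁ (coord (v x)) y₀
        β x = proj₁ (coord (v x)) y₁
        -- The affine parameter on the projective line of the quotient by A. The point at infinity
        -- is `y₀`, which is why it is kept apart from `Rs`.
        s x = α x * inv (β x)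
        bk-anti : ∀ x y → bk x y ≡ - bk y x
        bk-anti x y = ext-swap (v x) (v y) ωA B
        bk-self : ∀ x → bk x x ≡ 0#
        bk-self x = ext-sq (v x) ωA B
        bk-A : ∀ {a} → a ∈ As → ∀ z → bk a z ≡ 0#
        bk-A {a} m z = bk-anti a z ∙ (cong -_ (ext-0 (v z) (ext-member (∈-map⁺ v m)) B) ∙ -0#≈0#)
        bk-expand : ∀ x z → bk x z ≡ α x * bk y₀ z + β x * bk y₁ z
        bk-expand x z = ext-sum (y₀ ∷ y₁ ∷ As) (proj₁ (coord (v x))) v (ext (v z) ωA) (proj₂ (coord (v x))) B
          ∙ (cong (λ w → α x * bk y₀ z + (β x * bk y₁ z + w)) (sum-0 As (λ {a} m → cong (proj₁ (coord (v x)) a *_) (bk-A m z) ∙ zeroʳ _))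
          ∙ solve 2 (λ a b → a :+ (b :+ :0) := a :+ b) refl _ _)
        bk-y₀ : ∀ z → bk y₀ z ≡ κ * β z
        bk-y₀ z = begin
          bk y₀ z ≡⟨ bk-anti y₀ z ⟩
          - bk z y₀ ≡⟨ cong -_ (bk-expand z y₀) ⟩
          - (α z * bk y₀ y₀ + β z * bk y₁ y₀) ≡⟨ cong₂ (λ a b → - (α z * a + β z * b)) (bk-self y₀) (bk-anti y₁ y₀) ⟩
          - (α z * 0# + β z * - κ) ≡⟨ solve 3 (λ a b k → :- (a :* :0 :+ b :* :- k) := k :* b) refl (α z) (β z) κ ⟩
          κ * β z ∎
        bk-y₁ : ∀ z → bk y₁ z ≡ - (κ * α z)
        bk-y₁ z = begin
          bk y₁ z ≡⟨ bk-anti y₁ z ⟩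
          - bk z y₁ ≡⟨ cong -_ (bk-expand z y₁) ⟩
          - (α z * κ + β z * bk y₁ y₁) ≡⟨ cong (λ b → - (α z * κ + β z * b)) (bk-self y₁) ⟩
          - (α z * κ + β z * 0#) ≡⟨ solve 3 (λ a b k → :- (a :* k :+ b :* :0) := :- (k :* a)) refl (α z) (β z) κ ⟩
          - (κ * α z) ∎
        bk-αβ : ∀ x z → bk x z ≡ κ * (α x * β z + - (β x * α z))
        bk-αβ x z = bk-expand x z ∙ (cong₂ (λ a b → α x * a + β x * b) (bk-y₀ z) (bk-y₁ z)
          ∙ solve 5 (λ a b c d k → a :* (k :* d) :+ b :* :- (k :* c) := k :* (a :* d :+ :- (b :* c))) refl (α x) (β x) (α z) (β z) κ)
        β≢0 : ∀ {x} → x ∈ Rs ++ Z → β x ≢ 0#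
        β≢0 {x} m = ≢0ʳ (λ e → det≢0 (y₀ ∷ x ∷ As) (All.lookup (AllPairs.head (AllPairs-prepend (y₀ ∷ Rs ++ Z) As u)) m) (cong (2 ℕ.+_) lenA) (bk-y₀ x ∙ e))
        bk-s : ∀ {x z} → x ∈ Rs ++ Z → z ∈ Rs ++ Z → bk x z ≡ κ * (β x * β z * (s x + - s z))
        bk-s {x} {z} mx mz = bk-αβ x z ∙ cong (κ *_) (sym (begin
          β x * β z * (α x * inv (β x) + - (α z * inv (β z)))
            ≡⟨ solve 6 (λ a b c d i j → b :* d :* (a :* i :+ :- (c :* j)) := a :* d :* (b :* i) :+ :- (b :* c :* (d :* j))) refl (α x) (β x) (α z) (β z) (inv (β x)) (inv (β z)) ⟩
          α x * β z * (β x * inv (β x)) + - (β x * α z * (β z * inv (β z)))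
            ≡⟨ cong₂ (λ a b → α x * β z * a + - (β x * α z * b)) (inv-r (β≢0 mx)) (inv-r (β≢0 mz)) ⟩
          α x * β z * 1# + - (β x * α z * 1#)
            ≡⟨ cong₂ (λ a b → a + - b) (*-identityʳ _) (*-identityʳ _) ⟩
          α x * β z + - (β x * α z) ∎))
        distinct : ∀ {x z} → x ∈ Rs ++ Z → z ∈ Rs ++ Z → Unique (x ∷ z ∷ As) → s x ≢ s z
        distinct {x} {z} mx mz uq e = det≢0 (x ∷ z ∷ As) uq (cong (2 ℕ.+_) lenA) (bk-s mx mz
          ∙ (cong (λ a → κ * (β x * β z * (a + - s z))) e ∙ solve 3 (λ k b s → k :* (b :* (s :+ :- s)) := :0) refl κ (β x * β z) (s z)))
        unique-s : ∀ xs → (∀ {x} → x ∈ xs → x ∈ Rs ++ Z) → AllPairs (λ x z → Unique (x ∷ z ∷ As)) xs → Unique (map s xs)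
        unique-s [] _ _ = []
        unique-s (x ∷ xs) sub (r ∷ ps) = All.tabulate (λ m → lem (∈-map⁻ s m)) ∷ unique-s xs (λ m → sub (there m)) ps
          where
            lem : ∀ {y} → (∃ λ z → z ∈ xs × y ≡ s z) → s x ≢ y
            lem (z , m , refl) = distinct (sub (here refl)) (sub (there m)) (All.lookup r m)
        uniq : Unique (map s (Rs ++ Z))
        uniq = unique-s (Rs ++ Z) (λ m → m) (AllPairs.tail (AllPairs-prepend (y₀ ∷ Rs ++ Z) As u))
        term : ∀ {p} → p ∈ sel Z → inv (weight (y₀ ∷ Rs) (ext (v (proj₁ p)) ωA) (proj₂ p)) ≡
          inv (κ * β (proj₁ p) * prodL Rs (λ y → κ * (β y * β (proj₁ p) * (s y + - s (proj₁ p)))) *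
            (prodL (proj₂ p) (λ u → κ * (β u * β (proj₁ p) * (s u + - s (proj₁ p)))) * prodL (proj₂ p) (λ u → κ * (β u * β (proj₁ p) * (s u + - s (proj₁ p))))))
        term {z , rest} m = cong inv (cong₂ (λ a b → a * (b * b))
          (cong₂ _*_ (bk-y₀ z) (prod-cong Rs (λ m′ → bk-s (∈-++⁺ˡ m′) mz)))
          (prod-cong rest (λ m′ → bk-s (∈-++⁺ʳ Rs (∈-resp-↭ (↭-sym (sel-↭ Z m)) (there m′))) mz)))
          where
            mz : z ∈ Rs ++ Z
            mz = ∈-++⁺ʳ Rs (∈-sel Z m)

    -- The weights of the (k − 1)-subsets of K ∪ U are orthogonal to the columns of the inclusion matrix by the tangent identity,
    -- hence to the vector v.
    hyperplane-identity : (∀ m → 0 ℕ.< m → m ℕ.< k → nat m ≢ 0#) → ∀ (K : Vec I k) (U : Vec I t) y₀ y₁ R →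
      Unique (y₀ ∷ y₁ ∷ R ++ Vec.toList (K Vec.++ U)) → length (y₀ ∷ y₁ ∷ R) ℕ.+ (suc t ℕ.+ suc t) ≡ suc q →
      sumL (sel (Vec.toList K)) (λ p → inv (weight (y₀ ∷ y₁ ∷ R) (wedge (map v (proj₂ p))) (proj₁ p ∷ Vec.toList U))) ≡ 0#
    hyperplane-identity nz K U y₀ y₁ R u len = sym (begin
      0#
        ≡⟨ sym (sum-0 LA (λ {A} m → cong (x A *_) (vanish A (proj₂ (∈-filter⁻ (λ A → size A ℕ.≟ t) {xs = allSubsets n} m))) ∙ zeroʳ _)) ⟩
      sumL LA (λ A → x A * sumL LC (λ C → g C * [ A ⊆ᵇ C ]))
        ≡⟨ sum-≗ LA (λ A → sym (sum-*ˡ LC (x A) _)) ⟩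
      sumL LA (λ A → sumL LC (λ C → x A * (g C * [ A ⊆ᵇ C ])))
        ≡⟨ sum-swap LA LC _ ⟩
      sumL LC (λ C → sumL LA (λ A → x A * (g C * [ A ⊆ᵇ C ])))
        ≡⟨ sum-≗ LC (λ C → sum-≗ LA (λ A → solve 3 (λ a b c → a :* (b :* c) := b :* (a :* c)) refl (x A) (g C) [ A ⊆ᵇ C ]) ∙ sum-*ˡ LA (g C) _) ⟩
      sumL LC (λ C → g C * sumL LA (λ A → x A * [ A ⊆ᵇ C ]))
        ≡⟨ sum-cong LC (λ {C} m → *-comm _ _ ∙ cong (_* g C) (sum-filter-size n t _ ∙ column-combination t nz C (proj₂ (∈-filter⁻ (λ A → size A ℕ.≟ suc t) {xs = allSubsets n} m)))) ⟩
      sumL LC (λ C → [ size (Vec.drop k C) ℕ.≡ᵇ 0 ] * g C)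
        ≡⟨ sum-filter-size n (suc t) _ ⟩
      sumAtSize n (suc t) (λ C → [ size (Vec.drop k C) ℕ.≡ᵇ 0 ] * g C)
        ≡⟨ sum-low k t (suc t) g ⟩
      sumAtSize k (suc t) (λ C → g (C Vec.++ empty t))
        ≡⟨ sym (sum-filter-size k (suc t) _) ∙ (sum-≗ LK (λ C → sym (cong (λ b → g (C Vec.++ empty t) * [ b ]) (⊆-full C) ∙ *-identityʳ _)) ∙ sum-filter-size k (suc t) _) ⟩
      sumAtSize k (suc t) (λ C → g (C Vec.++ empty t) * [ C ⊆ᵇ full k ])
        ≡⟨ sum-downs (full k) (suc t) (λ C → g (C Vec.++ empty t)) (size-full k) ⟩
      sumL (downs (full k)) (λ C → g (C Vec.++ empty t))
        ≡⟨ sum-≗ (downs (full k)) (λ C → cong₂ (λ a b → h (wedge (map v a)) b) (inL-++ C K U) (outL-++ C K U)) ⟩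
      sumL (downs (full k)) (λ C → h (wedge (map v (inL C K))) (outL C K ++ Vec.toList U))
        ≡⟨ sum-downs-full K (λ a b → h (wedge (map v a)) (b ++ Vec.toList U)) ⟩
      sumL (sel (Vec.toList K)) (λ p → h (wedge (map v (proj₂ p))) (proj₁ p ∷ Vec.toList U)) ∎)
      where
        open ≡-Reasoning
        n = k ℕ.+ t
        E = K Vec.++ U
        Y = y₀ ∷ y₁ ∷ R
        LA = filter (λ A → size A ℕ.≟ t) (allSubsets n)
        LC = filter (λ A → size A ℕ.≟ suc t) (allSubsets n)
        LK = filter (λ A → size A ℕ.≟ suc t) (allSubsets k)
        h : Form k → List I → Carrier
        h ω out = inv (weight Y ω out)
        g : Vec Bool n → Carrier
        g C = h (wedge (map v (inL C E))) (outL C E)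
        x : Vec Bool n → Carrier
        x A = coeff t (size (Vec.drop k A))
        vanish : ∀ A → size A ≡ t → sumL LC (λ C → g C * [ A ⊆ᵇ C ]) ≡ 0#
        vanish A sz = sum-filter-size n (suc t) _ ∙ (sum-ups A t g sz ∙ (sum-ups-sel v A E h (λ out s → cong inv (weight-± Y len out s))
          ∙ tangent-identity (inL A E) y₀ y₁ R (outL A E) (length-inL A E ∙ sz) lenZ
              (Unique-↭ (prep y₀ (prep y₁ (↭-trans (Permₚ.++⁺ˡ R (in-out-↭ A E)) (↭-reflexive (sym (Listₚ.++-assoc R (outL A E) (inL A E))))))) u) lens))
          where
            lenZ : length (outL A E) ≡ k
            lenZ = ℕₚ.+-cancelʳ-≡ t (length (outL A E)) k (cong (length (outL A E) ℕ.+_) (sym sz) ∙ length-outL A E)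
            lens : length (y₁ ∷ R) ℕ.+ (length (outL A E) ℕ.+ t) ≡ q
            lens = cong (λ a → length (y₁ ∷ R) ℕ.+ (a ℕ.+ t)) lenZ ∙ (cong (λ a → length (y₁ ∷ R) ℕ.+ suc a) (sym (ℕₚ.+-suc t t)) ∙ ℕₚ.suc-injective len)

  -- Row reduction

  sum-tabulate : ∀ {A : Set} m (g : Fin m → A) (f : A → Carrier) → sumL (tabulate g) f ≡ ∑ F m (λ i → f (g i))
  sum-tabulate zero g f = refl
  sum-tabulate (suc m) g f = cong (f (g zero) +_) (sum-tabulate m (λ i → g (suc i)) f)

  ∑≡sum : ∀ m f → ∑ F m f ≡ sumL (allFin m) f
  ∑≡sum m f = sym (sum-tabulate m (λ i → i) f)

  e : ∀ {k} → Fin k → Vecᶠ F k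
  e i r = [ does (i Fin.≟ r) ]

  e-same : ∀ {k} (i : Fin k) → e i i ≡ 1#
  e-same i with i Fin.≟ i
  ... | yes _ = refl
  ... | no ne = ⊥-elim (ne refl)

  e-diff : ∀ {k} {i r : Fin k} → i ≢ r → e i r ≡ 0#
  e-diff {i = i} {r} ne with i Fin.≟ r
  ... | yes eq = ⊥-elim (ne eq)
  ... | no _ = refl

  e-sym : ∀ {k} (i r : Fin k) → e i r ≡ e r i
  e-sym i r with i Fin.≟ r
  ... | yes refl = sym (e-same i)
  ... | no ne = sym (e-diff (λ eq → ne (sym eq)))

  ∈-split : {A : Set} {x : A} {xs : List A} → x ∈ xs → ∃ λ ys → xs ↭ x ∷ ys
  ∈-split {x = x} m with ∈-∃++ m
  ... | as , bs , refl = as ++ bs , shift x as bs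

  sum-single : ∀ {A : Set} (xs : List A) → Unique xs → ∀ {x} → x ∈ xs → (f : A → Carrier) → (∀ {y} → y ∈ xs → y ≢ x → f y ≡ 0#) → sumL xs f ≡ f x
  sum-single xs u {x} m f z with ∈-split m
  ... | ys , p = sum-↭ f p ∙ (cong (f x +_) (sum-0 ys (λ m′ → z (∈-resp-↭ (↭-sym p) (there m′)) (λ { refl → ∉-Unique (Unique-↭ p u) m′ }))) ∙ +-identityʳ _)

  sum-e : ∀ {k} (a : Fin k → Carrier) (r : Fin k) → sumL (allFin k) (λ j → a j * e j r) ≡ a r
  sum-e {k} a r = sum-single (allFin k) (allFin⁺ k) (∈-allFin r) _ (λ _ ne → cong (a _ *_) (e-diff ne) ∙ zeroʳ _)
    ∙ (cong (a r *_) (e-same r) ∙ *-identityʳ _)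

  -- Linear relations between columns are the invariant of row operations: through them independence
  -- and interpolation identities pass to and from reduced matrices.
  Rel : ∀ {k N} → Mat F k N → List (Fin N) → (Fin N → Carrier) → Set
  Rel {k} M xs α = ∀ r → sumL xs (λ c → α c * M r c) ≡ 0#

  -- Row equivalence. The backward steps are recorded as well, since two arcs will be compared by
  -- descending from one to its reduced matrix and ascending to the other.
  record _⇝_ {k N} (M M′ : Mat F k N) : Set where
    field
      to : Star (ElemStep F) M M′
      from : Star (ElemStep F) M′ M
      rel→ : ∀ xs α → Rel M xs α → Rel M′ xs α
      rel← : ∀ xs α → Rel M′ xs α → Rel M xs α
  open _⇝_

  -- Matrices with equal entries need not be equal as functions; the identity permutation of the
  -- columns bridges the gap.
  ≗⇒Star : ∀ {k N} {M M′ : Mat F k N} → (∀ r c → M′ r c ≡ M r c) → Star (ElemStep F) M M′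
  ≗⇒Star eq = colPerm Perm.id eq ◅ ε

  ≗⇒⇝ : ∀ {k N} {M M′ : Mat F k N} → (∀ r c → M′ r c ≡ M r c) → M ⇝ M′
  ≗⇒⇝ eq .to = ≗⇒Star eq
  ≗⇒⇝ eq .from = ≗⇒Star (λ r c → sym (eq r c))
  ≗⇒⇝ eq .rel→ xs α h r = sum-≗ xs (λ c → cong (α c *_) (eq r c)) ∙ h r
  ≗⇒⇝ eq .rel← xs α h r = sum-≗ xs (λ c → cong (α c *_) (sym (eq r c))) ∙ h r

  ⇝-trans : ∀ {k N} {M M′ M″ : Mat F k N} → M ⇝ M′ → M′ ⇝ M″ → M ⇝ M″
  ⇝-trans a b .to = to a ◅◅ to b
  ⇝-trans a b .from = from b ◅◅ from a
  ⇝-trans a b .rel→ xs α h = rel→ b xs α (rel→ a xs α h)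
  ⇝-trans a b .rel← xs α h = rel← a xs α (rel← b xs α h)

  if-same : ∀ {k} (i : Fin k) {A : Set} {x y : A} → (if toℕ i ℕ.≡ᵇ toℕ i then x else y) ≡ x
  if-same i with toℕ i ℕ.≡ᵇ toℕ i | ℕₚ.≡⇒≡ᵇ (toℕ i) (toℕ i) refl
  ... | true | _ = refl

  if-diff : ∀ {k} {r i : Fin k} → r ≢ i → {A : Set} {x y : A} → (if toℕ r ℕ.≡ᵇ toℕ i then x else y) ≡ y
  if-diff {r = r} {i} ne with toℕ r ℕ.≡ᵇ toℕ i in eq
  ... | false = refl
  ... | true = ⊥-elim (ne (Finₚ.toℕ-injective (ℕₚ.≡ᵇ⇒≡ _ _ (subst Bool.T (sym eq) _))))

  rowAdd⇝ : ∀ {k N} (M M′ : Mat F k N) (i j : Fin k) → i ≢ j → ∀ μ → (∀ c → M′ i c ≡ M i c + μ * M j c) → (∀ {r} → r ≢ i → ∀ c → M′ r c ≡ M r c) → M ⇝ M′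
  rowAdd⇝ {k} {N} M M′ i j ne μ at off = record
    { to = rowAdd i j ne μ step ◅ ε
    ; from = rowAdd i j ne (- μ) step′ ◅ ε
    ; rel→ = preserve M M′ μ at off
    ; rel← = preserve M′ M (- μ) at′ (λ n c → sym (off n c))
    }
    where
      at′ : ∀ c → M i c ≡ M′ i c + - μ * M′ j c
      at′ c = solve 3 (λ x m y → x := (x :+ m :* y) :+ :- m :* y) refl (M i c) μ (M j c)
        ∙ sym (cong₂ (λ x y → x + - μ * y) (at c) (off (λ eq → ne (sym eq)) c))
      step : ∀ r c → M′ r c ≡ (if toℕ r ℕ.≡ᵇ toℕ i then M i c + μ * M j c else M r c)
      step r c with r Fin.≟ i
      ... | yes refl = at c ∙ sym (if-same r)
      ... | no n = off n c ∙ sym (if-diff n)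
      step′ : ∀ r c → M r c ≡ (if toℕ r ℕ.≡ᵇ toℕ i then M′ i c + - μ * M′ j c else M′ r c)
      step′ r c with r Fin.≟ i
      ... | yes refl = at′ c ∙ sym (if-same r)
      ... | no n = sym (off n c) ∙ sym (if-diff n)
      preserve : ∀ (M M′ : Mat F k N) μ → (∀ c → M′ i c ≡ M i c + μ * M j c) → (∀ {r} → r ≢ i → ∀ c → M′ r c ≡ M r c) → ∀ xs α → Rel M xs α → Rel M′ xs α
      preserve M M′ μ at off xs α h r with r Fin.≟ i
      ... | no n = sum-≗ xs (λ c → cong (α c *_) (off n c)) ∙ h r
      ... | yes refl = begin
        sumL xs (λ c → α c * M′ r c)
          ≡⟨ sum-≗ xs (λ c → cong (α c *_) (at c) ∙ solve 4 (λ a x m y → a :* (x :+ m :* y) := a :* x :+ m :* (a :* y)) refl (α c) (M r c) μ (M j c)) ⟩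
        sumL xs (λ c → α c * M r c + μ * (α c * M j c))
          ≡⟨ sum-+ xs _ _ ∙ cong (sumL xs (λ c → α c * M r c) +_) (sum-*ˡ xs μ _) ⟩
        sumL xs (λ c → α c * M r c) + μ * sumL xs (λ c → α c * M j c)
          ≡⟨ cong₂ (λ x y → x + μ * y) (h r) (h j) ⟩
        0# + μ * 0#
          ≡⟨ solve 1 (λ m → :0 :+ m :* :0 := :0) refl μ ⟩
        0# ∎
        where open ≡-Reasoning

  rowScale⇝ : ∀ {k N} (M M′ : Mat F k N) (i : Fin k) → ∀ μ → μ ≢ 0# → (∀ c → M′ i c ≡ μ * M i c) → (∀ {r} → r ≢ i → ∀ c → M′ r c ≡ M r c) → M ⇝ M′
  rowScale⇝ {k} {N} M M′ i μ μ≢0 at off = record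
    { to = step M M′ μ μ≢0 at off ◅ ε
    ; from = step M′ M (inv μ) (inv≢0 μ≢0) at′ (λ n c → sym (off n c)) ◅ ε
    ; rel→ = preserve M M′ μ at off
    ; rel← = preserve M′ M (inv μ) at′ (λ n c → sym (off n c))
    }
    where
      at′ : ∀ c → M i c ≡ inv μ * M′ i c
      at′ c = sym (*-identityˡ _) ∙ (cong (_* M i c) (sym (inv-l μ≢0)) ∙ (*-assoc _ _ _ ∙ cong (inv μ *_) (sym (at c))))
      step : ∀ (M M′ : Mat F k N) μ → μ ≢ 0# → (∀ c → M′ i c ≡ μ * M i c) → (∀ {r} → r ≢ i → ∀ c → M′ r c ≡ M r c) → ElemStep F M M′
      step M M′ μ nz at off = rowScale i μ nz go
        where
          go : ∀ r c → M′ r c ≡ (if toℕ r ℕ.≡ᵇ toℕ i then μ * M r c else M r c)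
          go r c with r Fin.≟ i
          ... | yes refl = at c ∙ sym (if-same r)
          ... | no n = off n c ∙ sym (if-diff n)
      preserve : ∀ (M M′ : Mat F k N) μ → (∀ c → M′ i c ≡ μ * M i c) → (∀ {r} → r ≢ i → ∀ c → M′ r c ≡ M r c) → ∀ xs α → Rel M xs α → Rel M′ xs α
      preserve M M′ μ at off xs α h r with r Fin.≟ i
      ... | no n = sum-≗ xs (λ c → cong (α c *_) (off n c)) ∙ h r
      ... | yes refl = sum-≗ xs (λ c → cong (α c *_) (at c) ∙ solve 3 (λ a m y → a :* (m :* y) := m :* (a :* y)) refl (α c) μ (M r c))
        ∙ (sum-*ˡ xs μ _ ∙ (cong (μ *_) (h r) ∙ zeroʳ μ))

  -- Because of μ j = 0 the source row j never changes, so the simultaneous addition can be carried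
  -- out row by row.
  addRows⇝ : ∀ {k N} (M : Mat F k N) (j : Fin k) (μ : Fin k → Carrier) → μ j ≡ 0# → M ⇝ (λ r c → M r c + μ r * M j c)
  addRows⇝ {k} {N} M j μ μj = ⇝-trans (go (allFin k)) (≗⇒⇝ (λ r c → cong (λ x → M r c + x * M j c) (sym (sum-e μ r))))
    where
      coef : List (Fin k) → Fin k → Carrier
      coef rs r = sumL rs (λ i → μ i * e i r)
      coef-j : ∀ rs → coef rs j ≡ 0#
      coef-j rs = sum-0 rs (λ {i} _ → lem i)
        where
          lem : ∀ i → μ i * e i j ≡ 0#
          lem i with i Fin.≟ j
          ... | yes refl = cong (_* 1#) μj ∙ zeroˡ _
          ... | no _ = zeroʳ _
      after : List (Fin k) → Mat F k N
      after rs r c = M r c + coef rs r * M j c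
      go : ∀ rs → M ⇝ after rs
      go [] = ≗⇒⇝ (λ r c → cong (M r c +_) (zeroˡ _) ∙ +-identityʳ _)
      go (i ∷ rs) = ⇝-trans (go rs) (step (i Fin.≟ j))
        where
          off : ∀ {r} → r ≢ i → ∀ c → after (i ∷ rs) r c ≡ after rs r c
          off {r} n c = cong (λ x → M r c + (x + coef rs r) * M j c) (cong (μ i *_) (e-diff (λ eq → n (sym eq))) ∙ zeroʳ _) ∙ cong (λ x → M r c + x * M j c) (+-identityˡ _)
          at : ∀ c → after (i ∷ rs) i c ≡ after rs i c + μ i * after rs j c
          at c = begin
            M i c + (μ i * e i i + coef rs i) * M j c ≡⟨ cong (λ x → M i c + (μ i * x + coef rs i) * M j c) (e-same i) ⟩
            M i c + (μ i * 1# + coef rs i) * M j c ≡⟨ solve 4 (λ x m y z → x :+ (m :* :1 :+ y) :* z := (x :+ y :* z) :+ m :* (z :+ :0 :* z)) refl (M i c) (μ i) (coef rs i) (M j c) ⟩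
            after rs i c + μ i * (M j c + 0# * M j c) ≡⟨ cong (λ x → after rs i c + μ i * (M j c + x * M j c)) (sym (coef-j rs)) ⟩
            after rs i c + μ i * after rs j c ∎
            where open ≡-Reasoning
          step : Dec (i ≡ j) → after rs ⇝ after (i ∷ rs)
          step (no ne) = rowAdd⇝ _ _ i j ne (μ i) at off
          step (yes refl) = ≗⇒⇝ all
            where
              all : ∀ r c → after (i ∷ rs) r c ≡ after rs r c
              all r c with r Fin.≟ i
              ... | yes refl = at c ∙ (cong (λ x → after rs r c + x * after rs r c) μj ∙ solve 1 (λ x → x :+ :0 :* x := x) refl _)
              ... | no n = off n c

  pivot⇝ : ∀ {k N} (M : Mat F k N) (j : Fin k) (c₀ : Fin N) → M j c₀ ≢ 0# → ∃ λ M′ → M ⇝ M′ ×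
    (∀ c → M′ j c ≡ inv (M j c₀) * M j c) × (∀ {r} → r ≢ j → ∀ c → M′ r c ≡ M r c + - (M r c₀ * inv (M j c₀)) * M j c)
  pivot⇝ {k} {N} M j c₀ p≢0 = M₂ , ⇝-trans (addRows⇝ M j μ μj) (rowScale⇝ M₁ M₂ j (inv p) (inv≢0 p≢0) at off) , at₂ , off₂
    where
      p = M j c₀
      μ : Fin k → Carrier
      μ r = if does (r Fin.≟ j) then 0# else - (M r c₀ * inv p)
      μj : μ j ≡ 0#
      μj with j Fin.≟ j
      ... | yes _ = refl
      ... | no ne = ⊥-elim (ne refl)
      M₁ M₂ : Mat F k N
      M₁ r c = M r c + μ r * M j c
      M₂ r c = (if does (r Fin.≟ j) then inv p else 1#) * M₁ r c
      at : ∀ c → M₂ j c ≡ inv p * M₁ j c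
      at c with j Fin.≟ j
      ... | yes _ = refl
      ... | no ne = ⊥-elim (ne refl)
      off : ∀ {r} → r ≢ j → ∀ c → M₂ r c ≡ M₁ r c
      off {r} n c with r Fin.≟ j
      ... | yes eq = ⊥-elim (n eq)
      ... | no _ = *-identityˡ _
      at₂ : ∀ c → M₂ j c ≡ inv p * M j c
      at₂ c = at c ∙ cong (inv p *_) (cong (λ x → M j c + x * M j c) μj ∙ solve 1 (λ x → x :+ :0 :* x := x) refl _)
      off₂ : ∀ {r} → r ≢ j → ∀ c → M₂ r c ≡ M r c + - (M r c₀ * inv p) * M j c
      off₂ {r} n c = off n c ∙ cong (λ x → M r c + x * M j c) μr
        where
          μr : μ r ≡ - (M r c₀ * inv p)
          μr with r Fin.≟ j
          ... | yes eq = ⊥-elim (n eq)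
          ... | no _ = refl

  IndepL : ∀ {k} {I : Set} → (I → Vecᶠ F k) → List I → Set
  IndepL {k} {I} v xs = ∀ (d : I → Carrier) → (∀ r → sumL xs (λ x → d x * v x r) ≡ 0#) → ∀ {x} → x ∈ xs → d x ≡ 0#

  private
    choose : {P : Set} → Dec P → Carrier → Carrier
    choose (yes _) x = x
    choose (no _) x = 0#

  -- Gauss-Jordan elimination: after b rounds the first b columns are unit vectors, and independence
  -- of the first k columns provides the next pivot.
  rowReduce : ∀ {k m} (M : Mat F k (k ℕ.+ m)) → IndepL (λ c r → M r c) (map (Fin._↑ˡ m) (allFin k)) →
    ∃ λ M′ → M ⇝ M′ × (∀ i r → M′ r (i Fin.↑ˡ m) ≡ e i r)
  rowReduce {k} {m} M ind with go k ℕₚ.≤-refl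
    where
      ι : Fin k → Fin (k ℕ.+ m)
      ι = Fin._↑ˡ m
      go : ∀ b → b ℕ.≤ k → ∃ λ M′ → M ⇝ M′ × (∀ i → toℕ i ℕ.< b → ∀ r → M′ r (ι i) ≡ e i r)
      go zero _ = M , ≗⇒⇝ (λ _ _ → refl) , λ _ ()
      go (suc b) b<k with go b (ℕₚ.<⇒≤ b<k)
      ... | M₁ , M⇝M₁ , cols = finish (Finₚ.any? (λ r → (b ℕ.≤? toℕ r) ×-dec ¬? (M₁ r (ι j) ≟ 0#)))
        where
          j : Fin k
          j = Fin.fromℕ< b<k
          toℕ-j : toℕ j ≡ b
          toℕ-j = Finₚ.toℕ-fromℕ< b<k
          <b⇒≢ : ∀ {i r : Fin k} → toℕ i ℕ.< b → b ℕ.≤ toℕ r → i ≢ r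
          <b⇒≢ lt le refl = ℕₚ.<⇒≱ lt le
          -- Without a pivot in the rows from b on, column j is a combination of the unit columns
          -- before it. The relation α, with coefficient 1 at column j, is pulled back to M and
          -- contradicts independence.
          nonpivot : (∀ r → b ℕ.≤ toℕ r → M₁ r (ι j) ≡ 0#) → 1# ≡ 0#
          nonpivot z = sym (cong₂ _+_ (e-same j) (a₁-≥ j (ℕₚ.≤-reflexive (sym toℕ-j))) ∙ +-identityʳ 1#)
            ∙ (sym (cong a′ (Finₚ.splitAt-↑ˡ k j m)) ∙ ind α (rel← M⇝M₁ xs α rel) (∈-map⁺ ι (∈-allFin j)))
            where
              xs = map ι (allFin k)
              a₁ : Fin k → Carrier
              a₁ i = choose (toℕ i ℕ.<? b) (- M₁ i (ι j))
              a₁-≥ : ∀ i → b ℕ.≤ toℕ i → a₁ i ≡ 0#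
              a₁-≥ i le with toℕ i ℕ.<? b
              ... | yes lt = ⊥-elim (ℕₚ.<⇒≱ lt le)
              ... | no _ = refl
              a : Fin k → Carrier
              a i = e i j + a₁ i
              a′ : Fin k ⊎ Fin m → Carrier
              a′ = [ a , (λ _ → 0#) ]′
              α : Fin (k ℕ.+ m) → Carrier
              α c = a′ (splitAt k c)
              split : ∀ r i → a i * M₁ r (ι i) ≡ M₁ r (ι j) * e i j + a₁ i * e i r
              split r i with i Fin.≟ j
              ... | yes refl = cong (λ x → (1# + x) * M₁ r (ι i)) (a₁-≥ i (ℕₚ.≤-reflexive (sym toℕ-j)))
                  ∙ (solve 2 (λ x y → (:1 :+ :0) :* x := x :* :1 :+ :0 :* y) refl (M₁ r (ι i)) (e i r)
                  ∙ cong (λ x → M₁ r (ι i) * 1# + x * e i r) (sym (a₁-≥ i (ℕₚ.≤-reflexive (sym toℕ-j)))))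
              ... | no ne with toℕ i ℕ.<? b
              ... | yes lt = cong ((0# + - M₁ i (ι j)) *_) (cols i lt r) ∙ solve 3 (λ x y z → (:0 :+ x) :* y := z :* :0 :+ x :* y) refl (- M₁ i (ι j)) (e i r) (M₁ r (ι j))
              ... | no _ = solve 3 (λ x y z → (:0 :+ :0) :* y := z :* :0 :+ :0 :* x) refl (e i r) (M₁ r (ι i)) (M₁ r (ι j))
              rel : Rel M₁ xs α
              rel r = sum-map ι (allFin k) ∙ (sum-≗ (allFin k) (λ i → cong (λ s → a′ s * M₁ r (ι i)) (Finₚ.splitAt-↑ˡ k i m) ∙ split r i)
                ∙ (sum-+ (allFin k) _ _ ∙ (cong₂ _+_ (sum-*ˡ (allFin k) (M₁ r (ι j)) _ ∙ cong (M₁ r (ι j) *_) (sum-≗ (allFin k) (λ i → sym (*-identityˡ _)) ∙ sum-e (λ _ → 1#) j)) (sum-e a₁ r)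
                ∙ (cong (_+ a₁ r) (*-identityʳ _) ∙ last r))))
                where
                  last : ∀ r → M₁ r (ι j) + a₁ r ≡ 0#
                  last r with toℕ r ℕ.<? b
                  ... | yes lt = -‿inverseʳ _
                  ... | no ≮ = +-identityʳ _ ∙ z r (ℕₚ.≮⇒≥ ≮)
          eliminate : ∀ M₂ → M ⇝ M₂ → (∀ i → toℕ i ℕ.< b → ∀ r → M₂ r (ι i) ≡ e i r) → M₂ j (ι j) ≢ 0# →
            ∃ λ M′ → M ⇝ M′ × (∀ i → toℕ i ℕ.< suc b → ∀ r → M′ r (ι i) ≡ e i r)
          eliminate M₂ w cols₂ p≢0 with pivot⇝ M₂ j (ι j) p≢0
          ... | M₃ , w₃ , at , off = M₃ , ⇝-trans w w₃ , cols₃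
            where
              cols₃ : ∀ i → toℕ i ℕ.< suc b → ∀ r → M₃ r (ι i) ≡ e i r
              cols₃ i lt r with toℕ i ℕ.<? b | r Fin.≟ j
              ... | yes lt′ | yes refl = at (ι i) ∙ (cong (inv (M₂ r (ι r)) *_) zero′ ∙ (zeroʳ _ ∙ sym (e-diff ne)))
                where
                  ne : i ≢ r
                  ne = <b⇒≢ lt′ (ℕₚ.≤-reflexive (sym toℕ-j))
                  zero′ = cols₂ i lt′ r ∙ e-diff ne
              ... | yes lt′ | no n = off n (ι i) ∙ (cong (λ x → M₂ r (ι i) + - (M₂ r (ι j) * inv (M₂ j (ι j))) * x) (cols₂ i lt′ j ∙ e-diff (<b⇒≢ lt′ (ℕₚ.≤-reflexive (sym toℕ-j))))
                ∙ (solve 2 (λ x y → x :+ y :* :0 := x) refl _ _ ∙ cols₂ i lt′ r))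
              ... | no ≮ | s rewrite Finₚ.toℕ-injective {i = i} {j = j} (ℕₚ.≤-antisym (ℕₚ.≤-trans (ℕ.s≤s⁻¹ lt) (ℕₚ.≤-reflexive (sym toℕ-j))) (ℕₚ.≤-trans (ℕₚ.≤-reflexive toℕ-j) (ℕₚ.≮⇒≥ ≮))) = here′ s
                where
                  here′ : Dec (r ≡ j) → M₃ r (ι j) ≡ e j r
                  here′ (yes refl) = at (ι r) ∙ (inv-l p≢0 ∙ sym (e-same r))
                  here′ (no n) = off n (ι j) ∙ (solve 3 (λ x i p → x :+ :- (x :* i) :* p := x :+ :- (x :* (i :* p))) refl (M₂ r (ι j)) (inv (M₂ j (ι j))) (M₂ j (ι j))
                    ∙ (cong (λ y → M₂ r (ι j) + - (M₂ r (ι j) * y)) (inv-l p≢0) ∙ (solve 1 (λ x → x :+ :- (x :* :1) := :0) refl _ ∙ sym (e-diff (λ eq → n (sym eq))))))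
          finish : Dec (∃ λ r → b ℕ.≤ toℕ r × ¬ (M₁ r (ι j) ≡ 0#)) → ∃ λ M′ → M ⇝ M′ × (∀ i → toℕ i ℕ.< suc b → ∀ r → M′ r (ι i) ≡ e i r)
          finish (no none) = ⊥-elim (1≢0 (nonpivot (λ r le → decidable-stable (M₁ r (ι j) ≟ 0#) (λ ne → none (r , le , ne)))))
          finish (yes (r , le , ne)) with M₁ j (ι j) ≟ 0#
          ... | no p≢0 = eliminate M₁ M⇝M₁ cols p≢0
          -- Adding row r to row j creates the pivot in place of a swap; the earlier unit columns
          -- survive because they vanish in row r.
          ... | yes p≡0 = eliminate M₂ (⇝-trans M⇝M₁ (rowAdd⇝ M₁ M₂ j r j≢r 1# at off)) cols₂ (λ z → ne (sym (at (ι j) ∙ (cong (_+ 1# * M₁ r (ι j)) p≡0 ∙ solve 1 (λ x → :0 :+ :1 :* x := x) refl _)) ∙ z))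
            where
              j≢r : j ≢ r
              j≢r refl = ne p≡0
              M₂ : Mat F k (k ℕ.+ m)
              M₂ s c = M₁ s c + e j s * M₁ r c
              at : ∀ c → M₂ j c ≡ M₁ j c + 1# * M₁ r c
              at c = cong (λ x → M₁ j c + x * M₁ r c) (e-same j)
              off : ∀ {s} → s ≢ j → ∀ c → M₂ s c ≡ M₁ s c
              off {s} n c = cong (λ x → M₁ s c + x * M₁ r c) (e-diff (λ eq → n (sym eq))) ∙ solve 2 (λ x y → x :+ :0 :* y := x) refl _ _
              cols₂ : ∀ i → toℕ i ℕ.< b → ∀ s → M₂ s (ι i) ≡ e i s
              cols₂ i lt s = cong₂ (λ x y → x + e j s * y) (cols i lt s) (cols i lt r ∙ e-diff (<b⇒≢ lt le)) ∙ solve 2 (λ x y → x :+ y :* :0 := x) refl _ _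
  ... | M′ , w , cols = M′ , w , λ i r → cols i (Finₚ.toℕ<n i) r

  assign : {I : Set} → ((x y : I) → Dec (x ≡ y)) → (xs : List I) → (Fin (length xs) → Carrier) → I → Carrier
  assign _≟ᴵ_ [] c y = 0#
  assign _≟ᴵ_ (x ∷ xs) c y = if does (y ≟ᴵ x) then c zero else assign _≟ᴵ_ xs (λ i → c (suc i)) y

  sum-assign : {I : Set} (_≟ᴵ_ : (x y : I) → Dec (x ≡ y)) (xs : List I) (c : Fin (length xs) → Carrier) (g : I → Carrier) → Unique xs →
    sumL xs (λ x → assign _≟ᴵ_ xs c x * g x) ≡ ∑ F (length xs) (λ i → c i * g (lookup xs i))
  sum-assign _≟ᴵ_ [] c g u = refl
  sum-assign {I} _≟ᴵ_ (x ∷ xs) c g u@(_ ∷ u′) = cong₂ _+_ first (sum-cong xs rest ∙ sum-assign _≟ᴵ_ xs (λ i → c (suc i)) g u′)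
    where
      first : assign _≟ᴵ_ (x ∷ xs) c x * g x ≡ c zero * g x
      first with x ≟ᴵ x
      ... | yes _ = refl
      ... | no ne = ⊥-elim (ne refl)
      rest : ∀ {y} → y ∈ xs → assign _≟ᴵ_ (x ∷ xs) c y * g y ≡ assign _≟ᴵ_ xs (λ i → c (suc i)) y * g y
      rest {y} m with y ≟ᴵ x
      ... | yes refl = ⊥-elim (∉-Unique u m)
      ... | no _ = refl

  -- Reduce the family augmented by w as last column. The reduced last column consists of the
  -- coordinates of w, and the relation that says so holds before the reduction too.
  indep⇒spans : ∀ {k} {I : Set} → ((x y : I) → Dec (x ≡ y)) → (v : I → Vecᶠ F k) (xs : List I) → Unique xs → length xs ≡ k → IndepL v xs → SpansL v xs
  indep⇒spans {I = I} _≟ᴵ_ v xs u refl ind w with rowReduce {k} {1} M indM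
    where
      k = length xs
      column : Fin k ⊎ Fin 1 → Vecᶠ F k
      column = [ (λ i → v (lookup xs i)) , (λ _ → w) ]′
      M : Mat F k (k ℕ.+ 1)
      M r c = column (splitAt k c) r
      indM : IndepL (λ c r → M r c) (map (Fin._↑ˡ 1) (allFin k))
      indM d h m with ∈-map⁻ (Fin._↑ˡ 1) m
      ... | i , _ , refl = sym (assign-lookup xs (λ i → d (i Fin.↑ˡ 1)) u i) ∙ ind d′ (λ r → sum-assign _≟ᴵ_ xs (λ i → d (i Fin.↑ˡ 1)) (λ x → v x r) u ∙ (∑≡sum k _ ∙ (sum-≗ (allFin k) (λ i → cong (λ s → d (i Fin.↑ˡ 1) * column s r) (sym (Finₚ.splitAt-↑ˡ k i 1))) ∙ (sym (sum-map (Fin._↑ˡ 1) (allFin k)) ∙ h r)))) (∈-lookup i)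
        where
          d′ = assign _≟ᴵ_ xs (λ i → d (i Fin.↑ˡ 1))
          assign-lookup : ∀ xs c → Unique xs → ∀ i → assign _≟ᴵ_ xs c (lookup xs i) ≡ c i
          assign-lookup (x ∷ xs) c u zero with x ≟ᴵ x
          ... | yes _ = refl
          ... | no ne = ⊥-elim (ne refl)
          assign-lookup (x ∷ xs) c u@(_ ∷ u′) (suc i) with lookup xs i ≟ᴵ x
          ... | yes eq = ⊥-elim (∉-Unique u (subst (_∈ xs) eq (∈-lookup i)))
          ... | no _ = assign-lookup xs (λ i → c (suc i)) u′ i
  ... | M′ , M⇝M′ , cols = assign _≟ᴵ_ xs a , λ r → sym (sum-assign _≟ᴵ_ xs a (λ x → v x r) u ∙ (∑≡sum k _ ∙ x-y≡0⇒x≡y (combination r)))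
    where
      k = length xs
      last : Fin (k ℕ.+ 1)
      last = k Fin.↑ʳ zero
      a : Fin k → Carrier
      a i = M′ i last
      α : Fin (k ℕ.+ 1) → Carrier
      α c = [ a , (λ _ → - 1#) ]′ (splitAt k c)
      relM′ : Rel M′ (last ∷ map (Fin._↑ˡ 1) (allFin k)) α
      relM′ r = cong₂ (λ s t → [ a , (λ _ → - 1#) ]′ s * M′ r last + t) (Finₚ.splitAt-↑ʳ k 1 zero)
          (sum-map (Fin._↑ˡ 1) (allFin k) ∙ (sum-≗ (allFin k) (λ i → cong₂ (λ s t → [ a , (λ _ → - 1#) ]′ s * t) (Finₚ.splitAt-↑ˡ k i 1) (cols i r)) ∙ sum-e a r))
        ∙ solve 1 (λ x → :- :1 :* x :+ x := :0) refl _
      combination : ∀ r → sumL (allFin k) (λ i → a i * v (lookup xs i) r) + - w r ≡ 0#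
      combination r = sym (cong₂ (λ s t → [ a , (λ _ → - 1#) ]′ s * column′ s r + t) (Finₚ.splitAt-↑ʳ k 1 zero)
          (sum-map (Fin._↑ˡ 1) (allFin k) ∙ sum-≗ (allFin k) (λ i → cong (λ s → [ a , (λ _ → - 1#) ]′ s * column′ s r) (Finₚ.splitAt-↑ˡ k i 1)))
        ∙ solve 2 (λ w s → :- :1 :* w :+ s := s :+ :- w) refl (w r) _) ∙ rel← M⇝M′ (last ∷ map (Fin._↑ˡ 1) (allFin k)) α relM′ r
        where
          column′ : Fin k ⊎ Fin 1 → Vecᶠ F k
          column′ = [ (λ i → v (lookup xs i)) , (λ _ → w) ]′

  -- Arcs [ I | M ] and Cauchy matrices

  Idx : ℕ → ℕ → Set
  Idx k m = Fin k ⊎ Fin m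

  _≟ᴵ_ : ∀ {k m} (x y : Idx k m) → Dec (x ≡ y)
  _≟ᴵ_ = Sumₚ.≡-dec Fin._≟_ Fin._≟_

  -- the columns of the matrix [ I | M ]
  col : ∀ {k m} → Mat F k m → Idx k m → Vecᶠ F k
  col M (inj₁ i) = e i
  col M (inj₂ j) = λ r → M r j

  -- The columns of [ I | M ] form an arc; equivalently, [ I | M ] generates a maximum distance
  -- separable code, and all square minors of M are nonzero.
  MDS : ∀ {k m} → Mat F k m → Set
  MDS {k} M = ∀ xs → Unique xs → length xs ≡ k → IndepL (col M) xs

  MDS-spans : ∀ {k m} {M : Mat F k m} → MDS M → ∀ xs → Unique xs → length xs ≡ k → SpansL (col M) xs
  MDS-spans mds xs u l = indep⇒spans _≟ᴵ_ _ xs u l (mds xs u l)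

  dot : ∀ {k} → Vecᶠ F k → Vecᶠ F k → Carrier
  dot {k} x w = sumL (allFin k) (λ r → x r * w r)

  dot-eʳ : ∀ {k} (x : Vecᶠ F k) i → dot x (e i) ≡ x i
  dot-eʳ {k} x i = sum-≗ (allFin k) (λ r → cong (x r *_) (e-sym i r)) ∙ sum-e x i

  dot-eˡ : ∀ {k} i (w : Vecᶠ F k) → dot (e i) w ≡ w i
  dot-eˡ {k} i w = sum-≗ (allFin k) (λ r → *-comm _ _) ∙ dot-eʳ w i

  dot-lin : ∀ {k} a b (x y w : Vecᶠ F k) → dot (λ r → a * x r + b * y r) w ≡ a * dot x w + b * dot y w
  dot-lin {k} a b x y w = sum-≗ (allFin k) (λ r → solve 5 (λ a b x y w → (a :* x :+ b :* y) :* w := a :* (x :* w) :+ b :* (y :* w)) refl a b (x r) (y r) (w r))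
    ∙ (sum-+ (allFin k) _ _ ∙ cong₂ _+_ (sum-*ˡ (allFin k) a _) (sum-*ˡ (allFin k) b _))

  ⊥-spanning : ∀ {k} {I : Set} {v : I → Vecᶠ F k} {xs : List I} → SpansL v xs → (x : Vecᶠ F k) → (∀ {y} → y ∈ xs → dot x (v y) ≡ 0#) → ∀ i → x i ≡ 0#
  ⊥-spanning {k} {v = v} {xs} sp x perp i with sp (e i)
  ... | d , eq = begin
    x i ≡⟨ sym (dot-eʳ x i) ⟩
    sumL (allFin k) (λ r → x r * e i r) ≡⟨ sum-≗ (allFin k) (λ r → cong (x r *_) (eq r) ∙ sym (sum-*ˡ xs (x r) _)) ⟩
    sumL (allFin k) (λ r → sumL xs (λ y → x r * (d y * v y r))) ≡⟨ sum-swap (allFin k) xs _ ⟩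
    sumL xs (λ y → sumL (allFin k) (λ r → x r * (d y * v y r))) ≡⟨ sum-cong xs (λ {y} m → sum-≗ (allFin k) (λ r → solve 3 (λ a b c → a :* (b :* c) := b :* (a :* c)) refl (x r) (d y) (v y r)) ∙ (sum-*ˡ (allFin k) (d y) _ ∙ (cong (d y *_) (perp m) ∙ zeroʳ _))) ⟩
    sumL xs (λ _ → 0#) ≡⟨ sum-0 xs (λ _ → refl) ⟩
    0# ∎
    where open ≡-Reasoning

  Unique-inj : ∀ {k m} {is : List (Fin k)} {js : List (Fin m)} → Unique is → Unique js → Unique (map inj₂ js ++ map inj₁ is)
  Unique-inj {k} {m} {is} {js} ui uj = Uniqueₚ.++⁺ (Uniqueₚ.map⁺ Sumₚ.inj₂-injective uj) (Uniqueₚ.map⁺ Sumₚ.inj₁-injective ui) disjoint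
    where
      disjoint : ∀ {x : Idx k m} → x ∈ map inj₂ js × x ∈ map inj₁ is → ⊥
      disjoint (a , b) with ∈-map⁻ inj₂ a | ∈-map⁻ inj₁ b
      ... | _ , _ , refl | _ , _ , ()

  ∈-inj : ∀ {k m} {is : List (Fin k)} {js : List (Fin m)} {x : Idx k m} → x ∈ map inj₂ js ++ map inj₁ is →
    (∃ λ j → j ∈ js × x ≡ inj₂ j) ⊎ (∃ λ i → i ∈ is × x ≡ inj₁ i)
  ∈-inj {js = js} m with ∈-++⁻ (map inj₂ js) m
  ... | inj₁ m′ = inj₁ (∈-map⁻ inj₂ m′)
  ... | inj₂ m′ = inj₂ (∈-map⁻ inj₁ m′)

  module _ {k m} {M : Mat F k m} (mds : MDS M) where

    private
      -- x is orthogonal to the columns js and to the unit vectors outside is, and these form a basis if |is| = |js|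
      minor-argument : ∀ (is : List (Fin k)) (js : List (Fin m)) → Unique is → Unique js → length is ≡ length js →
        (x : Vecᶠ F k) → (∀ {l} → l ∉ is → x l ≡ 0#) → (∀ {j} → j ∈ js → dot x (λ r → M r j) ≡ 0#) → ∀ i → x i ≡ 0#
      minor-argument is js ui uj len x off perp with complete (allFin k) ∈-allFin is ui
      ... | rest , p = ⊥-spanning (MDS-spans mds (map inj₂ js ++ map inj₁ rest) (Unique-inj ur uj) len′) x perp′
        where
          up : Unique (rest ++ is)
          up = Unique-↭ (↭-trans p (Permₚ.++-comm is rest)) (allFin⁺ k)
          ur : Unique rest
          ur = AllPairs-++ˡ rest up
          rest∉ : ∀ {l} rest → Unique (rest ++ is) → l ∈ rest → l ∉ is
          rest∉ (_ ∷ rest) (r ∷ _) (here refl) m = All.lookup r (∈-++⁺ʳ rest m) refl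
          rest∉ (_ ∷ rest) (_ ∷ u) (there m) = rest∉ rest u m
          len′ : length (map {B = Idx k m} inj₂ js ++ map inj₁ rest) ≡ k
          len′ = length-++ (map inj₂ js) ∙ (cong₂ ℕ._+_ (length-map inj₂ js ∙ sym len) (length-map inj₁ rest)
            ∙ (sym (length-++ is) ∙ (sym (↭-length p) ∙ length-allFin k)))
          perp′ : ∀ {y} → y ∈ map inj₂ js ++ map inj₁ rest → dot x (col M y) ≡ 0#
          perp′ m with ∈-inj {is = rest} {js = js} m
          ... | inj₁ (j , mj , refl) = perp mj
          ... | inj₂ (l , ml , refl) = dot-eʳ x l ∙ off (rest∉ rest up ml)

    entry≢0 : ∀ i j → M i j ≢ 0#
    entry≢0 i j z = 1≢0 (sym (e-same i) ∙ minor-argument (i ∷ []) (j ∷ []) ([] ∷ []) ([] ∷ []) refl (e i) (λ l∉ → e-diff (λ eq → l∉ (here (sym eq)))) (λ { (here refl) → dot-eˡ i _ ∙ z }) i)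

    minor≢0 : ∀ {i i′ j j′} → i ≢ i′ → j ≢ j′ → M i j * M i′ j′ ≢ M i j′ * M i′ j
    minor≢0 {i} {i′} {j} {j′} i≢ j≢ eq = entry≢0 i′ j (sym x-i ∙ minor-argument (i ∷ i′ ∷ []) (j ∷ j′ ∷ []) ((i≢ ∷ []) ∷ ([] ∷ [])) ((j≢ ∷ []) ∷ ([] ∷ [])) refl x off perp i)
      where
        -- This combination of `e i` and `e i′` is orthogonal to column j by construction, and to
        -- column j′ precisely because the minor is assumed to vanish.
        x : Vecᶠ F k
        x r = M i′ j * e i r + - M i j * e i′ r
        x-i : x i ≡ M i′ j
        x-i = cong₂ (λ a b → M i′ j * a + - M i j * b) (e-same i) (e-diff (λ eq → i≢ (sym eq))) ∙ solve 2 (λ a b → a :* :1 :+ b :* :0 := a) refl _ _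
        off : ∀ {l} → l ∉ i ∷ i′ ∷ [] → x l ≡ 0#
        off l∉ = cong₂ (λ a b → M i′ j * a + - M i j * b) (e-diff (λ eq → l∉ (here (sym eq)))) (e-diff (λ eq → l∉ (there (here (sym eq))))) ∙ solve 2 (λ a b → a :* :0 :+ b :* :0 := :0) refl _ _
        dotx : ∀ w → dot x w ≡ M i′ j * w i + - M i j * w i′
        dotx w = dot-lin (M i′ j) (- M i j) (e i) (e i′) w ∙ cong₂ (λ a b → M i′ j * a + - M i j * b) (dot-eˡ i w) (dot-eˡ i′ w)
        perp : ∀ {c} → c ∈ j ∷ j′ ∷ [] → dot x (λ r → M r c) ≡ 0#
        perp (here refl) = dotx _ ∙ solve 2 (λ a b → a :* b :+ :- b :* a := :0) refl _ _
        perp (there (here refl)) = dotx _ ∙ (solve 4 (λ a b c d → a :* b :+ :- c :* d := b :* a :+ :- (c :* d)) refl (M i′ j) (M i j′) (M i j) (M i′ j′)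
          ∙ (cong (λ z → z + - (M i j * M i′ j′)) (sym eq) ∙ -‿inverseʳ _))

  -- A homogeneous form of the Cauchy matrix 1/(x_i - y_j): the scalings of rows and columns are
  -- absorbed in the choice of representatives P and Q of points of the projective line.
  record Cauchy {k m} (M : Mat F k m) : Set where
    field
      P : Fin k → Point
      Q : Fin m → Point
      M·br : ∀ i j → M i j * br (P i) (Q j) ≡ 1#
      P-apart : ∀ {i j} → i ≢ j → br (P i) (P j) ≢ 0#
      Q-apart : ∀ {i j} → i ≢ j → br (Q i) (Q j) ≢ 0#

  toVec : {A : Set} (xs : List A) {n : ℕ} → length xs ≡ n → ∃ λ (w : Vec A n) → Vec.toList w ≡ xs
  toVec xs refl = Vec.fromList xs , Vecₚ.toList∘fromList xs

  module _ (t m : ℕ) (k+m : suc (suc t) ℕ.+ m ≡ suc q) (nz : ∀ n → 0 ℕ.< n → n ℕ.< suc (suc t) → nat n ≢ 0#)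
    {M : Mat F (suc (suc t)) m} (mds : MDS M) where

    private
      k : ℕ
      k = suc (suc t)

    open GeneralPosition t (col M) (MDS-spans mds)

    -- Take K to be the unit vectors and C = K without i. The determinant of u and C is u_i δ, where
    -- δ = ±Δ and Δ is the determinant of K, so D_C = δ^(q+1) N i = Δ² N i, and the constant Δ²
    -- cancels from `hyperplane-identity`.
    coordinate-identity : ∀ y₀ y₁ R U → y₀ ∷ y₁ ∷ R ++ U ↭ allFin m → length U ≡ t →
      sumL (allFin k) (λ i → inv (prodL (y₀ ∷ y₁ ∷ R) (M i) * (prodL U (M i) * prodL U (M i)))) ≡ 0#
    coordinate-identity y₀ y₁ R U perm lenU with toVec (map {B = Idx k m} inj₁ (allFin k)) (length-map inj₁ (allFin k) ∙ length-allFin k) | toVec (map {B = Idx k m} inj₂ U) (length-map inj₂ U ∙ lenU)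
    ... | K , K≡ | V , V≡ = *≡0 (inv≢0 (*≢0 Δ≢0 Δ≢0)) (begin
      inv (Δ * Δ) * sumL (allFin k) (λ i → inv (N i))
        ≡⟨ sym (sum-*ˡ (allFin k) _ _) ⟩
      sumL (allFin k) (λ i → inv (Δ * Δ) * inv (N i))
        ≡⟨ cong (λ l → sumL l (λ i → inv (Δ * Δ) * inv (N i))) (sym (map-proj₁-sel (allFin k))) ∙ sum-map proj₁ (sel (allFin k)) ⟩
      sumL (sel (allFin k)) (λ p → inv (Δ * Δ) * inv (N (proj₁ p)))
        ≡⟨ sum-cong (sel (allFin k)) (λ {p} m → sym (inv-* _ _) ∙ cong inv (sym (term m))) ⟩
      sumL (sel (allFin k)) (λ p → inv (weight Y (wedge (map (col M) (map inj₁ (proj₂ p)))) (inj₁ (proj₁ p) ∷ map inj₂ U)))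
        ≡⟨ sym (sum-map _ (sel (allFin k))) ∙ cong (λ l → sumL l (λ p → inv (weight Y (wedge (map (col M) (proj₂ p))) (proj₁ p ∷ map inj₂ U)))) (sym (sel-map inj₁ (allFin k))) ⟩
      sumL (sel (map inj₁ (allFin k))) (λ p → inv (weight Y (wedge (map (col M) (proj₂ p))) (proj₁ p ∷ map inj₂ U)))
        ≡⟨ cong₂ (λ a b → sumL (sel a) (λ p → inv (weight Y (wedge (map (col M) (proj₂ p))) (proj₁ p ∷ b)))) (sym K≡) (sym V≡) ⟩
      sumL (sel (Vec.toList K)) (λ p → inv (weight Y (wedge (map (col M) (proj₂ p))) (proj₁ p ∷ Vec.toList V)))
        ≡⟨ hyperplane-identity nz K V (inj₂ y₀) (inj₂ y₁) (map inj₂ R) uniq len ⟩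
      0# ∎)
      where
        open ≡-Reasoning
        Y₀ = y₀ ∷ y₁ ∷ R
        Y : List (Idx k m)
        Y = map inj₂ Y₀
        N : Fin k → Carrier
        N i = prodL Y₀ (M i) * (prodL U (M i) * prodL U (M i))
        Δ = top (wedge (map (col M) (map inj₁ (allFin k))))
        Δ≢0 : Δ ≢ 0#
        Δ≢0 = det≢0 (map inj₁ (allFin k)) (Uniqueₚ.map⁺ Sumₚ.inj₁-injective (allFin⁺ k)) (length-map inj₁ (allFin k) ∙ length-allFin k)
        uniq : Unique (Y ++ Vec.toList (K Vec.++ V))
        uniq = subst (λ l → Unique (Y ++ l)) (sym (Vecₚ.toList-++ K V ∙ cong₂ _++_ K≡ V≡))
          (Unique-↭ (↭-trans (Permₚ.++⁺ʳ (map inj₁ (allFin k)) (↭-reflexive (Listₚ.map-++ inj₂ Y₀ U)))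
                       (↭-trans (↭-reflexive (Listₚ.++-assoc Y (map inj₂ U) (map inj₁ (allFin k)))) (Permₚ.++⁺ˡ Y (Permₚ.++-comm (map inj₂ U) (map inj₁ (allFin k))))))
            (Unique-inj (allFin⁺ k) (Unique-↭ (↭-sym perm) (allFin⁺ m))))
        |Y|+t : length Y₀ ℕ.+ t ≡ m
        |Y|+t = cong (length Y₀ ℕ.+_) (sym lenU) ∙ (sym (length-++ Y₀) ∙ (↭-length perm ∙ length-allFin m))
        len₀ : length Y₀ ℕ.+ (suc t ℕ.+ suc t) ≡ suc q
        len₀ = cong (length Y₀ ℕ.+_) (ℕₚ.+-suc (suc t) t ∙ ℕₚ.+-comm k t) ∙ (sym (ℕₚ.+-assoc (length Y₀) t k) ∙ (cong (ℕ._+ k) |Y|+t ∙ (ℕₚ.+-comm m k ∙ k+m)))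
        len : length Y ℕ.+ (suc t ℕ.+ suc t) ≡ suc q
        len = cong (ℕ._+ (suc t ℕ.+ suc t)) (length-map inj₂ Y₀) ∙ len₀
        term : ∀ {p} → p ∈ sel (allFin k) → weight Y (wedge (map (col M) (map inj₁ (proj₂ p)))) (inj₁ (proj₁ p) ∷ map inj₂ U) ≡ (Δ * Δ) * N (proj₁ p)
        term {i , r} mem = begin
          weight Y ω (inj₁ i ∷ map inj₂ U)
            ≡⟨ cong₂ (λ a b → a * (b * b)) (expand Y₀) (cong (δ *_) (expand U)) ⟩
          (prodL Y₀ (M i) * pw δ (length Y₀)) * ((δ * (PU * pw δ (length U))) * (δ * (PU * pw δ (length U))))
            ≡⟨ solve 5 (λ a b d u c → (a :* b) :* ((d :* (u :* c)) :* (d :* (u :* c))) := (b :* ((d :* c) :* (d :* c))) :* (a :* (u :* u))) refl (prodL Y₀ (M i)) (pw δ (length Y₀)) δ PU (pw δ (length U)) ⟩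
          (pw δ (length Y₀) * ((δ * pw δ (length U)) * (δ * pw δ (length U)))) * N i
            ≡⟨ cong (λ n → (pw δ (length Y₀) * (pw δ (suc n) * pw δ (suc n))) * N i) lenU ⟩
          (pw δ (length Y₀) * (pw δ (suc t) * pw δ (suc t))) * N i
            ≡⟨ cong (_* N i) (cong (pw δ (length Y₀) *_) (sym (pw-+ δ (suc t) (suc t))) ∙ (sym (pw-+ δ (length Y₀) (suc t ℕ.+ suc t)) ∙ cong (pw δ) len₀)) ⟩
          (δ * pw δ q) * N i
            ≡⟨ cong (λ x → (δ * x) * N i) (fermat δ) ⟩
          (δ * δ) * N i
            ≡⟨ cong (_* N i) (≈±-square (wedge-↭ (Permₚ.map⁺ (col M) (Permₚ.map⁺ inj₁ (↭-sym (sel-↭ (allFin k) mem))))) (full k)) ⟩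
          (Δ * Δ) * N i ∎
          where
            ω = wedge (map (col M) (map inj₁ r))
            δ = top (ext (e i) ω)
            PU = prodL U (M i)
            coordinate : ∀ y → top (ext (col M y) ω) ≡ col M y i * δ
            coordinate y = ext-sum (allFin k) (col M y) e ω (λ s → sym (sum-e (col M y) s)) (full k)
              ∙ sum-single (allFin k) (allFin⁺ k) (∈-allFin i) _ (λ {j} _ ne → cong (col M y j *_) (ext-member (∈-map⁺ (col M) (∈-map⁺ inj₁ (inRest ne))) (full k)) ∙ zeroʳ _)
              where
                inRest : ∀ {j} → j ≢ i → j ∈ r
                inRest {j} ne with ∈-resp-↭ (sel-↭ (allFin k) mem) (∈-allFin j)
                ... | here eq = ⊥-elim (ne eq)
                ... | there m′ = m′
            expand : ∀ ys → prodL (map inj₂ ys) (λ y → top (ext (col M y) ω)) ≡ prodL ys (M i) * pw δ (length ys)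
            expand ys = prod-map inj₂ ys ∙ (prod-cong ys (λ {y} _ → coordinate (inj₂ y)) ∙ (prod-* ys (M i) (λ _ → δ) ∙ cong (prodL ys (M i) *_) (prod-const ys δ)))

    module _ (W : List (Fin m)) (lenW : length W ≡ t) where

      -- The part of the terms of `coordinate-identity` common to all exchanges of a w in W for a z:
      -- the product over Y and twice U is that over all columns and once U, and the latter is the
      -- product over W times M i z / M i w.
      β : Fin k → Carrier
      β i = inv (prodL (allFin m) (M i) * prodL W (M i))

      β≢0 : ∀ i → β i ≢ 0#
      β≢0 i = inv≢0 (*≢0 (prod≢0 (allFin m) (λ {j} _ → entry≢0 mds i j)) (prod≢0 W (λ {j} _ → entry≢0 mds i j)))

      -- This is `coordinate-identity` for the set U obtained from W by exchanging w for z. The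
      -- columns `z₂` and `z₃` stay outside U whatever w is, and provide the two vectors required
      -- there.
      orthogonality : ∀ z z₂ z₃ X → z ∷ z₂ ∷ z₃ ∷ W ++ X ↭ allFin m → ∀ {w} → w ∈ W → dot (λ i → β i * inv (M i z)) (λ i → M i w) ≡ 0#
      orthogonality z z₂ z₃ X perm {w} w∈W with ∈-map⁻ proj₁ (subst (w ∈_) (sym (map-proj₁-sel W)) w∈W)
      ... | (_ , W′) , mem , refl = sum-≗ (allFin k) term ∙ coordinate-identity z₂ z₃ (w ∷ X) (z ∷ W′) perm′ lenU
        where
          open ≡-Reasoning
          W↭ = sel-↭ W mem
          lenU : length (z ∷ W′) ≡ t
          lenU = sym (↭-length W↭) ∙ lenW
          perm′ : z₂ ∷ z₃ ∷ w ∷ X ++ (z ∷ W′) ↭ allFin m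
          perm′ = ↭-trans (prep z₂ (prep z₃ (prep w (↭-trans (shift z X W′) (prep z (Permₚ.++-comm X W′))))))
            (↭-trans (shift z (z₂ ∷ z₃ ∷ w ∷ []) (W′ ++ X)) (↭-trans (prep z (prep z₂ (prep z₃ (Permₚ.++⁺ʳ X (↭-sym W↭))))) perm))
          term : ∀ i → β i * inv (M i z) * M i w ≡ inv (prodL (z₂ ∷ z₃ ∷ w ∷ X) (M i) * (prodL (z ∷ W′) (M i) * prodL (z ∷ W′) (M i)))
          term i = begin
            inv (Π * prodL W (M i)) * inv (M i z) * M i w
              ≡⟨ cong (λ x → inv (Π * x) * inv (M i z) * M i w) (prod-↭ (M i) W↭) ⟩
            inv (Π * (M i w * B)) * inv (M i z) * M i w
              ≡⟨ cong (λ x → x * inv (M i z) * M i w) (inv-* Π _ ∙ cong (inv Π *_) (inv-* (M i w) B)) ⟩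
            inv Π * (inv (M i w) * inv B) * inv (M i z) * M i w
              ≡⟨ solve 5 (λ p u b y x → p :* (u :* b) :* y :* x := (x :* u) :* (p :* (y :* b))) refl (inv Π) (inv (M i w)) (inv B) (inv (M i z)) (M i w) ⟩
            (M i w * inv (M i w)) * (inv Π * (inv (M i z) * inv B))
              ≡⟨ cong (_* (inv Π * (inv (M i z) * inv B))) (inv-r (entry≢0 mds i w)) ∙ *-identityˡ _ ⟩
            inv Π * (inv (M i z) * inv B)
              ≡⟨ cong (inv Π *_) (sym (inv-* (M i z) B)) ∙ sym (inv-* Π _) ⟩
            inv (Π * U)
              ≡⟨ cong (λ x → inv (x * U)) (sym (prod-↭ (M i) perm′) ∙ prod-++ (z₂ ∷ z₃ ∷ w ∷ X) (z ∷ W′)) ⟩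
            inv ((prodL (z₂ ∷ z₃ ∷ w ∷ X) (M i) * U) * U)
              ≡⟨ cong inv (*-assoc _ _ _) ⟩
            inv (prodL (z₂ ∷ z₃ ∷ w ∷ X) (M i) * (U * U)) ∎
            where
              Π = prodL (allFin m) (M i)
              B = prodL W′ (M i)
              U = prodL (z ∷ W′) (M i)

    -- The inverted columns lie in a plane: three of them are orthogonal (after scaling the coordinates) to t = k − 2 further columns W,
    -- and a vector orthogonal to W is determined by its first two coordinates because e₀, e₁ and W form a basis.
    coplanar : ∀ {a b c} → Unique (a ∷ b ∷ c ∷ []) → t ℕ.+ 3 ℕ.≤ m → ∃ λ σ → ∃ λ τ → ∀ i → inv (M i c) ≡ σ * inv (M i a) + τ * inv (M i b)
    coplanar {a} {b} {c} u t+3≤m with complete (allFin m) ∈-allFin (a ∷ b ∷ c ∷ []) u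
    ... | others , p = σ , τ , λ i → x-y≡0⇒x≡y (*≡0 (β≢0 W lenW i) (⊥-spanning (MDS-spans mds basis ub lenb) x perp i))
      where
        open ≡-Reasoning
        W = take t others
        X = drop t others
        W++X : W ++ X ≡ others
        W++X = Listₚ.take++drop≡id t others
        lenO : 3 ℕ.+ length others ≡ m
        lenO = sym (↭-length p) ∙ length-allFin m
        lenW : length W ≡ t
        lenW = Listₚ.length-take t others ∙ ℕₚ.m≤n⇒m⊓n≡m (ℕₚ.+-cancelˡ-≤ 3 t (length others) (ℕₚ.≤-trans (ℕₚ.≤-reflexive (ℕₚ.+-comm 3 t)) (ℕₚ.≤-trans t+3≤m (ℕₚ.≤-reflexive (sym lenO)))))
        perm : a ∷ b ∷ c ∷ W ++ X ↭ allFin m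
        perm = ↭-trans (↭-reflexive (cong (λ l → a ∷ b ∷ c ∷ l) W++X)) (↭-sym p)
        i₀ i₁ : Fin k
        i₀ = zero
        i₁ = suc zero
        basis : List (Idx k m)
        basis = map inj₂ W ++ map inj₁ (i₀ ∷ i₁ ∷ [])
        uW : Unique W
        uW = Uniqueₚ.take⁺ t (AllPairs.tail (AllPairs.tail (AllPairs.tail (Unique-↭ p (allFin⁺ m)))))
        ub : Unique basis
        ub = Unique-inj (((λ ()) ∷ []) ∷ ([] ∷ [])) uW
        lenb : length basis ≡ k
        lenb = length-++ (map inj₂ W) ∙ (cong (ℕ._+ 2) (length-map inj₂ W ∙ lenW) ∙ ℕₚ.+-comm t 2)
        A B C : Fin k → Carrier
        A i = inv (M i a)
        B i = inv (M i b)
        C i = inv (M i c)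
        D = A i₀ * B i₁ + - (B i₀ * A i₁)
        D≢0 : D ≢ 0#
        D≢0 z = minor≢0 mds {i₀} {i₁} {a} {b} (λ ()) (All.head (AllPairs.head u)) (sym (inv-inv _) ∙ (cong inv (inv-* _ _ ∙ (x-y≡0⇒x≡y z ∙ sym (inv-* _ _))) ∙ inv-inv _))
        -- Cramer's rule for the coordinates `i₀` and `i₁`, so that x vanishes there.
        σ = (C i₀ * B i₁ + - (C i₁ * B i₀)) * inv D
        τ = (A i₀ * C i₁ + - (A i₁ * C i₀)) * inv D
        x : Vecᶠ F k
        x i = β W lenW i * (C i + - (σ * A i + τ * B i))
        vanish : ∀ g → D * g ≡ 0# → g ≡ 0#
        vanish g = *≡0 D≢0
        clear : ∀ i → D * (C i + - (σ * A i + τ * B i)) ≡ D * C i + - ((C i₀ * B i₁ + - (C i₁ * B i₀)) * A i + (A i₀ * C i₁ + - (A i₁ * C i₀)) * B i)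
        clear i = solve 7 (λ d j s t a b c → d :* (c :+ :- (s :* j :* a :+ t :* j :* b)) := d :* c :+ :- ((d :* j) :* (s :* a :+ t :* b))) refl D (inv D) (C i₀ * B i₁ + - (C i₁ * B i₀)) (A i₀ * C i₁ + - (A i₁ * C i₀)) (A i) (B i) (C i)
          ∙ cong (λ y → D * C i + - y) (cong (_* ((C i₀ * B i₁ + - (C i₁ * B i₀)) * A i + (A i₀ * C i₁ + - (A i₁ * C i₀)) * B i)) (inv-r D≢0) ∙ *-identityˡ _)
        x₀ : x i₀ ≡ 0#
        x₀ = cong (β W lenW i₀ *_) (vanish _ (clear i₀ ∙ solve 6 (λ a b c a′ b′ c′ → (a :* b′ :+ :- (b :* a′)) :* c :+ :- ((c :* b′ :+ :- (c′ :* b)) :* a :+ (a :* c′ :+ :- (a′ :* c)) :* b) := :0) refl (A i₀) (B i₀) (C i₀) (A i₁) (B i₁) (C i₁))) ∙ zeroʳ _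
        x₁ : x i₁ ≡ 0#
        x₁ = cong (β W lenW i₁ *_) (vanish _ (clear i₁ ∙ solve 6 (λ a b c a′ b′ c′ → (a :* b′ :+ :- (b :* a′)) :* c′ :+ :- ((c :* b′ :+ :- (c′ :* b)) :* a′ :+ (a :* c′ :+ :- (a′ :* c)) :* b′) := :0) refl (A i₀) (B i₀) (C i₀) (A i₁) (B i₁) (C i₁))) ∙ zeroʳ _
        perp : ∀ {y} → y ∈ basis → dot x (col M y) ≡ 0#
        perp mem with ∈-inj {is = i₀ ∷ i₁ ∷ []} {js = W} mem
        ... | inj₂ (_ , here refl , refl) = dot-eʳ x i₀ ∙ x₀
        ... | inj₂ (_ , there (here refl) , refl) = dot-eʳ x i₁ ∙ x₁
        ... | inj₁ (w , w∈ , refl) = begin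
          dot x (λ i → M i w)
            ≡⟨ sum-≗ (allFin k) (λ i → cong (_* M i w) (solve 6 (λ g c s a t b → g :* (c :+ :- (s :* a :+ t :* b)) := :1 :* (g :* c) :+ :1 :* (:- s :* (g :* a) :+ :- t :* (g :* b))) refl (β W lenW i) (C i) σ (A i) τ (B i))) ⟩
          dot (λ i → 1# * (β W lenW i * C i) + 1# * (- σ * (β W lenW i * A i) + - τ * (β W lenW i * B i))) (λ i → M i w)
            ≡⟨ dot-lin {k} 1# 1# βC (λ i → - σ * βA i + - τ * βB i) (λ i → M i w) ∙ cong (λ z → 1# * dot βC (λ i → M i w) + 1# * z) (dot-lin {k} (- σ) (- τ) βA βB (λ i → M i w)) ⟩
          1# * dot (λ i → β W lenW i * C i) (λ i → M i w) + 1# * (- σ * dot (λ i → β W lenW i * A i) (λ i → M i w) + - τ * dot (λ i → β W lenW i * B i) (λ i → M i w))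
            ≡⟨ cong₂ (λ y z → 1# * y + 1# * z) (orthogonality W lenW c b a X permc w∈)
                 (cong₂ (λ y z → - σ * y + - τ * z) (orthogonality W lenW a b c X perm w∈) (orthogonality W lenW b a c X (↭-trans (swap b a refl) perm) w∈)) ⟩
          1# * 0# + 1# * (- σ * 0# + - τ * 0#)
            ≡⟨ solve 2 (λ s t → :1 :* :0 :+ :1 :* (s :* :0 :+ t :* :0) := :0) refl (- σ) (- τ) ⟩
          0# ∎
          where
            βA βB βC : Vecᶠ F k
            βA i = β W lenW i * A i
            βB i = β W lenW i * B i
            βC i = β W lenW i * C i
            permc : c ∷ b ∷ a ∷ W ++ X ↭ allFin m
            permc = ↭-trans (swap c b refl) (↭-trans (prep b (swap c a refl)) (↭-trans (swap b a refl) perm))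

  -- The first two inverted columns span the plane. P i consists of their entries in row i, and Q c
  -- is the coefficient vector (σ, τ) of column c turned into (-τ, σ), so that the bracket
  -- [P i, Q c] is the combination σ, τ of the entries of P i.
  MDS⇒Cauchy : ∀ t m → suc (suc t) ℕ.+ m ≡ suc q → (∀ n → 0 ℕ.< n → n ℕ.< suc (suc t) → nat n ≢ 0#) → t ℕ.+ 3 ℕ.≤ m →
    {M : Mat F (suc (suc t)) m} → MDS M → Cauchy M
  MDS⇒Cauchy t zero _ _ le with () ← ℕₚ.≤-trans (ℕₚ.m≤n+m 3 t) le
  MDS⇒Cauchy t (suc zero) _ _ le with (ℕ.s≤s ()) ← ℕₚ.≤-trans (ℕₚ.m≤n+m 3 t) le
  MDS⇒Cauchy t m@(suc (suc _)) k+m nz le {M} mds = record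
    { P = P
    ; Q = Q
    ; M·br = λ i j → cong (M i j *_) (brPQ i j) ∙ inv-r (entry≢0 mds i j)
    ; P-apart = P-apart
    ; Q-apart = Q-apart
    }
    where
      k = suc (suc t)
      a b : Fin m
      a = zero
      b = suc zero
      P : Fin k → Point
      P i = inv (M i a) , inv (M i b)
      combo : ∀ c → ∃ λ σ → ∃ λ τ → ∀ i → inv (M i c) ≡ σ * inv (M i a) + τ * inv (M i b)
      combo zero = 1# , 0# , λ i → solve 2 (λ x y → x := :1 :* x :+ :0 :* y) refl _ _
      combo (suc zero) = 0# , 1# , λ i → solve 2 (λ x y → y := :0 :* x :+ :1 :* y) refl _ _
      combo (suc (suc c)) = coplanar t m k+m nz mds (((λ ()) ∷ (λ ()) ∷ []) ∷ (((λ ()) ∷ []) ∷ ([] ∷ []))) le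
      Q : Fin m → Point
      Q c = - proj₁ (proj₂ (combo c)) , proj₁ (combo c)
      brPQ : ∀ i c → br (P i) (Q c) ≡ inv (M i c)
      brPQ i c = solve 4 (λ x y s t → x :* s :+ :- (y :* :- t) := s :* x :+ t :* y) refl (inv (M i a)) (inv (M i b)) (proj₁ (combo c)) (proj₁ (proj₂ (combo c)))
        ∙ sym (proj₂ (proj₂ (combo c)) i)
      inverse-minor : ∀ {i j c d} → i ≢ j → c ≢ d → inv (M i c) * inv (M j d) ≢ inv (M i d) * inv (M j c)
      inverse-minor i≢ c≢ eq = minor≢0 mds i≢ c≢ (sym (inv-inv _) ∙ (cong inv (inv-* _ _ ∙ (eq ∙ sym (inv-* _ _))) ∙ inv-inv _))
      P-apart : ∀ {i j} → i ≢ j → br (P i) (P j) ≢ 0#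
      P-apart ne z = inverse-minor {c = a} {d = b} ne (λ ()) (x-y≡0⇒x≡y z)
      Q-apart : ∀ {c d} → c ≢ d → br (Q c) (Q d) ≢ 0#
      -- The minor of the inverted entries in rows 0, 1 and columns c, d factors as [P 0, P 1]
      -- [Q c, Q d], so it would vanish with the second bracket.
      Q-apart {c} {d} ne z = inverse-minor {zero} {suc zero} (λ ()) ne (x-y≡0⇒x≡y (sym (cong₂ (λ x y → x + - y) (cong₂ _*_ (brPQ zero c) (brPQ (suc zero) d)) (cong₂ _*_ (brPQ zero d) (brPQ (suc zero) c)))
        ∙ (plücker (P zero) (P (suc zero)) (Q c) (Q d) ∙ (cong (br (P zero) (P (suc zero)) *_) z ∙ zeroʳ _))))
        where
          plücker : ∀ p r x y → br p x * br r y + - (br p y * br r x) ≡ br p r * br x y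
          plücker (p , p′) (r , r′) (x , x′) (y , y′) = solve 8 (λ p p′ r r′ x x′ y y′ →
            (p :* x′ :+ :- (p′ :* x)) :* (r :* y′ :+ :- (r′ :* y)) :+ :- ((p :* y′ :+ :- (p′ :* y)) :* (r :* x′ :+ :- (r′ :* x)))
            := (p :* r′ :+ :- (p′ :* r)) :* (x :* y′ :+ :- (x′ :* y))) refl p p′ r r′ x x′ y y′

  -- Duality

  _ᵀ : ∀ {k m} → Mat F k m → Mat F m k
  (M ᵀ) j i = M i j

  -- A relation d between m columns of [ I | Mᵀ ] is, up to sign, a row combination c of [ I | M ] that vanishes at the k
  -- complementary columns.
  MDS-transpose : ∀ {k m} {M : Mat F k m} → MDS M → MDS (M ᵀ)
  MDS-transpose {k} {m} {M} mds xs u len d rel {x} x∈xs with complete all ∈all xs u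
    where
      all : List (Idx m k)
      all = map inj₂ (allFin k) ++ map inj₁ (allFin m)
      ∈all : ∀ x → x ∈ all
      ∈all (inj₁ j) = ∈-++⁺ʳ (map inj₂ (allFin k)) (∈-map⁺ inj₁ (∈-allFin j))
      ∈all (inj₂ i) = ∈-++⁺ˡ (∈-map⁺ inj₂ (∈-allFin i))
  ... | ys , p = sym (d̂-in x∈xs) ∙ d̂≡0 x
    where
      all : List (Idx m k)
      all = map inj₂ (allFin k) ++ map inj₁ (allFin m)
      uall : Unique (xs ++ ys)
      uall = Unique-↭ p (Unique-inj (allFin⁺ m) (allFin⁺ k))
      open import Data.List.Membership.DecPropositional (_≟ᴵ_ {m} {k}) using (_∈?_)
      restrict : ∀ {x} → Dec (x ∈ xs) → Carrier
      restrict {x} (yes _) = d x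
      restrict (no _) = 0#
      d̂ : Idx m k → Carrier
      d̂ x = restrict (x ∈? xs)
      d̂-in : ∀ {x} → x ∈ xs → d̂ x ≡ d x
      d̂-in {x} mem with x ∈? xs
      ... | yes _ = refl
      ... | no ∉ = ⊥-elim (∉ mem)
      ys∉xs : ∀ xs {y} → Unique (xs ++ ys) → y ∈ ys → y ∉ xs
      ys∉xs (_ ∷ xs) (r ∷ _) my (here refl) = All.lookup r (∈-++⁺ʳ xs my) refl
      ys∉xs (_ ∷ xs) (_ ∷ u) my (there mx) = ys∉xs xs u my mx
      d̂-out : ∀ {y} → y ∈ ys → d̂ y ≡ 0#
      d̂-out {y} mem with y ∈? xs
      ... | yes ∈xs = ⊥-elim (ys∉xs xs uall mem ∈xs)
      ... | no _ = refl
      c : Vecᶠ F k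
      c i = d̂ (inj₂ i)
      total : ∀ r → dot c (λ i → M i r) + d̂ (inj₁ r) ≡ 0#
      total r = begin
        dot c (λ i → M i r) + d̂ (inj₁ r)
          ≡⟨ cong₂ _+_ (sym (sum-map inj₂ (allFin k))) (sym (sum-e (λ j → d̂ (inj₁ j)) r) ∙ sym (sum-map inj₁ (allFin m))) ⟩
        sumL (map inj₂ (allFin k)) term + sumL (map inj₁ (allFin m)) term
          ≡⟨ sym (sum-++ (map inj₂ (allFin k)) (map inj₁ (allFin m))) ⟩
        sumL all term
          ≡⟨ sum-↭ term p ∙ sum-++ xs ys ⟩
        sumL xs term + sumL ys term
          ≡⟨ cong₂ _+_ (sum-cong xs (λ {x} mem → cong (_* col (M ᵀ) x r) (d̂-in mem)) ∙ rel r) (sum-0 ys (λ {y} mem → cong (_* col (M ᵀ) y r) (d̂-out mem) ∙ zeroˡ _)) ⟩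
        0# + 0#
          ≡⟨ +-identityˡ 0# ⟩
        0# ∎
        where
          open ≡-Reasoning
          term : Idx m k → Carrier
          term x = d̂ x * col (M ᵀ) x r
      zs : List (Idx k m)
      zs = map Sum.swap ys
      uys : Unique ys
      uys = AllPairs-++ˡ ys (Unique-↭ (Permₚ.++-comm xs ys) uall)
      lenys : length ys ≡ k
      lenys = ℕₚ.+-cancelˡ-≡ m (length ys) k (cong (ℕ._+ length ys) (sym len) ∙ (sym (length-++ xs) ∙ (sym (↭-length p)
        ∙ (length-++ (map inj₂ (allFin k)) ∙ (cong₂ ℕ._+_ (length-map inj₂ (allFin k) ∙ length-allFin k) (length-map inj₁ (allFin m) ∙ length-allFin m) ∙ ℕₚ.+-comm k m)))))
      swap-injective : ∀ {x y : Idx m k} → Sum.swap x ≡ Sum.swap y → x ≡ y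
      swap-injective {x} {y} eq = sym (Sumₚ.swap-involutive x) ∙ (cong Sum.swap eq ∙ Sumₚ.swap-involutive y)
      perp : ∀ {z} → z ∈ zs → dot c (col M z) ≡ 0#
      perp mem with ∈-map⁻ Sum.swap mem
      ... | inj₂ i , my , refl = dot-eʳ c i ∙ d̂-out my
      ... | inj₁ j , my , refl = sym (+-identityʳ _) ∙ (cong (dot c (λ i → M i j) +_) (sym (d̂-out my)) ∙ total j)
      c≡0 : ∀ i → c i ≡ 0#
      c≡0 = ⊥-spanning (MDS-spans mds zs (Uniqueₚ.map⁺ swap-injective uys) (length-map Sum.swap ys ∙ lenys)) c perp
      d̂≡0 : ∀ x → d̂ x ≡ 0#
      d̂≡0 (inj₂ i) = c≡0 i
      d̂≡0 (inj₁ j) = sym (+-identityˡ _) ∙ (cong (_+ d̂ (inj₁ j)) (sym (sum-0 (allFin k) (λ {i} _ → cong (_* M i j) (c≡0 i) ∙ zeroˡ _))) ∙ total j)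

  -- Rows and columns exchange their points. One family is negated because the bracket is
  -- antisymmetric: [x, -y] = [y, x].
  Cauchy-transpose : ∀ {k m} {M : Mat F k m} → Cauchy (M ᵀ) → Cauchy M
  Cauchy-transpose {M = M} C = record
    { P = Q
    ; Q = λ j → neg (P j)
    ; M·br = λ i j → cong (M i j *_) (br-neg (Q i) (P j)) ∙ M·br j i
    ; P-apart = Q-apart
    ; Q-apart = λ {i} {j} ne z → P-apart ne (sym (br-neg-neg (P i) (P j)) ∙ z)
    }
    where
      open Cauchy C
      neg : Point → Point
      neg (a , b) = - a , - b
      br-neg : ∀ x y → br x (neg y) ≡ br y x
      br-neg (a , b) (c , d) = solve 4 (λ a b c d → a :* :- d :+ :- (b :* :- c) := c :* b :+ :- (d :* a)) refl a b c d
      br-neg-neg : ∀ x y → br (neg x) (neg y) ≡ br x y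
      br-neg-neg (a , b) (c , d) = solve 4 (λ a b c d → :- a :* :- d :+ :- (:- b :* :- c) := a :* d :+ :- (b :* c)) refl a b c d

  enum-injective : ∀ {i j} → Inverse.to enum i ≡ Inverse.to enum j → i ≡ j
  enum-injective {i} {j} eq = sym (Inverse.strictlyInverseʳ enum i) ∙ (cong (Inverse.from enum) eq ∙ Inverse.strictlyInverseʳ enum j)

  -- The q columns receive the q field elements as affine parameters, the single row takes the
  -- remaining point (1, 0), and the scaling of Q j is dictated by the entry.
  Cauchy-one-row : ∀ m → 1 ℕ.+ m ≡ suc q → {M : Mat F 1 m} → MDS M → Cauchy M
  Cauchy-one-row m m≡ {M} mds = record
    { P = λ _ → 1# , 0#
    ; Q = Q
    ; M·br = λ { zero j → cong (M zero j *_) (solve 2 (λ x g → :1 :* g :+ :- (:0 :* (x :* g)) := g) refl (x j) (g j)) ∙ inv-r (entry≢0 mds zero j) }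
    ; P-apart = λ { {zero} {zero} ne → ⊥-elim (ne refl) }
    ; Q-apart = λ {i} {j} ne z → ne (x-injective (x-y≡0⇒x≡y (*≡0 (*≢0 (g≢0 i) (g≢0 j)) (solve 4 (λ x y g h → g :* h :* (x :+ :- y) := x :* g :* h :+ :- (g :* (y :* h))) refl (x i) (x j) (g i) (g j) ∙ z))))
    }
    where
      x g : Fin m → Carrier
      x j = Inverse.to enum (Fin.cast (ℕₚ.suc-injective m≡) j)
      g j = inv (M zero j)
      g≢0 : ∀ j → g j ≢ 0#
      g≢0 j = inv≢0 (entry≢0 mds zero j)
      Q : Fin m → Point
      Q j = x j * g j , g j
      x-injective : ∀ {i j} → x i ≡ x j → i ≡ j
      x-injective {i} {j} eq = Finₚ.toℕ-injective (sym (Finₚ.toℕ-cast (ℕₚ.suc-injective m≡) i) ∙ (cong toℕ (enum-injective eq) ∙ Finₚ.toℕ-cast (ℕₚ.suc-injective m≡) j))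

  Cauchy-wide : ∀ k m → k ℕ.+ m ≡ suc q → 0 ℕ.< k → k ℕ.< m → (∀ n → 0 ℕ.< n → n ℕ.< k → nat n ≢ 0#) → {M : Mat F k m} → MDS M → Cauchy M
  Cauchy-wide 1 m k+m _ _ _ = Cauchy-one-row m k+m
  Cauchy-wide (suc (suc t)) m k+m _ k<m nz = MDS⇒Cauchy t m k+m nz (subst (ℕ._≤ m) (ℕₚ.+-comm 3 t) k<m)

  -- For k > m the transpose has more columns than rows, and the condition on the characteristic
  -- descends from k to m. For k = m neither matrix has the additional column that `coplanar` asks
  -- for.
  Cauchy-all : ∀ k m → k ℕ.+ m ≡ suc q → 0 ℕ.< k → 0 ℕ.< m → k ≢ m → (∀ n → 0 ℕ.< n → n ℕ.< k → nat n ≢ 0#) → {M : Mat F k m} → MDS M → Cauchy M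
  Cauchy-all k m k+m 0<k 0<m k≢m nz mds with ℕₚ.<-cmp k m
  ... | tri< k<m _ _ = Cauchy-wide k m k+m 0<k k<m nz mds
  ... | tri≈ _ k≡m _ = ⊥-elim (k≢m k≡m)
  ... | tri> _ _ m<k = Cauchy-transpose (Cauchy-wide m k (ℕₚ.+-comm m k ∙ k+m) 0<m m<k (λ n 0<n n<m → nz n 0<n (ℕₚ.<-trans n<m m<k)) (MDS-transpose mds))

  -- Normal rational curves

  -- The Veronese map of degree k - 1, the homogeneous parametrisation of the normal rational curve:
  -- rescaling a point only rescales its column.
  ν : ∀ k → Point → Vecᶠ F k
  ν k (s , t) r = pw s (k ℕ.∸ suc (toℕ r)) * pw t (toℕ r)

  _·_ : Carrier → Point → Point
  c · (s , t) = c * s , c * t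

  ∸-suc-+ : ∀ {k} (r : Fin k) → (k ℕ.∸ suc (toℕ r)) ℕ.+ toℕ r ≡ ℕ.pred k
  ∸-suc-+ {suc k} r = ℕₚ.m∸n+n≡m (ℕ.s≤s⁻¹ (Finₚ.toℕ<n r))

  ν-scale : ∀ k c x r → ν k (c · x) r ≡ pw c (ℕ.pred k) * ν k x r
  ν-scale k c (s , t) r = cong₂ _*_ (pw-* c s a) (pw-* c t b)
    ∙ (solve 4 (λ x y z w → x :* y :* (z :* w) := (x :* z) :* (y :* w)) refl (pw c a) (pw s a) (pw c b) (pw t b)
    ∙ cong (_* (pw s a * pw t b)) (sym (pw-+ c a b) ∙ cong (pw c) (∸-suc-+ r)))
    where
      a = k ℕ.∸ suc (toℕ r)
      b = toℕ r

  br-self : ∀ x → br x x ≡ 0#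
  br-self (a , b) = solve 2 (λ a b → a :* b :+ :- (b :* a) := :0) refl a b

  -- Multiplying the coefficient of y by [x , y] eliminates x and lowers the degree by one.
  ν-independent : ∀ {I : Set} (pt : I → Point) k (xs : List I) → length xs ≡ k → AllPairs (λ x y → br (pt x) (pt y) ≢ 0#) xs → IndepL (λ x → ν k (pt x)) xs
  ν-independent pt (suc k) (x ∷ xs) len (x# ∷ xs#) d rel = λ { (here refl) → dx ; (there m) → dxs m }
    where
      open ≡-Reasoning
      s₀ = proj₁ (pt x)
      t₀ = proj₂ (pt x)
      d′ : _ → Carrier
      d′ y = d y * br (pt x) (pt y)
      lower : ∀ y r → br (pt x) (pt y) * ν k (pt y) r ≡ s₀ * ν (suc k) (pt y) (suc r) + - t₀ * ν (suc k) (pt y) (Fin.inject₁ r)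
      lower y r = begin
        (s₀ * t + - (t₀ * s)) * (pw s a * pw t b)
          ≡⟨ solve 6 (λ s₀ t₀ s t p q → (s₀ :* t :+ :- (t₀ :* s)) :* (p :* q) := s₀ :* (p :* (t :* q)) :+ :- t₀ :* ((s :* p) :* q)) refl s₀ t₀ s t (pw s a) (pw t b) ⟩
        s₀ * (pw s a * pw t (suc b)) + - t₀ * (pw s (suc a) * pw t b)
          ≡⟨ cong₂ (λ m n → s₀ * (pw s a * pw t (suc b)) + - t₀ * (pw s m * pw t n)) (sym (ℕₚ.+-∸-assoc 1 (Finₚ.toℕ<n r)) ∙ cong (k ℕ.∸_) (sym (Finₚ.toℕ-inject₁ r))) (sym (Finₚ.toℕ-inject₁ r)) ⟩
        s₀ * ν (suc k) (pt y) (suc r) + - t₀ * ν (suc k) (pt y) (Fin.inject₁ r) ∎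
        where
          s = proj₁ (pt y)
          t = proj₂ (pt y)
          a = k ℕ.∸ suc (toℕ r)
          b = toℕ r
      rel′ : ∀ r → sumL xs (λ y → d′ y * ν k (pt y) r) ≡ 0#
      rel′ r = begin
        sumL xs (λ y → d′ y * ν k (pt y) r)
          ≡⟨ sym (cong (λ z → d x * z * ν k (pt x) r + sumL xs (λ y → d′ y * ν k (pt y) r)) (br-self (pt x)) ∙ solve 3 (λ d n s → d :* :0 :* n :+ s := s) refl (d x) (ν k (pt x) r) _) ⟩
        sumL (x ∷ xs) (λ y → d′ y * ν k (pt y) r)
          ≡⟨ sum-≗ (x ∷ xs) (λ y → *-assoc _ _ _ ∙ (cong (d y *_) (lower y r) ∙ solve 5 (λ d s a t b → d :* (s :* a :+ :- t :* b) := s :* (d :* a) :+ :- t :* (d :* b)) refl (d y) s₀ (ν (suc k) (pt y) (suc r)) t₀ (ν (suc k) (pt y) (Fin.inject₁ r)))) ⟩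
        sumL (x ∷ xs) (λ y → s₀ * (d y * ν (suc k) (pt y) (suc r)) + - t₀ * (d y * ν (suc k) (pt y) (Fin.inject₁ r)))
          ≡⟨ sum-+ (x ∷ xs) _ _ ∙ cong₂ _+_ (sum-*ˡ (x ∷ xs) s₀ _) (sum-*ˡ (x ∷ xs) (- t₀) _) ⟩
        s₀ * sumL (x ∷ xs) (λ y → d y * ν (suc k) (pt y) (suc r)) + - t₀ * sumL (x ∷ xs) (λ y → d y * ν (suc k) (pt y) (Fin.inject₁ r))
          ≡⟨ cong₂ (λ a b → s₀ * a + - t₀ * b) (rel (suc r)) (rel (Fin.inject₁ r)) ⟩
        s₀ * 0# + - t₀ * 0#
          ≡⟨ solve 2 (λ s t → s :* :0 :+ t :* :0 := :0) refl s₀ (- t₀) ⟩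
        0# ∎
      dxs : ∀ {y} → y ∈ xs → d y ≡ 0#
      dxs {y} m = *≡0 (All.lookup x# m) (*-comm _ _ ∙ ν-independent pt k xs (ℕₚ.suc-injective len) xs# d′ rel′ m)
      only : ∀ r → d x * ν (suc k) (pt x) r ≡ 0#
      only r = sym (cong (d x * ν (suc k) (pt x) r +_) (sum-0 xs (λ {y} m → cong (_* ν (suc k) (pt y) r) (dxs m) ∙ zeroˡ _)) ∙ +-identityʳ _) ∙ rel r
      nonzero : ∃ λ r → ν (suc k) (pt x) r ≢ 0#
      nonzero with s₀ ≟ 0#
      ... | no s≢0 = zero , *≢0 (pw≢0 k s≢0) 1≢0
      ... | yes s≡0 with t₀ ≟ 0#
      ... | no t≢0 = Fin.fromℕ k , λ z → pw≢0 k t≢0 (sym (cong₂ (λ m n → pw s₀ (k ℕ.∸ m) * pw t₀ n) (Finₚ.toℕ-fromℕ k) (Finₚ.toℕ-fromℕ k) ∙ (cong (λ n → pw s₀ n * pw t₀ k) (ℕₚ.n∸n≡0 k) ∙ *-identityˡ _)) ∙ z)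
      -- The zero vector is excluded by its bracket with any other point of the list; if there is no
      -- other point, the degree is 0 and the only coordinate is 1.
      ... | yes t≡0 = origin xs k (ℕₚ.suc-injective len) x#
        where
          origin : ∀ xs k → length xs ≡ k → All (λ y → br (pt x) (pt y) ≢ 0#) xs → ∃ λ r → ν (suc k) (pt x) r ≢ 0#
          origin [] zero _ _ = zero , λ z → 1≢0 (sym (*-identityˡ 1#) ∙ z)
          origin (y ∷ _) _ _ (y# ∷ _) = ⊥-elim (y# (cong₂ (λ a b → a * proj₂ (pt y) + - (b * proj₁ (pt y))) s≡0 t≡0 ∙ solve 2 (λ a b → :0 :* a :+ :- (:0 :* b) := :0) refl _ _))
      dx : d x ≡ 0#
      dx = *≡0 (proj₂ nonzero) (*-comm _ _ ∙ only (proj₁ nonzero))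

  ν-family : ∀ {k} {I : Set} → (I → Vecᶠ F k) → Set
  ν-family {k} {I} H = ∃ λ (pt : I → Point) → (∀ c r → H c r ≡ ν k (pt c) r) × (∀ {c d} → c ≢ d → br (pt c) (pt d) ≢ 0#)

  ν-family-independent : ∀ {k} {I : Set} {H : I → Vecᶠ F k} → ν-family H → ∀ xs → Unique xs → length xs ≡ k → IndepL H xs
  ν-family-independent {k} (pt , H≡ , apart) xs u len d rel = ν-independent pt k xs len (AllPairs.map apart u) d (λ r → sum-≗ xs (λ x → cong (d x *_) (sym (H≡ x r))) ∙ rel r)

  -- Arcs and independent lists

  independent⇒arc : ∀ {k n} {H : Fin n → Vecᶠ F k} → k ℕ.≤ n → (∀ xs → Unique xs → length xs ≡ k → IndepL H xs) → IsArc F H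
  independent⇒arc {k} {n} {H} k≤n ind = k≤n , λ s inc → linIndep s inc , spans s inc
    where
      injective : ∀ {s : Fin k → Fin n} → StrictlyIncreasing F s → ∀ {i j} → s i ≡ s j → i ≡ j
      injective {s} inc {i} {j} eq with Finₚ.<-cmp i j
      ... | tri< lt _ _ = ⊥-elim (Finₚ.<-irrefl eq (inc i j lt))
      ... | tri≈ _ e _ = e
      ... | tri> _ _ gt = ⊥-elim (Finₚ.<-irrefl (sym eq) (inc j i gt))
      indS : ∀ s → StrictlyIncreasing F s → IndepL (λ i → H (s i)) (allFin k)
      indS s inc c rel {i} _ = sym (ĉ-s i) ∙ ind (map s (allFin k)) (Uniqueₚ.map⁺ (injective inc) (allFin⁺ k)) (length-map s (allFin k) ∙ length-allFin k) ĉ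
          (λ r → sum-map s (allFin k) ∙ (sum-≗ (allFin k) (λ i → cong (_* H (s i) r) (ĉ-s i)) ∙ rel r)) (∈-map⁺ s (∈-allFin i))
        where
          ĉ : Fin n → Carrier
          ĉ x = sumL (allFin k) (λ i → c i * e (s i) x)
          ĉ-s : ∀ i → ĉ (s i) ≡ c i
          ĉ-s i = sum-single (allFin k) (allFin⁺ k) (∈-allFin i) _ (λ _ ne → cong (c _ *_) (e-diff (λ eq → ne (injective inc eq))) ∙ zeroʳ _) ∙ (cong (c i *_) (e-same (s i)) ∙ *-identityʳ _)
      linIndep : ∀ s → StrictlyIncreasing F s → LinIndep F (λ i → H (s i))
      linIndep s inc c rel i = indS s inc c (λ r → sym (∑≡sum k _) ∙ rel r) (∈-allFin i)
      spans : ∀ s → StrictlyIncreasing F s → Spans F (λ i → H (s i))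
      spans s inc w with indep⇒spans Fin._≟_ (λ i → H (s i)) (allFin k) (allFin⁺ k) (length-allFin k) (indS s inc) w
      ... | d , eq = d , λ r → ∑≡sum k _ ∙ sym (eq r)

  -- Arcs are defined through increasing index maps, so a list of distinct indices is sorted first;
  -- relations do not depend on the order.
  arc⇒independent : ∀ {k n} {G : Fin n → Vecᶠ F k} → IsArc F G → ∀ xs → Unique xs → length xs ≡ k → IndepL G xs
  arc⇒independent {k} {n} {G} (_ , arc) xs u len d rel x∈xs = go (sort xs) sorted (↭-length p ∙ len) (λ r → sum-↭ _ p ∙ rel r) (∈-resp-↭ (↭-sym p) x∈xs)
    where
      open import Data.List.Sort (Finₚ.≤-decTotalOrder n) using (sort; sort-↭; sort-↗)
      p = sort-↭ xs
      sorted : AllPairs Fin._<_ (sort xs)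
      sorted = AllPairs.zipWith (λ (le , ne) → Finₚ.≤∧≢⇒< le ne) (Sortedₚ.Sorted⇒AllPairs (Finₚ.≤-totalOrder n) (sort-↗ xs) , Unique-↭ (↭-sym p) u)
      increasing : ∀ ys → AllPairs Fin._<_ ys → StrictlyIncreasing F (lookup ys)
      increasing (y ∷ ys) (r ∷ s) zero (suc j) _ = All.lookup r (∈-lookup j)
      increasing (y ∷ ys) (r ∷ s) (suc i) (suc j) lt = increasing ys s i j (ℕ.s<s⁻¹ lt)
      sum-lookup : ∀ ys (f : Fin n → Carrier) → ∑ F (length ys) (λ i → f (lookup ys i)) ≡ sumL ys f
      sum-lookup [] f = refl
      sum-lookup (y ∷ ys) f = cong (f y +_) (sum-lookup ys f)
      go : ∀ ys → AllPairs Fin._<_ ys → length ys ≡ k → (∀ r → sumL ys (λ x → d x * G x r) ≡ 0#) → ∀ {x} → x ∈ ys → d x ≡ 0#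
      go ys s refl rel′ {x} m = cong d (lookup-index m) ∙ proj₁ (arc (lookup ys) (increasing ys s)) (λ i → d (lookup ys i)) (λ r → sum-lookup ys _ ∙ rel′ r) (index m)

  -- The points of the projective line and the curve

  point : Maybe (Fin q) → Point
  point (just j) = 1# , Inverse.to enum j
  point nothing = 0# , 1#

  NRC-point : Fin (suc q) → Point
  NRC-point i = point (unlast F i)

  private
    unlast-injective : ∀ {n} (i j : Fin (suc n)) → unlast F i ≡ unlast F j → i ≡ j
    unlast-injective {zero} zero zero eq = refl
    unlast-injective {suc n} zero zero eq = refl
    unlast-injective {suc n} zero (suc j) eq with unlast F j
    unlast-injective {suc n} zero (suc j) () | just _
    unlast-injective {suc n} zero (suc j) () | nothing
    unlast-injective {suc n} (suc i) zero eq with unlast F i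
    unlast-injective {suc n} (suc i) zero () | just _
    unlast-injective {suc n} (suc i) zero () | nothing
    unlast-injective {suc n} (suc i) (suc j) eq = cong suc (unlast-injective i j (Maybeₚ.map-injective Finₚ.suc-injective eq))

    unlast-inject₁ : ∀ {n} (j : Fin n) → unlast F (Fin.inject₁ j) ≡ just j
    unlast-inject₁ {suc n} zero = refl
    unlast-inject₁ {suc n} (suc j) = cong (Maybe.map suc) (unlast-inject₁ j)

    unlast-fromℕ : ∀ n → unlast F (Fin.fromℕ n) ≡ nothing
    unlast-fromℕ zero = refl
    unlast-fromℕ (suc n) = cong (Maybe.map suc) (unlast-fromℕ n)

  NRC≡ν : ∀ k c r → NRC F k c r ≡ ν k (NRC-point c) r
  NRC≡ν k c r with unlast F c
  ... | just j = sym (cong (_* pw (Inverse.to enum j) (toℕ r)) (pw-1 (k ℕ.∸ suc (toℕ r))) ∙ *-identityˡ _)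
  NRC≡ν (suc k) c r | nothing = sym (cong (pw 0# (k ℕ.∸ toℕ r) *_) (pw-1 (toℕ r)) ∙ (*-identityʳ _ ∙ at k (toℕ r) (ℕ.s≤s⁻¹ (Finₚ.toℕ<n r))))
    where
      at : ∀ k r → r ℕ.≤ k → pw 0# (k ℕ.∸ r) ≡ (if r ℕ.≡ᵇ k then 1# else 0#)
      at zero zero _ = refl
      at (suc k) zero _ = zeroˡ _
      at (suc k) (suc r) le = at k r (ℕ.s≤s⁻¹ le)

  NRC-apart : ∀ {c d} → c ≢ d → br (NRC-point c) (NRC-point d) ≢ 0#
  NRC-apart {c} {d} ne z with unlast F c in ec | unlast F d in ed
  ... | just i | just j = ne (unlast-injective c d (ec ∙ (cong just (sym (enum-injective (x-y≡0⇒x≡y (solve 2 (λ a b → a :+ :- b := :1 :* a :+ :- (b :* :1)) refl (Inverse.to enum j) (Inverse.to enum i) ∙ z)))) ∙ sym ed)))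
  ... | just i | nothing = 1≢0 (solve 1 (λ a → :1 := :1 :* :1 :+ :- (a :* :0)) refl (Inverse.to enum i) ∙ z)
  ... | nothing | just j = 1≢0 (solve 1 (λ a → :1 := :- (:0 :* a :+ :- (:1 :* :1))) refl (Inverse.to enum j) ∙ (cong -_ z ∙ -0#≈0#))
  ... | nothing | nothing = ne (unlast-injective c d (ec ∙ sym ed))

  NRC-ν-family : ∀ k → ν-family (NRC F k)
  NRC-ν-family k = NRC-point , NRC≡ν k , NRC-apart

  -- Dividing by the first coordinate, or by the second one if the first is zero, gives the normal
  -- form (1, u) or (0, 1).
  nonzero-multiple : ∀ x → x ≢ (0# , 0#) → ∃ λ c → ∃ λ μ → μ ≢ 0# × x ≡ μ · NRC-point c
  nonzero-multiple (s , t) ne with s ≟ 0#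
  ... | no s≢0 = Fin.inject₁ j , s , s≢0 , subst (λ u → (s , t) ≡ s · point u) (sym (unlast-inject₁ j)) (cong₂ _,_ (sym (*-identityʳ s)) (sym (cong (s *_) (Inverse.strictlyInverseˡ enum (inv s * t)) ∙ (sym (*-assoc _ _ _) ∙ (cong (_* t) (inv-r s≢0) ∙ *-identityˡ t)))))
    where j = Inverse.from enum (inv s * t)
  ... | yes s≡0 = Fin.fromℕ q , t , (λ t≡0 → ne (cong₂ _,_ s≡0 t≡0)) , subst (λ u → (s , t) ≡ t · point u) (sym (unlast-fromℕ q)) (cong₂ _,_ (s≡0 ∙ sym (zeroʳ t)) (sym (*-identityʳ t)))

  -- Linear equivalence

  prod-1 : {A : Set} (xs : List A) {f : A → Carrier} → (∀ {x} → x ∈ xs → f x ≡ 1#) → prodL xs f ≡ 1#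
  prod-1 [] _ = refl
  prod-1 (x ∷ xs) h = cong₂ _*_ (h (here refl)) (prod-1 xs (λ m → h (there m))) ∙ *-identityˡ 1#

  private
    factor : ∀ {n} → (Fin n → Carrier) → Fin n → Fin n → Carrier
    factor ρ r i = if toℕ r ℕ.≡ᵇ toℕ i then ρ i else 1#

    prod-factor : ∀ {n} (ρ : Fin n → Carrier) r → prodL (allFin n) (factor ρ r) ≡ ρ r
    prod-factor {n} ρ r with ∈-split (∈-allFin r)
    ... | ys , p = prod-↭ (factor ρ r) p ∙ (cong₂ _*_ (if-same r) (prod-1 ys (λ {i} m → if-diff {r = r} {i} (λ { refl → ∉-Unique (Unique-↭ p (allFin⁺ n)) m }))) ∙ *-identityʳ _)

    absorb : ∀ b (x y z : Carrier) → (if b then x else 1#) * y * z ≡ (if b then x * (y * z) else y * z)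
    absorb true x y z = *-assoc x y z
    absorb false x y z = cong (_* z) (*-identityˡ y)

  scaleRows : ∀ {k N} (M : Mat F k N) (ρ : Fin k → Carrier) → (∀ r → ρ r ≢ 0#) → Star (ElemStep F) M (λ r c → ρ r * M r c)
  scaleRows {k} M ρ ρ≢0 = go (allFin k) ◅◅ ≗⇒Star (λ r c → cong (_* M r c) (sym (prod-factor ρ r)))
    where
      go : ∀ rs → Star (ElemStep F) M (λ r c → prodL rs (factor ρ r) * M r c)
      go [] = ≗⇒Star (λ r c → *-identityˡ _)
      go (i ∷ rs) = go rs ◅◅ (rowScale i (ρ i) (ρ≢0 i) (λ r c → absorb (toℕ r ℕ.≡ᵇ toℕ i) (ρ i) (prodL rs (factor ρ r)) (M r c)) ◅ ε)

  scaleColumns : ∀ {k N} (M : Mat F k N) (κ : Fin N → Carrier) → (∀ c → κ c ≢ 0#) → Star (ElemStep F) M (λ r c → κ c * M r c)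
  scaleColumns {N = N} M κ κ≢0 = go (allFin N) ◅◅ ≗⇒Star (λ r c → cong (_* M r c) (sym (prod-factor κ c)))
    where
      go : ∀ cs → Star (ElemStep F) M (λ r c → prodL cs (factor κ c) * M r c)
      go [] = ≗⇒Star (λ r c → *-identityˡ _)
      go (i ∷ cs) = go cs ◅◅ (colScale i (κ i) (κ≢0 i) (λ r c → absorb (toℕ c ℕ.≡ᵇ toℕ i) (κ i) (prodL cs (factor κ c)) (M r c)) ◅ ε)

  module _ {k} (P : Fin (suc k) → Point) (P-apart : ∀ {i j} → i ≢ j → br (P i) (P j) ≢ 0#) where

    -- The barycentric weights of the nodes P; the vanishing factor l = i is replaced by 1.
    ρ : Fin (suc k) → Carrier
    ρ i = inv (prodL (allFin (suc k)) (λ l → if does (l Fin.≟ i) then 1# else br (P i) (P l)))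

    ρ≢0 : ∀ i → ρ i ≢ 0#
    ρ≢0 i = inv≢0 (prod≢0 (allFin (suc k)) (λ {l} _ → nonzero l))
      where
        nonzero : ∀ l → (if does (l Fin.≟ i) then 1# else br (P i) (P l)) ≢ 0#
        nonzero l with l Fin.≟ i
        ... | yes _ = 1≢0
        ... | no ne = P-apart (λ eq → ne (sym eq))

    -- Interpolation at the k + 2 points x and P i, applied to the monomial of degree k that gives
    -- coordinate r. It expresses ν(x) by the vectors ν(P i) with coefficients proportional to ρ i /
    -- [P i, x]: in the coordinates given by k + 1 of its points, the curve is a Cauchy matrix.
    lagrange : ∀ x → (∀ i → br (P i) x ≢ 0#) → ∀ r →
      inv (prodL (allFin (suc k)) (λ l → br x (P l))) * ν (suc k) x r + sumL (allFin (suc k)) (λ i → inv (br (P i) x) * ρ i * ν (suc k) (P i) r) ≡ 0#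
    lagrange x x# r = begin
      inv (prodL L (λ l → br x (P l))) * ν (suc k) x r + sumL L (λ i → inv (br (P i) x) * ρ i * ν (suc k) (P i) r)
        ≡⟨ cong₂ _+_ (*-comm _ _ ∙ cong₂ (λ a b → a * inv b) (sym (forms x)) (sym (prod-map P L)))
             (cong (λ l → sumL l (λ i → inv (br (P i) x) * ρ i * ν (suc k) (P i) r)) (sym (map-proj₁-sel L)) ∙ (sum-map proj₁ (sel L) ∙ sum-cong (sel L) term)) ⟩
      lagrangeTerm φs (x , map P L) + sumL (sel L) (λ p → lagrangeTerm φs (P (proj₁ p) , x ∷ map P (proj₂ p)))
        ≡⟨ cong (lagrangeTerm φs (x , map P L) +_) (sym (sum-map _ (sel L)) ∙ (cong (λ l → sumL l (λ p → lagrangeTerm φs (proj₁ p , x ∷ proj₂ p))) (sym (sel-map P L)) ∙ sym (sum-map _ (sel (map P L))))) ⟩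
      sumL (sel (x ∷ map P L)) (lagrangeTerm φs)
        ≡⟨ interpolation φs (x ∷ map P L) len (All.tabulate (λ m → x-apart (∈-map⁻ P m)) ∷ map-apart (allFin⁺ (suc k))) ⟩
      0# ∎
      where
        open ≡-Reasoning
        L = allFin (suc k)
        a = suc k ℕ.∸ suc (toℕ r)
        b = toℕ r
        φs : List Point
        φs = replicate a (1# , 0#) ++ replicate b (0# , 1#)
        len : suc (length (map P L)) ≡ 2 ℕ.+ length φs
        len = cong suc (length-map P L ∙ (length-allFin (suc k) ∙ cong suc (sym (length-++ (replicate a _) ∙ (cong₂ ℕ._+_ (Listₚ.length-replicate a) (Listₚ.length-replicate b) ∙ ∸-suc-+ r)))))
        prod-replicate : ∀ n φ z → prodL (replicate n φ) (λ ψ → ap ψ z) ≡ pw (ap φ z) n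
        prod-replicate zero φ z = refl
        prod-replicate (suc n) φ z = cong (ap φ z *_) (prod-replicate n φ z)
        forms : ∀ z → prodL φs (λ φ → ap φ z) ≡ ν (suc k) z r
        forms z@(s , t) = prod-++ (replicate a _) (replicate b _) ∙ cong₂ _*_
          (prod-replicate a _ z ∙ cong (λ y → pw y a) (solve 2 (λ s t → :1 :* s :+ :0 :* t := s) refl s t))
          (prod-replicate b _ z ∙ cong (λ y → pw y b) (solve 2 (λ s t → :0 :* s :+ :1 :* t := t) refl s t))
        x-apart : ∀ {y} → (∃ λ i → i ∈ L × y ≡ P i) → br x y ≢ 0#
        x-apart (i , _ , refl) = br-sym≢0 (x# i)
        map-apart : ∀ {xs} → Unique xs → AllPairs (λ y z → br y z ≢ 0#) (map P xs)
        map-apart [] = []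
        map-apart {i ∷ xs} (i# ∷ u) = All.tabulate (λ m → lem (∈-map⁻ P m)) ∷ map-apart u
          where
            lem : ∀ {y} → (∃ λ j → j ∈ xs × y ≡ P j) → br (P i) y ≢ 0#
            lem (j , m , refl) = P-apart (All.lookup i# m)
        term : ∀ {p} → p ∈ sel L → inv (br (P (proj₁ p)) x) * ρ (proj₁ p) * ν (suc k) (P (proj₁ p)) r ≡ lagrangeTerm φs (P (proj₁ p) , x ∷ map P (proj₂ p))
        term {i , rest} m = *-comm _ _ ∙ cong₂ _*_ (sym (forms (P i))) (cong (λ y → inv (br (P i) x) * inv y) ρ-rest ∙ sym (inv-* _ _))
          where
            g : Fin (suc k) → Carrier
            g l = if does (l Fin.≟ i) then 1# else br (P i) (P l)
            perm = sel-↭ L m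
            g-same : g i ≡ 1#
            g-same with i Fin.≟ i
            ... | yes _ = refl
            ... | no ne = ⊥-elim (ne refl)
            g-diff : ∀ {l} → l ≢ i → g l ≡ br (P i) (P l)
            g-diff {l} ne with l Fin.≟ i
            ... | yes eq = ⊥-elim (ne eq)
            ... | no _ = refl
            ρ-rest : prodL L g ≡ prodL (map P rest) (br (P i))
            ρ-rest = prod-↭ g perm ∙ (cong₂ _*_ g-same (prod-cong rest (λ m′ → g-diff (λ { refl → ∉-Unique (Unique-↭ perm (allFin⁺ (suc k))) m′ }))) ∙ (*-identityˡ _ ∙ sym (prod-map P rest)))

  -- The systematic form [ I | M ] of an arc

  module Normalise {k m} (G : Fin (suc k ℕ.+ m) → Vecᶠ F (suc k)) (arcG : ∀ xs → Unique xs → length xs ≡ suc k → IndepL G xs) where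

    private
      K : ℕ
      K = suc k
      initial : List (Fin (K ℕ.+ m))
      initial = map (Fin._↑ˡ m) (allFin K)
      reduced = rowReduce {K} {m} (matrixOf F G) (arcG initial (Uniqueₚ.map⁺ (Finₚ.↑ˡ-injective m _ _) (allFin⁺ K)) (length-map _ (allFin K) ∙ length-allFin K))

    abstract
      reducedMatrix : Mat F K (K ℕ.+ m)
      reducedMatrix = proj₁ reduced

      reduction : matrixOf F G ⇝ reducedMatrix
      reduction = proj₁ (proj₂ reduced)

      reduced-unit : ∀ i r → reducedMatrix r (i Fin.↑ˡ m) ≡ e i r
      reduced-unit = proj₂ (proj₂ reduced)

    block : Mat F K m
    block i j = reducedMatrix i (K Fin.↑ʳ j)

    reduced-col : ∀ x r → reducedMatrix r (join K m x) ≡ col block x r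
    reduced-col (inj₁ i) r = reduced-unit i r
    reduced-col (inj₂ j) r = refl

    sum-join : ∀ (d : Idx K m → Carrier) xs r → sumL (map (join K m) xs) (λ c → d (splitAt K c) * reducedMatrix r c) ≡ sumL xs (λ x → d x * col block x r)
    sum-join d xs r = sum-map (join K m) xs ∙ sum-≗ xs (λ x → cong₂ (λ y z → d y * z) (Finₚ.splitAt-join K m x) (reduced-col x r))

    -- A relation between columns of the reduced matrix is one between the vectors of G.
    MDS-block : MDS block
    MDS-block xs u len d rel {x} x∈xs = sym (cong d (Finₚ.splitAt-join K m x)) ∙
      arcG (map (join K m) xs) (Uniqueₚ.map⁺ join-injective u) (length-map (join K m) xs ∙ len) (λ c → d (splitAt K c))
        (rel← reduction (map (join K m) xs) (λ c → d (splitAt K c)) (λ r → sum-join d xs r ∙ rel r)) (∈-map⁺ (join K m) x∈xs)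
      where
        join-injective : ∀ {x y} → join K m x ≡ join K m y → x ≡ y
        join-injective {x} {y} eq = sym (Finₚ.splitAt-join K m x) ∙ (cong (splitAt K) eq ∙ Finₚ.splitAt-join K m y)

  module _ {k m} (k+m : suc k ℕ.+ m ≡ suc q) (G : Fin (suc k ℕ.+ m) → Vecᶠ F (suc k)) (arcG : ∀ xs → Unique xs → length xs ≡ suc k → IndepL G xs)
    (cauchy : Cauchy (Normalise.block G arcG)) where

    private
      K N : ℕ
      K = suc k
      N = K ℕ.+ m
      open Normalise G arcG
      open Cauchy cauchy

      ptI : Idx K m → Point
      ptI = [ P , Q ]′

      pt : Fin N → Point
      pt c = ptI (splitAt K c)

      br-PQ : ∀ i j → br (P i) (Q j) ≢ 0#
      br-PQ i j z = 1≢0 (sym (M·br i j) ∙ (cong (block i j *_) z ∙ zeroʳ _))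

      ptI-apart : ∀ {x y} → x ≢ y → br (ptI x) (ptI y) ≢ 0#
      ptI-apart {inj₁ i} {inj₁ j} ne = P-apart (λ eq → ne (cong inj₁ eq))
      ptI-apart {inj₁ i} {inj₂ j} ne = br-PQ i j
      ptI-apart {inj₂ i} {inj₁ j} ne = br-sym≢0 (br-PQ j i)
      ptI-apart {inj₂ i} {inj₂ j} ne = Q-apart (λ eq → ne (cong inj₂ eq))

      pt-apart : ∀ {c d} → c ≢ d → br (pt c) (pt d) ≢ 0#
      pt-apart {c} {d} ne = ptI-apart {splitAt K c} {splitAt K d} (λ eq → ne (sym (Finₚ.join-splitAt K m c) ∙ (cong (join K m) eq ∙ Finₚ.join-splitAt K m d)))

      -- The arc on the curve at the points of the Cauchy data of G. By `lagrange` its systematic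
      -- form is the same Cauchy matrix up to scalings of rows and columns, so G and H are
      -- equivalent through their reduced matrices.
      H : Fin N → Vecᶠ F K
      H c = ν K (pt c)

      arcH : ∀ xs → Unique xs → length xs ≡ K → IndepL H xs
      arcH = ν-family-independent (pt , (λ _ _ → refl) , pt-apart)

      module NH = Normalise H arcH

      g : Fin m → Carrier
      g j = inv (prodL (allFin K) (λ l → br (Q j) (P l)))

      g≢0 : ∀ j → g j ≢ 0#
      g≢0 j = inv≢0 (prod≢0 (allFin K) (λ {l} _ → br-sym≢0 (br-PQ l j)))

      w : Fin K → Carrier
      w = ρ P P-apart

      inv-br : ∀ i j → inv (br (P i) (Q j)) ≡ block i j
      inv-br i j = sym (inv-unique (br-PQ i j) (*-comm _ _ ∙ M·br i j))

      -- The Lagrange relation between ν(Q j) and the vectors ν(P i) survives the reduction of H.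
      -- There the latter are unit vectors, so row r isolates a single entry.
      relation : ∀ j r → g j * NH.block r j + block r j * w r ≡ 0#
      relation j r = cong (g j * NH.block r j +_) (sym (sum-e (λ i → block i j * w i) r) ∙ sym (sum-map inj₁ (allFin K)))
          ∙ (sym (NH.sum-join d (inj₂ j ∷ map inj₁ (allFin K)) r) ∙ rel→ NH.reduction (map (join K m) (inj₂ j ∷ map inj₁ (allFin K))) (λ c → d (splitAt K c)) original r)
        where
          d : Idx K m → Carrier
          d = [ (λ i → block i j * w i) , (λ _ → g j) ]′
          original : Rel (matrixOf F H) (map (join K m) (inj₂ j ∷ map inj₁ (allFin K))) (λ c → d (splitAt K c))
          original r = cong₂ _+_ (cong (λ y → d y * ν K (ptI y) r) (Finₚ.splitAt-↑ʳ K m j))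
              (sum-map (join K m) (map inj₁ (allFin K)) ∙ (sum-map inj₁ (allFin K) ∙ sum-≗ (allFin K) (λ i → cong (λ y → d y * ν K (ptI y) r) (Finₚ.splitAt-↑ˡ K i m) ∙ cong (λ y → y * w i * ν K (P i) r) (sym (inv-br i j)))))
            ∙ lagrange P P-apart (Q j) (λ i → br-PQ i j) r

      block≡ : ∀ j r → NH.block r j ≡ - inv (g j) * (w r * block r j)
      block≡ j r = *-cancelˡ (g≢0 j) (begin
        g j * NH.block r j ≡⟨ solve 2 (λ x y → x := (x :+ y) :+ :- y) refl _ (block r j * w r) ⟩
        (g j * NH.block r j + block r j * w r) + - (block r j * w r) ≡⟨ cong (_+ - (block r j * w r)) (relation j r) ∙ +-identityˡ _ ⟩
        - (block r j * w r) ≡⟨ sym (cong (λ y → - (y * (w r * block r j))) (inv-r (g≢0 j)) ∙ solve 2 (λ w b → :- (:1 :* (w :* b)) := :- (b :* w)) refl (w r) (block r j)) ⟩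
        - (g j * inv (g j) * (w r * block r j)) ≡⟨ solve 3 (λ a b c → :- (a :* b :* c) := a :* (:- b :* c)) refl (g j) (inv (g j)) (w r * block r j) ⟩
        g j * (- inv (g j) * (w r * block r j)) ∎)
        where open ≡-Reasoning

      -- Scaling row i by `w i` spoils the unit column i, and the column factor `inv (w i)` repairs
      -- it; the factors of the other columns come from `block≡`.
      κI : Idx K m → Carrier
      κI = [ (λ i → inv (w i)) , (λ j → - inv (g j)) ]′

      κI≢0 : ∀ x → κI x ≢ 0#
      κI≢0 (inj₁ i) = inv≢0 (ρ≢0 P P-apart i)
      κI≢0 (inj₂ j) z = inv≢0 (g≢0 j) (sym (-‿involutive _) ∙ (cong -_ z ∙ -0#≈0#))

      matchI : ∀ x r → col NH.block x r ≡ κI x * (w r * col block x r)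
      matchI (inj₂ j) r = block≡ j r
      matchI (inj₁ i) r with i Fin.≟ r
      ... | yes refl = sym (cong (inv (w i) *_) (*-identityʳ _) ∙ inv-l (ρ≢0 P P-apart i))
      ... | no _ = solve 2 (λ a b → :0 := a :* (b :* :0)) refl _ _

      match : ∀ r c → NH.reducedMatrix r c ≡ κI (splitAt K c) * (w r * reducedMatrix r c)
      match r c = cong (NH.reducedMatrix r) (sym (Finₚ.join-splitAt K m c)) ∙ (NH.reduced-col x r ∙ (matchI x r
        ∙ cong (λ y → κI x * (w r * y)) (sym (reduced-col x r) ∙ cong (reducedMatrix r) (Finₚ.join-splitAt K m c))))
        where x = splitAt K c

    G~ν : Star (ElemStep F) (matrixOf F G) (matrixOf F H)
    G~ν = to reduction ◅◅ (scaleRows reducedMatrix w (ρ≢0 P P-apart) ◅◅ (scaleColumns _ (λ c → κI (splitAt K c)) (λ c → κI≢0 (splitAt K c)) ◅◅ (≗⇒Star match ◅◅ from NH.reduction)))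

    private
      not-origin : 0 ℕ.< m → ∀ c → pt c ≢ (0# , 0#)
      not-origin 0<m c eq = pt-apart (proj₂ (another c)) (cong (λ z → br z (pt (proj₁ (another c)))) eq ∙ lem (pt (proj₁ (another c))))
        where
          lem : ∀ z → br (0# , 0#) z ≡ 0#
          lem (a , b) = solve 2 (λ a b → :0 :* b :+ :- (:0 :* a) := :0) refl a b
          another : ∀ (c : Fin N) → ∃ λ d → c ≢ d
          another zero = Fin.opposite zero , λ eq → ℕₚ.<-irrefl (cong toℕ eq) (subst (0 ℕ.<_) (sym (Finₚ.opposite-prop {N} zero)) (ℕₚ.≤-trans 0<m (ℕₚ.m≤n+m m k)))
          another (suc c) = zero , λ ()

    module _ (0<m : 0 ℕ.< m) where
      private
        multiple : ∀ c → ∃ λ d → ∃ λ μ → μ ≢ 0# × pt c ≡ μ · NRC-point d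
        multiple c = nonzero-multiple (pt c) (not-origin 0<m c)

        abstract
          idx : Fin N → Fin (suc q)
          idx c = proj₁ (multiple c)

          μ : Fin N → Carrier
          μ c = proj₁ (proj₂ (multiple c))

          μ≢0 : ∀ c → μ c ≢ 0#
          μ≢0 c = proj₁ (proj₂ (proj₂ (multiple c)))

          pt≡ : ∀ c → pt c ≡ μ c · NRC-point (idx c)
          pt≡ c = proj₂ (proj₂ (proj₂ (multiple c)))

        idx-injective : ∀ {c d} → idx c ≡ idx d → c ≡ d
        idx-injective {c} {d} eq with c Fin.≟ d
        ... | yes e = e
        ... | no ne = ⊥-elim (pt-apart ne (cong₂ br (pt≡ c) (pt≡ d ∙ cong (λ x → μ d · NRC-point x) (sym eq)) ∙ parallel (μ c) (μ d) (NRC-point (idx c))))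
          where
            parallel : ∀ a b x → br (a · x) (b · x) ≡ 0#
            parallel a b (s , t) = solve 4 (λ a b s t → a :* s :* (b :* t) :+ :- (a :* t :* (b :* s)) := :0) refl a b s t

        -- N = q + 1 distinct points exhaust the projective line.
        indices : allFin (suc q) ↭ map idx (allFin N)
        indices = exhaust (allFin (suc q)) ∈-allFin (map idx (allFin N)) (Uniqueₚ.map⁺ idx-injective (allFin⁺ N))
          (length-map idx (allFin N) ∙ (length-allFin N ∙ (k+m ∙ sym (length-allFin (suc q)))))

        preimage : ∀ c → ∃ λ d → c ≡ idx d
        preimage c with ∈-map⁻ idx (∈-resp-↭ indices (∈-allFin c))
        ... | d , _ , eq = d , eq

        ν≡ : ∀ r c → NRC F K (idx c) r ≡ inv (pw (μ c) k) * H c r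
        ν≡ r c = *-cancelˡ μ′≢0 (begin
          μ′ * NRC F K (idx c) r ≡⟨ cong (μ′ *_) (NRC≡ν K (idx c) r) ∙ sym (ν-scale K (μ c) (NRC-point (idx c)) r) ⟩
          ν K (μ c · NRC-point (idx c)) r ≡⟨ cong (λ x → ν K x r) (sym (pt≡ c)) ⟩
          H c r ≡⟨ sym (cong (_* H c r) (inv-r μ′≢0) ∙ *-identityˡ _) ⟩
          μ′ * inv μ′ * H c r ≡⟨ *-assoc _ _ _ ⟩
          μ′ * (inv μ′ * H c r) ∎)
          where
            open ≡-Reasoning
            μ′ = pw (μ c) k
            μ′≢0 : μ′ ≢ 0#
            μ′≢0 = pw≢0 k (μ≢0 c)

      G~NRC∘idx : Star (ElemStep F) (matrixOf F G) (λ r c → NRC F K (idx c) r)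
      G~NRC∘idx = G~ν ◅◅ (scaleColumns _ (λ c → inv (pw (μ c) k)) (λ c → inv≢0 (pw≢0 k (μ≢0 c))) ◅◅ ≗⇒Star ν≡)

      NRC-reindexing : ∃ λ (σ : Fin N → Fin (suc q)) → Star (ElemStep F) (matrixOf F G) (λ r c → NRC F K (σ c) r)
        × (∃ λ (τ : Fin (suc q) → Fin N) → (∀ c → σ (τ c) ≡ c) × (∀ c → τ (σ c) ≡ c))
      NRC-reindexing = idx , G~NRC∘idx , (λ c → proj₁ (preimage c)) , (λ c → sym (proj₂ (preimage c))) , (λ c → idx-injective (sym (proj₂ (preimage (idx c)))))

  -- Uniqueness of the arc of size q + 1

  uniqueness : ∀ k → (∀ n → 0 ℕ.< n → n ℕ.< k → nat n ≢ 0#) → k ℕ.≤ q → 2 ℕ.* k ≢ q ℕ.+ 1 →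
    (G : Fin (suc q) → Vecᶠ F k) → IsArc F G → LinearlyEquivalent F G (NRC F k)
  uniqueness zero nz k≤q ne G arc = ≗⇒Star (λ ())
  uniqueness (suc k) nz k≤q ne G arc = uncast (transport (suc q ℕ.∸ suc k) (suc q) refl (ℕₚ.m+[n∸m]≡n (ℕₚ.m≤n⇒m≤1+n k≤q)) G arc)
    where
      uncast : Star (ElemStep F) (matrixOf F G) (λ r c → NRC F (suc k) (Fin.cast refl c) r) → LinearlyEquivalent F G (NRC F (suc k))
      uncast star = star ◅◅ ≗⇒Star (λ r c → cong (λ x → NRC F (suc k) x r) (sym (Finₚ.cast-is-id refl c)))
      reindex : ∀ {N} (N≡ : N ≡ suc q) (G : Fin N → Vecᶠ F (suc k)) →
        (∃ λ (σ : Fin N → Fin (suc q)) → Star (ElemStep F) (matrixOf F G) (λ r c → NRC F (suc k) (σ c) r)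
          × (∃ λ (τ : Fin (suc q) → Fin N) → (∀ c → σ (τ c) ≡ c) × (∀ c → τ (σ c) ≡ c))) →
        Star (ElemStep F) (matrixOf F G) (λ r c → NRC F (suc k) (Fin.cast N≡ c) r)
      reindex {N} N≡ G (σ , star , τ , στ , τσ) = star ◅◅ (colPerm (Perm.permutation f h fh hf) (λ r c → cong (λ x → NRC F (suc k) x r) (sym (στ (Fin.cast N≡ c)))) ◅ ε)
        where
          f h : Fin N → Fin N
          f c = τ (Fin.cast N≡ c)
          h c = Fin.cast (sym N≡) (σ c)
          fh : ∀ c → f (h c) ≡ c
          fh c = cong τ (Finₚ.cast-trans (sym N≡) N≡ (σ c) ∙ Finₚ.cast-is-id refl (σ c)) ∙ τσ c
          hf : ∀ c → h (f c) ≡ c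
          hf c = cong (Fin.cast (sym N≡)) (στ (Fin.cast N≡ c)) ∙ (Finₚ.cast-trans N≡ (sym N≡) c ∙ Finₚ.cast-is-id refl c)
      -- The number of vectors is a variable N so that suc k + m can be substituted for it;
      -- `Fin.cast` then leads back to the q + 1 columns of the curve.
      transport : ∀ m N (N≡ : N ≡ suc q) → suc k ℕ.+ m ≡ N → (G : Fin N → Vecᶠ F (suc k)) → IsArc F G →
        Star (ElemStep F) (matrixOf F G) (λ r c → NRC F (suc k) (Fin.cast N≡ c) r)
      transport m _ N≡ refl G arc = reindex N≡ G (NRC-reindexing N≡ G ind (Cauchy-all (suc k) m N≡ (ℕ.s≤s ℕ.z≤n) 0<m k≢m nz (Normalise.MDS-block G ind)) 0<m)
        where
          ind : ∀ xs → Unique xs → length xs ≡ suc k → IndepL G xs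
          ind = arc⇒independent arc
          0<m : 0 ℕ.< m
          0<m = ℕₚ.+-cancelˡ-< (suc k) 0 m (subst (ℕ._< suc k ℕ.+ m) (sym (ℕₚ.+-identityʳ (suc k))) (ℕₚ.≤-trans (ℕ.s≤s k≤q) (ℕₚ.≤-reflexive (sym N≡))))
          -- If k and m agreed, then 2k = k + m = q + 1.
          k≢m : suc k ≢ m
          k≢m eq = ne (cong (suc k ℕ.+_) (ℕₚ.+-identityʳ (suc k) ∙ eq) ∙ (N≡ ∙ ℕₚ.+-comm 1 q))

  -- The multiples of 1 by 0, ..., p - 1 are distinct, because the difference of two of them is
  -- again a multiple by a positive integer below p.
  characteristic≤q : ∀ p → (∀ m → 0 ℕ.< m → m ℕ.< p → nat m ≢ 0#) → p ℕ.≤ q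
  characteristic≤q p nz with complete allF ∈-allF (applyUpTo nat p) (Uniqueₚ.applyUpTo⁺₁ nat p distinct)
    where
      distinct : ∀ {i j} → i ℕ.< j → j ℕ.< p → nat i ≢ nat j
      distinct {i} {j} i<j j<p eq = nz (j ℕ.∸ i) (ℕₚ.m<n⇒0<n∸m i<j) (ℕₚ.≤-<-trans (ℕₚ.m∸n≤m j i) j<p)
        (solve 2 (λ a b → b := (a :+ b) :+ :- a) refl (nat i) _ ∙ (cong (_+ - nat i) (sym (nat-+ i (j ℕ.∸ i)) ∙ (cong nat (ℕₚ.m+[n∸m]≡n (ℕₚ.<⇒≤ i<j)) ∙ sym eq)) ∙ -‿inverseʳ _))
  ... | ys , perm = ℕₚ.≤-trans (ℕₚ.m≤m+n p (length ys)) (ℕₚ.≤-reflexive (cong (ℕ._+ length ys) (sym (Listₚ.length-applyUpTo nat p)) ∙ (sym (length-++ (applyUpTo nat p)) ∙ (sym (↭-length perm) ∙ length-allF))))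

open import Data.Nat using (ℕ; suc; _+_; _*_; _∸_; _≤_)
open import Data.Fin using (Fin)
open import Data.Product using (_×_)
open import Relation.Binary.PropositionalEquality using (_≢_)

theorem1p13 : (F : FiniteField) (p : ℕ) → IsCharacteristic F p →
    ((k : ℕ) → k ≤ p → (G : Fin (2 * k ∸ 2) → Vecᶠ F k) → IsArc F G →
    InColumnSpaceH0 F k (2 * k ∸ 2))
    ×
    ((k : ℕ) → k ≤ p → 2 * k ≢ FiniteField.q F + 1 →
    IsArc F (NRC F k)
    × ((G : Fin (suc (FiniteField.q F)) → Vecᶠ F k) → IsArc F G →
    LinearlyEquivalent F G (NRC F k)))
theorem1p13 F p (_ , _ , below-p) =
    (λ k k≤p _ _ → columnSpace k (below k≤p))
  , (λ k k≤p k≢ → let k≤q = ℕₚ.≤-trans k≤p (characteristic≤q p below-p) in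
        independent⇒arc (ℕₚ.m≤n⇒m≤1+n k≤q) (ν-family-independent (NRC-ν-family k))
      , uniqueness k (below k≤p) k≤q k≢)
  where
    open ArcClassification F using (columnSpace; independent⇒arc; ν-family-independent; NRC-ν-family; uniqueness; characteristic≤q)
    below : ∀ {k} → k ≤ p → ∀ m → 0 ℕ.< m → m ℕ.< k → _×1 F m ≢ FiniteField.0# F
    below k≤p m 0<m m<k = below-p m 0<m (ℕₚ.<-≤-trans m<k k≤p)
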